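{- Let $f_k=\prod_{j=1}^{\infty}(1-q^{kj})$ and let $p_8(n)$ be defined by $\sum_{n\ge0}p_8(n)q^n=1/f_1^8$. Define the infinite matrix $M=(m_{j,k})_{j,k\ge1}$ by: $m_{1,1}=8$, $m_{1,k}=0$ for $k\ge2$; $m_{2,1}=1$, $m_{2,2}=128$, $m_{2,k}=0$ for $k\ge3$; $m_{j,1}=0$ for $j\ge3$; and $m_{j,k}=16m_{j-1,k-1}+m_{j-2,k-1}$ for $j\ge3$, $k\ge2$. Define the infinite matrix $(x_{\alpha,j})_{\alpha,j\ge1}$ by $x_{1,1}=8$, $x_{1,k}=0$ for $k\ge2$, and \[x_{\alpha+1,j}=\begin{cases}\sum_{i=1}^{\infty}x_{\alpha,i}\,m_{3i,i+j} & \text{if } \alpha \text{ is odd},\\ \sum_{i=1}^{\infty}x_{\alpha,i}\,m_{3i+1,i+j} & \text{if } \alpha \text{ is even}.\end{cases}\] Then for every positive integer $\alpha$, \[\sum_{n=0}^{\infty} p_8\!\left(2^{2\alpha-1}n + \tfrac{2^{2\alpha-1}+1}{3}\right)q^{n+1}=\frac{1}{f_2^8}\sum_{j=1}^{(4^{\alpha}-1)/3}x_{2\alpha-1,j}\, q^j \frac{f_2^{24j}}{f_1^{24j}}\] and \[\sum_{n=0}^{\infty} p_8\!\left(2^{2\alpha}n + \tfrac{2^{2\alpha+1}+1}{3}\right)q^{n+1}=\frac{1}{f_1^8}\sum_{j=1}^{2(4^{\alpha}-1)/3}x_{2\alpha,j}\, q^j \frac{f_2^{24j}}{f_1^{24j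}}.\]
   Context: The sums defining $x_{\alpha+1,j}$ have only finitely many nonzero terms. -}

module Defs where

open import Data.Nat as ℕ using (ℕ; zero; suc)
open import Data.Bool using (Bool; true; false; not; if_then_else_)
open import Data.List using (List; []; _∷_)
open import Data.Integer using (ℤ; +_; 0ℤ; 1ℤ; _+_; _*_; -_)

sumFrom : ℕ → ℕ → (ℕ → ℤ) → ℤ
sumFrom a zero    f = 0ℤ
sumFrom a (suc n) f = f a + sumFrom (suc a) n f

Σ₀ : ℕ → (ℕ → ℤ) → ℤ
Σ₀ n f = sumFrom 0 (suc n) f

Σ₁ : ℕ → (ℕ → ℤ) → ℤ
Σ₁ n f = sumFrom 1 n f

-- Formal power series over ℤ, as coefficient functions (n ↦ [q^n])

PS : Set
PS = ℕ → ℤ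

𝟙 : PS
𝟙 zero    = 1ℤ
𝟙 (suc _) = 0ℤ

qpow : ℕ → PS
qpow e n = if e ℕ.≡ᵇ n then 1ℤ else 0ℤ

infixl 6 _⊕_ _⊖_
infixl 7 _⊛_

_⊕_ : PS → PS → PS
(a ⊕ b) n = a n + b n

_⊖_ : PS → PS → PS
(a ⊖ b) n = a n + - b n

_⊛_ : PS → PS → PS
(a ⊛ b) n = Σ₀ n (λ i → a i * b (n ℕ.∸ i))

scale : ℤ → PS → PS
scale c a n = c * a n

pow : PS → ℕ → PS
pow a zero    = 𝟙
pow a (suc k) = a ⊛ pow a k

psum : ℕ → (ℕ → PS) → PS
psum N F n = Σ₁ N (λ j → F j n)

-- Multiplicative inverse of a power series with constant term 1:
-- b 0 = 1,  b (n+1) = - Σ_{i=1}^{n+1} a i * b (n+1-i).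
-- invRev a n = [b n, b (n-1), ..., b 0]
dotFrom : PS → ℕ → List ℤ → ℤ
dotFrom a i []       = 0ℤ
dotFrom a i (b ∷ bs) = a i * b + dotFrom a (suc i) bs

invRev : PS → ℕ → List ℤ
invRev a zero    = 1ℤ ∷ []
invRev a (suc n) = (- dotFrom a 1 (invRev a n)) ∷ invRev a n

headℤ : List ℤ → ℤ
headℤ []      = 0ℤ
headℤ (b ∷ _) = b

inv : PS → PS
inv a n = headℤ (invRev a n)

finProd : ℕ → ℕ → PS
finProd k zero    = 𝟙
finProd k (suc N) = finProd k N ⊛ (𝟙 ⊖ qpow (k ℕ.* suc N))

-- For k ≥ 1, the factors with j > n do not affect the coefficient of q^n.
f : ℕ → PS
f k n = finProd k n n

p₈ : ℕ → ℤ
p₈ = inv (pow (f 1) 8)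

-- The matrix M = (m_{j,k})_{j,k ≥ 1}  (index 0 unused, set to 0)

m : ℕ → ℕ → ℤ
m 1 1 = + 8
m 2 1 = + 1
m 2 2 = + 128
m (suc (suc (suc j))) (suc (suc k)) = + 16 * m (suc (suc j)) (suc k) + m (suc j) (suc k)
m _ _ = 0ℤ

odd : ℕ → Bool
odd zero    = false
odd (suc n) = not (odd n)

-- The matrix (x_{α,j})_{α,j ≥ 1}  (index 0 unused).
-- The infinite sum over i is truncated at i ≤ 2j: for i > 2j one has
-- i + j < 3i/2 ≤ (least column index of a nonzero entry in rows 3i, 3i+1),
-- so all omitted terms vanish (m_{r,k} ≠ 0 implies k ≥ r/2).
x : ℕ → ℕ → ℤ
x zero j = 0ℤ
x (suc zero) (suc zero) = + 8
x (suc zero) _ = 0ℤ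
x (suc (suc a)) j =
  Σ₁ (2 ℕ.* j) (λ i → x (suc a) i *
     (if odd (suc a) then m (3 ℕ.* i) (i ℕ.+ j) else m (3 ℕ.* i ℕ.+ 1) (i ℕ.+ j)))

shiftSeq : (ℕ → ℤ) → PS
shiftSeq g zero    = 0ℤ
shiftSeq g (suc n) = g n

{-# OPTIONS --safe #-}
-- Write T = q f₂²⁴/f₁²⁴ and w = q f₄⁸/f₁⁸.  Jacobi's identity f₁(−q)⁸ − f₁(q)⁸ = 16 q f₄⁸ together
-- with f₁(q) f₁(−q) f₄ = f₂³ says that w(q) and w(−q) are the roots of X² = T(q²) (16 X + 1).  Hence
-- the even parts of the powers of w obey the recursion defining M, and since T(q) T(q²) = w³, the even
-- parts of T^i and w T^i are T^(−i) times the rows 3i and 3i + 1 of M.  Passing from one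
-- level of the theorem to the next is taking even parts, after multiplying by q at even levels.
--
-- Jacobi's identity reduces to Gauss's φ(−q) = f₁²/f₂ = 1 + 2 Σ (−1)^s q^(s²), proved with Shanks's
-- finite telescoping sum.  The series gives φ(q) + φ(−q) = 2 φ(q⁴) and the product gives
-- φ(q) φ(−q) = φ(−q²)².  These two relations make the defect of φ(q)² + φ(−q)² = 2 φ(q²)², and then
-- that of Jacobi's identity, satisfy a functional equation relating δ(q) to δ(q²), which forces δ = 0
-- by comparing orders of vanishing.
module Submission where

open import Defs
open import Algebra.Bundles using (CommutativeRing)
import Algebra.Solver.Ring
import Algebra.Solver.Ring.AlmostCommutativeRing as ACR
open import Data.Bool using (false; not)
open import Data.Integer using (ℤ; 0ℤ; 1ℤ; +_)
import Data.Integer as ℤ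
import Data.Integer.Properties as ℤₚ
open import Data.Integer.Solver using (module +-*-Solver)
open import Data.Maybe using (Maybe; just; nothing)
open import Data.Nat using (ℕ; zero; suc; _+_; _*_; _∸_; _^_; _≤_; _<_; z≤n; s≤s; _≤′_; ≤′-refl; ≤′-step)
import Data.Nat.Properties as ℕₚ
import Data.Nat.Solver
open import Data.Nat.DivMod using (_/_; m*n/n≡m)
open import Data.Product using (_×_; _,_)
open import Data.Sum using (inj₁; inj₂)
open import Function using (_∘_)
open import Level using (0ℓ)
open import Relation.Nullary using (yes; no)
open import Relation.Binary.PropositionalEquality using (_≡_; refl; sym; trans; cong; cong₂; subst; module ≡-Reasoning)

-- The alternation of the prefactors and that of the rows 3i and 3i + 1 have one cause. At odd
-- levels 1/f₂⁸ is a series in q² and leaves the even part as 1/f₁⁸, so T^i stands alone. At even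
-- levels 1/f₁⁸ is no series in q², but q/f₁⁸ = w/f₄⁸: this is why q is multiplied in, it supplies
-- one factor w, and 1/f₄⁸ leaves the even part as 1/f₂⁸.
--
-- The theta relations determine only the square of H = f₁(-q)⁸ - f₁(q)⁸ from series in q², not H
-- itself. With G = 16 q f₄⁸ the defect δ = H - G is therefore reached through H² - G² = (H + G) δ.
-- Since H + G = 32 q + ..., this factor costs one order of vanishing, and the comparison with δ(q²)
-- starts only once δ is known to vanish to order 2, which is checked on two coefficients.
--
-- No limits and no fractions are used. A product identity is proved for finite products whose
-- lengths make it exact, then read modulo q^(n+1) for every n. Inverses exist only for series with
-- constant term 1; powers of T and the integers 2 and 32 are cancelled instead.

private
  module ℕ-Solver = Data.Nat.Solver.+-*-Solver
  module ℤ-Solver = +-*-Solver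

-- The commutative ring of formal power series

infix 4 _≈_ _≈[_]_

-- A record, so that both series can be read off from the type of a proof; a bare pointwise equality
-- would show only their coefficients.
record _≈_ (a b : PS) : Set where
  constructor pointwise
  field at : ∀ n → a n ≡ b n
open _≈_

-- Congruence modulo q^(n+1), through which finite products and partial sums are passed to the
-- infinite ones.
record _≈[_]_ (a : PS) (n : ℕ) (b : PS) : Set where
  constructor upTo
  field below : ∀ i → i ≤ n → a i ≡ b i
open _≈[_]_

tail : PS → PS
tail a n = a (suc n)

-- The ring operations are opaque so that unification and the ring solver
-- treat them as symbols instead of unfolding convolutions.
infixl 6 _⊞_
infixl 7 _⊠_
infix 8 ⊟_

opaque
  _⊞_ : PS → PS → PS
  _⊞_ = _⊕_

  ⊟_ : PS → PS
  (⊟ a) n = ℤ.- a n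

  _⊠_ : PS → PS → PS
  _⊠_ = _⊛_

  const : ℤ → PS
  const c zero    = c
  const c (suc _) = 0ℤ

  ⊞-at : ∀ a b n → (a ⊞ b) n ≡ a n ℤ.+ b n
  ⊞-at a b n = refl

  ⊟-at : ∀ a n → (⊟ a) n ≡ ℤ.- a n
  ⊟-at a n = refl

  ⊛≡⊠ : ∀ a b → a ⊛ b ≡ a ⊠ b
  ⊛≡⊠ a b = refl

  const-zero : ∀ c → const c 0 ≡ c
  const-zero c = refl

  const-suc : ∀ c n → const c (suc n) ≡ 0ℤ
  const-suc c n = refl

  private
    sumFrom-suc : ∀ a n g → sumFrom (suc a) n g ≡ sumFrom a n (g ∘ suc)
    sumFrom-suc a zero    g = refl
    sumFrom-suc a (suc n) g = cong (λ s → g (suc a) ℤ.+ s) (sumFrom-suc (suc a) n g)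

  ⊠-zero : ∀ a b → (a ⊠ b) 0 ≡ a 0 ℤ.* b 0
  ⊠-zero a b = ℤₚ.+-identityʳ (a 0 ℤ.* b 0)

  -- Coefficientwise form of a b = a(0) b + q (`tail a`) b. The ring laws are proved by induction on
  -- the coefficient along this recursion rather than by rearranging double sums.
  ⊠-suc : ∀ a b n → (a ⊠ b) (suc n) ≡ a 0 ℤ.* b (suc n) ℤ.+ (tail a ⊠ b) n
  ⊠-suc a b n = cong (λ s → a 0 ℤ.* b (suc n) ℤ.+ s)
    (sumFrom-suc 0 (suc n) (λ i → a i ℤ.* b (suc n ∸ i)))

0ₛ 1ₛ : PS
0ₛ = const 0ℤ
1ₛ = const 1ℤ

0ₛ-at : ∀ n → 0ₛ n ≡ 0ℤ
0ₛ-at zero    = const-zero 0ℤ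
0ₛ-at (suc n) = const-suc 0ℤ n

≈-refl : ∀ {a} → a ≈ a
≈-refl = pointwise λ _ → refl

≈-sym : ∀ {a b} → a ≈ b → b ≈ a
≈-sym p = pointwise λ n → sym (at p n)

≈-trans : ∀ {a b c} → a ≈ b → b ≈ c → a ≈ c
≈-trans p r = pointwise λ n → trans (at p n) (at r n)

-- A coefficient of a product sees no later coefficients of its factors. Compatibility of the
-- product with `_≈_` and with truncation both come from this.
⊠-local : ∀ {a a′ b b′} n → (∀ i → i ≤ n → a i ≡ a′ i) → (∀ i → i ≤ n → b i ≡ b′ i) →
          (a ⊠ b) n ≡ (a′ ⊠ b′) n
⊠-local {a} {a′} {b} {b′} zero p r = trans (⊠-zero a b)
  (trans (cong₂ ℤ._*_ (p 0 z≤n) (r 0 z≤n)) (sym (⊠-zero a′ b′)))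
⊠-local {a} {a′} {b} {b′} (suc n) p r = trans (⊠-suc a b n)
  (trans (cong₂ ℤ._+_ (cong₂ ℤ._*_ (p 0 z≤n) (r (suc n) ℕₚ.≤-refl))
            (⊠-local n (λ i i≤n → p (suc i) (s≤s i≤n)) (λ i i≤n → r i (ℕₚ.m≤n⇒m≤1+n i≤n))))
         (sym (⊠-suc a′ b′ n)))

⊠-cong : ∀ {a a′ b b′} → a ≈ a′ → b ≈ b′ → a ⊠ b ≈ a′ ⊠ b′
⊠-cong p r = pointwise λ n → ⊠-local n (λ i _ → at p i) (λ i _ → at r i)

⊞-cong : ∀ {a a′ b b′} → a ≈ a′ → b ≈ b′ → a ⊞ b ≈ a′ ⊞ b′
⊞-cong {a} {a′} {b} {b′} p r = pointwise λ n →
  trans (⊞-at a b n) (trans (cong₂ ℤ._+_ (at p n) (at r n)) (sym (⊞-at a′ b′ n)))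

⊟-cong : ∀ {a a′} → a ≈ a′ → ⊟ a ≈ ⊟ a′
⊟-cong {a} {a′} p = pointwise λ n → trans (⊟-at a n) (trans (cong (ℤ.-_) (at p n)) (sym (⊟-at a′ n)))

⊞-assoc : ∀ a b c → (a ⊞ b) ⊞ c ≈ a ⊞ (b ⊞ c)
⊞-assoc a b c = pointwise λ n → begin
  ((a ⊞ b) ⊞ c) n           ≡⟨ ⊞-at (a ⊞ b) c n ⟩
  (a ⊞ b) n ℤ.+ c n         ≡⟨ cong (ℤ._+ c n) (⊞-at a b n) ⟩
  a n ℤ.+ b n ℤ.+ c n       ≡⟨ ℤₚ.+-assoc (a n) (b n) (c n) ⟩
  a n ℤ.+ (b n ℤ.+ c n)     ≡⟨ cong (λ t → a n ℤ.+ t) (⊞-at b c n) ⟨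
  a n ℤ.+ (b ⊞ c) n         ≡⟨ ⊞-at a (b ⊞ c) n ⟨
  (a ⊞ (b ⊞ c)) n           ∎
  where open ≡-Reasoning

⊞-comm : ∀ a b → a ⊞ b ≈ b ⊞ a
⊞-comm a b = pointwise λ n →
  trans (⊞-at a b n) (trans (ℤₚ.+-comm (a n) (b n)) (sym (⊞-at b a n)))

⊞-identityˡ : ∀ a → 0ₛ ⊞ a ≈ a
⊞-identityˡ a = pointwise λ n →
  trans (⊞-at 0ₛ a n) (trans (cong (ℤ._+ a n) (0ₛ-at n)) (ℤₚ.+-identityˡ (a n)))

⊟-inverseˡ : ∀ a → ⊟ a ⊞ a ≈ 0ₛ
⊟-inverseˡ a = pointwise λ n → trans (⊞-at (⊟ a) a n)
  (trans (cong (ℤ._+ a n) (⊟-at a n)) (trans (ℤₚ.+-inverseˡ (a n)) (sym (0ₛ-at n))))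

scale-⊠ : ∀ c a b n → (scale c a ⊠ b) n ≡ c ℤ.* (a ⊠ b) n
scale-⊠ c a b zero = begin
  (scale c a ⊠ b) 0         ≡⟨ ⊠-zero (scale c a) b ⟩
  c ℤ.* a 0 ℤ.* b 0         ≡⟨ ℤₚ.*-assoc c (a 0) (b 0) ⟩
  c ℤ.* (a 0 ℤ.* b 0)       ≡⟨ cong (c ℤ.*_) (⊠-zero a b) ⟨
  c ℤ.* (a ⊠ b) 0           ∎
  where open ≡-Reasoning
scale-⊠ c a b (suc n) = begin
  (scale c a ⊠ b) (suc n)
    ≡⟨ ⊠-suc (scale c a) b n ⟩
  c ℤ.* a 0 ℤ.* b (suc n) ℤ.+ (scale c (tail a) ⊠ b) n
    ≡⟨ cong₂ ℤ._+_ (ℤₚ.*-assoc c (a 0) (b (suc n))) (scale-⊠ c (tail a) b n) ⟩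
  c ℤ.* (a 0 ℤ.* b (suc n)) ℤ.+ c ℤ.* (tail a ⊠ b) n
    ≡⟨ ℤₚ.*-distribˡ-+ c (a 0 ℤ.* b (suc n)) ((tail a ⊠ b) n) ⟨
  c ℤ.* (a 0 ℤ.* b (suc n) ℤ.+ (tail a ⊠ b) n)
    ≡⟨ cong (c ℤ.*_) (⊠-suc a b n) ⟨
  c ℤ.* (a ⊠ b) (suc n) ∎
  where open ≡-Reasoning

tail-⊞ : ∀ a b → tail (a ⊞ b) ≈ tail a ⊞ tail b
tail-⊞ a b = pointwise λ n → trans (⊞-at a b (suc n)) (sym (⊞-at (tail a) (tail b) n))

tail-⊠ : ∀ a b → tail (a ⊠ b) ≈ scale (a 0) (tail b) ⊞ (tail a ⊠ b)
tail-⊠ a b = pointwise λ n →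
  trans (⊠-suc a b n) (sym (⊞-at (scale (a 0) (tail b)) (tail a ⊠ b) n))

⊠-distribʳ : ∀ c a b → (a ⊞ b) ⊠ c ≈ (a ⊠ c) ⊞ (b ⊠ c)
⊠-distribʳ c a b = pointwise λ n → trans (pt a b n) (sym (⊞-at (a ⊠ c) (b ⊠ c) n))
  where
  open ≡-Reasoning
  pt : ∀ a b n → ((a ⊞ b) ⊠ c) n ≡ (a ⊠ c) n ℤ.+ (b ⊠ c) n
  pt a b zero = begin
    ((a ⊞ b) ⊠ c) 0                     ≡⟨ ⊠-zero (a ⊞ b) c ⟩
    (a ⊞ b) 0 ℤ.* c 0                   ≡⟨ cong (ℤ._* c 0) (⊞-at a b 0) ⟩
    (a 0 ℤ.+ b 0) ℤ.* c 0               ≡⟨ ℤₚ.*-distribʳ-+ (c 0) (a 0) (b 0) ⟩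
    a 0 ℤ.* c 0 ℤ.+ b 0 ℤ.* c 0         ≡⟨ cong₂ ℤ._+_ (⊠-zero a c) (⊠-zero b c) ⟨
    (a ⊠ c) 0 ℤ.+ (b ⊠ c) 0             ∎
  pt a b (suc n) = begin
    ((a ⊞ b) ⊠ c) (suc n)
      ≡⟨ ⊠-suc (a ⊞ b) c n ⟩
    (a ⊞ b) 0 ℤ.* c (suc n) ℤ.+ (tail (a ⊞ b) ⊠ c) n
      ≡⟨ cong₂ ℤ._+_ (cong (ℤ._* c (suc n)) (⊞-at a b 0))
           (trans (at (⊠-cong (tail-⊞ a b) ≈-refl) n) (pt (tail a) (tail b) n)) ⟩
    (a 0 ℤ.+ b 0) ℤ.* c (suc n) ℤ.+ ((tail a ⊠ c) n ℤ.+ (tail b ⊠ c) n)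
      ≡⟨ ℤ-Solver.solve 5 (λ x y z u v → (x :+ y) :* z :+ (u :+ v) := (x :* z :+ u) :+ (y :* z :+ v))
           refl (a 0) (b 0) (c (suc n)) ((tail a ⊠ c) n) ((tail b ⊠ c) n) ⟩
    (a 0 ℤ.* c (suc n) ℤ.+ (tail a ⊠ c) n) ℤ.+ (b 0 ℤ.* c (suc n) ℤ.+ (tail b ⊠ c) n)
      ≡⟨ cong₂ ℤ._+_ (⊠-suc a c n) (⊠-suc b c n) ⟨
    (a ⊠ c) (suc n) ℤ.+ (b ⊠ c) (suc n) ∎
    where open ℤ-Solver

⊠-assoc : ∀ a b c → (a ⊠ b) ⊠ c ≈ a ⊠ (b ⊠ c)
⊠-assoc a b c = pointwise (pt a)
  where
  open ≡-Reasoning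
  pt : ∀ a n → ((a ⊠ b) ⊠ c) n ≡ (a ⊠ (b ⊠ c)) n
  pt a zero = begin
    ((a ⊠ b) ⊠ c) 0             ≡⟨ ⊠-zero (a ⊠ b) c ⟩
    (a ⊠ b) 0 ℤ.* c 0           ≡⟨ cong (ℤ._* c 0) (⊠-zero a b) ⟩
    a 0 ℤ.* b 0 ℤ.* c 0         ≡⟨ ℤₚ.*-assoc (a 0) (b 0) (c 0) ⟩
    a 0 ℤ.* (b 0 ℤ.* c 0)       ≡⟨ cong (a 0 ℤ.*_) (⊠-zero b c) ⟨
    a 0 ℤ.* (b ⊠ c) 0           ≡⟨ ⊠-zero a (b ⊠ c) ⟨
    (a ⊠ (b ⊠ c)) 0             ∎
  pt a (suc n) = begin
    ((a ⊠ b) ⊠ c) (suc n)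
      ≡⟨ ⊠-suc (a ⊠ b) c n ⟩
    (a ⊠ b) 0 ℤ.* c (suc n) ℤ.+ (tail (a ⊠ b) ⊠ c) n
      ≡⟨ cong₂ ℤ._+_ (cong (ℤ._* c (suc n)) (⊠-zero a b)) tail-part ⟩
    a 0 ℤ.* b 0 ℤ.* c (suc n) ℤ.+ (a 0 ℤ.* (tail b ⊠ c) n ℤ.+ (tail a ⊠ (b ⊠ c)) n)
      ≡⟨ ℤ-Solver.solve 5 (λ x y z u v → x :* y :* z :+ (x :* u :+ v) := x :* (y :* z :+ u) :+ v)
           refl (a 0) (b 0) (c (suc n)) ((tail b ⊠ c) n) ((tail a ⊠ (b ⊠ c)) n) ⟩
    a 0 ℤ.* (b 0 ℤ.* c (suc n) ℤ.+ (tail b ⊠ c) n) ℤ.+ (tail a ⊠ (b ⊠ c)) n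
      ≡⟨ cong (λ t → a 0 ℤ.* t ℤ.+ (tail a ⊠ (b ⊠ c)) n) (⊠-suc b c n) ⟨
    a 0 ℤ.* (b ⊠ c) (suc n) ℤ.+ (tail a ⊠ (b ⊠ c)) n
      ≡⟨ ⊠-suc a (b ⊠ c) n ⟨
    (a ⊠ (b ⊠ c)) (suc n) ∎
    where
    open ℤ-Solver
    tail-part : (tail (a ⊠ b) ⊠ c) n ≡ a 0 ℤ.* (tail b ⊠ c) n ℤ.+ (tail a ⊠ (b ⊠ c)) n
    tail-part = begin
      (tail (a ⊠ b) ⊠ c) n
        ≡⟨ at (⊠-cong (tail-⊠ a b) ≈-refl) n ⟩
      ((scale (a 0) (tail b) ⊞ (tail a ⊠ b)) ⊠ c) n
        ≡⟨ at (⊠-distribʳ c (scale (a 0) (tail b)) (tail a ⊠ b)) n ⟩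
      ((scale (a 0) (tail b) ⊠ c) ⊞ ((tail a ⊠ b) ⊠ c)) n
        ≡⟨ ⊞-at (scale (a 0) (tail b) ⊠ c) ((tail a ⊠ b) ⊠ c) n ⟩
      (scale (a 0) (tail b) ⊠ c) n ℤ.+ ((tail a ⊠ b) ⊠ c) n
        ≡⟨ cong₂ ℤ._+_ (scale-⊠ (a 0) (tail b) c n) (pt (tail a) n) ⟩
      a 0 ℤ.* (tail b ⊠ c) n ℤ.+ (tail a ⊠ (b ⊠ c)) n ∎

-- The recursion with the right factor peeled off; set against `⊠-suc`, it gives commutativity by
-- induction.
⊠-sucʳ : ∀ a b n → (a ⊠ b) (suc n) ≡ a (suc n) ℤ.* b 0 ℤ.+ (a ⊠ tail b) n
⊠-sucʳ a b zero = begin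
  (a ⊠ b) 1                                   ≡⟨ ⊠-suc a b 0 ⟩
  a 0 ℤ.* b 1 ℤ.+ (tail a ⊠ b) 0              ≡⟨ cong (λ t → a 0 ℤ.* b 1 ℤ.+ t) (⊠-zero (tail a) b) ⟩
  a 0 ℤ.* b 1 ℤ.+ a 1 ℤ.* b 0                 ≡⟨ ℤₚ.+-comm (a 0 ℤ.* b 1) (a 1 ℤ.* b 0) ⟩
  a 1 ℤ.* b 0 ℤ.+ a 0 ℤ.* b 1                 ≡⟨ cong (λ t → a 1 ℤ.* b 0 ℤ.+ t) (⊠-zero a (tail b)) ⟨
  a 1 ℤ.* b 0 ℤ.+ (a ⊠ tail b) 0              ∎
  where open ≡-Reasoning
⊠-sucʳ a b (suc n) = begin
  (a ⊠ b) (suc (suc n))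
    ≡⟨ ⊠-suc a b (suc n) ⟩
  a 0 ℤ.* b (suc (suc n)) ℤ.+ (tail a ⊠ b) (suc n)
    ≡⟨ cong (λ t → a 0 ℤ.* b (suc (suc n)) ℤ.+ t) (⊠-sucʳ (tail a) b n) ⟩
  a 0 ℤ.* b (suc (suc n)) ℤ.+ (a (suc (suc n)) ℤ.* b 0 ℤ.+ (tail a ⊠ tail b) n)
    ≡⟨ ℤ-Solver.solve 3 (λ x y z → x :+ (y :+ z) := y :+ (x :+ z)) refl
         (a 0 ℤ.* b (suc (suc n))) (a (suc (suc n)) ℤ.* b 0) ((tail a ⊠ tail b) n) ⟩
  a (suc (suc n)) ℤ.* b 0 ℤ.+ (a 0 ℤ.* b (suc (suc n)) ℤ.+ (tail a ⊠ tail b) n)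
    ≡⟨ cong (λ t → a (suc (suc n)) ℤ.* b 0 ℤ.+ t) (⊠-suc a (tail b) n) ⟨
  a (suc (suc n)) ℤ.* b 0 ℤ.+ (a ⊠ tail b) (suc n) ∎
  where
  open ≡-Reasoning
  open ℤ-Solver

⊠-comm : ∀ a b → a ⊠ b ≈ b ⊠ a
⊠-comm a b = pointwise (pt a)
  where
  pt : ∀ a n → (a ⊠ b) n ≡ (b ⊠ a) n
  pt a zero = trans (⊠-zero a b) (trans (ℤₚ.*-comm (a 0) (b 0)) (sym (⊠-zero b a)))
  pt a (suc n) = trans (⊠-suc a b n)
    (trans (cong₂ ℤ._+_ (ℤₚ.*-comm (a 0) (b (suc n))) (pt (tail a) n)) (sym (⊠-sucʳ b a n)))

0ₛ-⊠ : ∀ a → 0ₛ ⊠ a ≈ 0ₛ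
0ₛ-⊠ a = pointwise λ n → trans (⊠-local n (λ i _ → 0ₛ-at i) (λ i _ → refl))
  (trans (scale-⊠ 0ℤ 0ₛ a n) (sym (0ₛ-at n)))

const-⊠ : ∀ c a n → (const c ⊠ a) n ≡ c ℤ.* a n
const-⊠ c a zero    = trans (⊠-zero (const c) a) (cong (ℤ._* a 0) (const-zero c))
const-⊠ c a (suc n) = begin
  (const c ⊠ a) (suc n)
    ≡⟨ ⊠-suc (const c) a n ⟩
  const c 0 ℤ.* a (suc n) ℤ.+ (tail (const c) ⊠ a) n
    ≡⟨ cong₂ ℤ._+_ (cong (ℤ._* a (suc n)) (const-zero c)) tail-vanishes ⟩
  c ℤ.* a (suc n) ℤ.+ 0ℤ
    ≡⟨ ℤₚ.+-identityʳ (c ℤ.* a (suc n)) ⟩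
  c ℤ.* a (suc n) ∎
  where
  open ≡-Reasoning
  tail-vanishes : (tail (const c) ⊠ a) n ≡ 0ℤ
  tail-vanishes = trans (⊠-local n (λ i _ → trans (const-suc c i) (sym (0ₛ-at i))) (λ i _ → refl))
    (trans (at (0ₛ-⊠ a) n) (0ₛ-at n))

⊠-identityˡ : ∀ a → 1ₛ ⊠ a ≈ a
⊠-identityˡ a = pointwise λ n → trans (const-⊠ 1ℤ a n) (ℤₚ.*-identityˡ (a n))

seriesRing : CommutativeRing 0ℓ 0ℓ
seriesRing = record
  { Carrier = PS ; _≈_ = _≈_ ; _+_ = _⊞_ ; _*_ = _⊠_ ; -_ = ⊟_ ; 0# = 0ₛ ; 1# = 1ₛ
  ; isCommutativeRing = record
    { isRing = record
      { +-isAbelianGroup = record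
        { isGroup = record
          { isMonoid = record
            { isSemigroup = record
              { isMagma = record
                { isEquivalence = record { refl = ≈-refl ; sym = ≈-sym ; trans = ≈-trans }
                ; ∙-cong = ⊞-cong }
              ; assoc = ⊞-assoc }
            ; identity = ⊞-identityˡ , λ a → ≈-trans (⊞-comm a 0ₛ) (⊞-identityˡ a) }
          ; inverse = ⊟-inverseˡ , λ a → ≈-trans (⊞-comm a (⊟ a)) (⊟-inverseˡ a)
          ; ⁻¹-cong = ⊟-cong }
        ; comm = ⊞-comm }
      ; *-cong = ⊠-cong
      ; *-assoc = ⊠-assoc
      ; *-identity = ⊠-identityˡ , λ a → ≈-trans (⊠-comm a 1ₛ) (⊠-identityˡ a)
      ; distrib =
          (λ a b c → ≈-trans (⊠-comm a (b ⊞ c))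
            (≈-trans (⊠-distribʳ a b c) (⊞-cong (⊠-comm b a) (⊠-comm c a))))
          , ⊠-distribʳ
      }
    ; *-comm = ⊠-comm
    }
  }

const-⊞ : ∀ c d → const (c ℤ.+ d) ≈ const c ⊞ const d
const-⊞ c d = pointwise λ where
  zero → trans (const-zero (c ℤ.+ d)) (trans (sym (cong₂ ℤ._+_ (const-zero c) (const-zero d)))
           (sym (⊞-at (const c) (const d) 0)))
  (suc n) → trans (const-suc (c ℤ.+ d) n) (trans (sym (cong₂ ℤ._+_ (const-suc c n) (const-suc d n)))
           (sym (⊞-at (const c) (const d) (suc n))))

const-* : ∀ c d → const (c ℤ.* d) ≈ const c ⊠ const d
const-* c d = pointwise λ where
  zero → trans (const-zero (c ℤ.* d)) (trans (cong (c ℤ.*_) (sym (const-zero d)))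
           (sym (const-⊠ c (const d) 0)))
  (suc n) → trans (const-suc (c ℤ.* d) n) (trans (sym (ℤₚ.*-zeroʳ c))
           (trans (cong (c ℤ.*_) (sym (const-suc d n))) (sym (const-⊠ c (const d) (suc n)))))

const-neg : ∀ c → const (ℤ.- c) ≈ ⊟ const c
const-neg c = pointwise λ where
  zero → trans (const-zero (ℤ.- c)) (trans (cong (ℤ.-_) (sym (const-zero c))) (sym (⊟-at (const c) 0)))
  (suc n) → trans (const-suc (ℤ.- c) n) (trans (cong (ℤ.-_) (sym (const-suc c n)))
              (sym (⊟-at (const c) (suc n))))

module S = CommutativeRing seriesRing
open import Algebra.Properties.Semiring.Exp S.semiring
  using (^-homo-*; ^-assocʳ; ^-congˡ) renaming (_^_ to _^ˢ_)
open import Algebra.Properties.CommutativeSemiring.Exp S.commutativeSemiring using (^-distrib-*)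
open import Relation.Binary.Reasoning.Setoid S.setoid

private
  constHom : CommutativeRing.rawRing ℤₚ.+-*-commutativeRing ACR.-Raw-AlmostCommutative⟶ ACR.fromCommutativeRing seriesRing
  constHom = record
    { ⟦_⟧ = const ; +-homo = const-⊞ ; *-homo = const-* ; -‿homo = const-neg
    ; 0-homo = ≈-refl ; 1-homo = ≈-refl }

  const-≟ : ∀ c d → Maybe (const c ≈ const d)
  const-≟ c d with c ℤ.≟ d
  ... | yes refl = just ≈-refl
  ... | no _     = nothing

-- The solver's coefficients are integers embedded as constant series, so that numerals such as 16
-- or -2 are computed and not treated as unknowns.
module Ring = Algebra.Solver.Ring
  (CommutativeRing.rawRing ℤₚ.+-*-commutativeRing) (ACR.fromCommutativeRing seriesRing) constHom const-≟

-- Substitutions: alt a = a(−q), sq a = a(q²), and evens a is the even part of a with q² replaced by q.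

alt sq evens : PS → PS
alt a zero    = a 0
alt a (suc n) = ℤ.- alt (tail a) n

sq a zero          = a 0
sq a (suc zero)    = 0ℤ
sq a (suc (suc n)) = sq (tail a) n

evens a zero    = a 0
evens a (suc n) = evens (tail (tail a)) n

evens-at : ∀ a n → evens a n ≡ a (2 * n)
evens-at a zero    = refl
evens-at a (suc n) = trans (evens-at (tail (tail a)) n)
  (cong (λ k → a (suc k)) (sym (ℕₚ.+-suc n (n + 0))))

alt-local : ∀ {a b} n → (∀ i → i ≤ n → a i ≡ b i) → alt a n ≡ alt b n
alt-local zero    p = p 0 z≤n
alt-local (suc n) p = cong (ℤ.-_) (alt-local n λ i i≤n → p (suc i) (s≤s i≤n))

sq-local : ∀ {a b} n → (∀ i → i ≤ n → a i ≡ b i) → sq a n ≡ sq b n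
sq-local zero          p = p 0 z≤n
sq-local (suc zero)    p = refl
sq-local (suc (suc n)) p = sq-local n λ i i≤n → p (suc i) (s≤s (ℕₚ.m≤n⇒m≤1+n i≤n))

alt-cong : ∀ {a b} → a ≈ b → alt a ≈ alt b
alt-cong p = pointwise λ n → alt-local n λ i _ → at p i

sq-cong : ∀ {a b} → a ≈ b → sq a ≈ sq b
sq-cong p = pointwise λ n → sq-local n λ i _ → at p i

evens-cong : ∀ {a b} → a ≈ b → evens a ≈ evens b
evens-cong {a} {b} p = pointwise λ n → trans (evens-at a n) (trans (at p (2 * n)) (sym (evens-at b n)))

alt-⊞ : ∀ a b → alt (a ⊞ b) ≈ alt a ⊞ alt b
alt-⊞ a b = pointwise λ n → trans (pt a b n) (sym (⊞-at (alt a) (alt b) n))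
  where
  pt : ∀ a b n → alt (a ⊞ b) n ≡ alt a n ℤ.+ alt b n
  pt a b zero    = ⊞-at a b 0
  pt a b (suc n) = trans (cong (ℤ.-_) (trans (at (alt-cong (tail-⊞ a b)) n) (pt (tail a) (tail b) n)))
    (ℤₚ.neg-distrib-+ (alt (tail a) n) (alt (tail b) n))

sq-⊞ : ∀ a b → sq (a ⊞ b) ≈ sq a ⊞ sq b
sq-⊞ a b = pointwise λ n → trans (pt a b n) (sym (⊞-at (sq a) (sq b) n))
  where
  pt : ∀ a b n → sq (a ⊞ b) n ≡ sq a n ℤ.+ sq b n
  pt a b zero          = ⊞-at a b 0
  pt a b (suc zero)    = refl
  pt a b (suc (suc n)) = trans (at (sq-cong (tail-⊞ a b)) n) (pt (tail a) (tail b) n)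

evens-⊞ : ∀ a b → evens (a ⊞ b) ≈ evens a ⊞ evens b
evens-⊞ a b = pointwise λ n → trans (evens-at (a ⊞ b) n) (trans (⊞-at a b (2 * n))
  (trans (cong₂ ℤ._+_ (sym (evens-at a n)) (sym (evens-at b n))) (sym (⊞-at (evens a) (evens b) n))))

alt-scale : ∀ c a n → alt (scale c a) n ≡ c ℤ.* alt a n
alt-scale c a zero    = refl
alt-scale c a (suc n) = trans (cong (ℤ.-_) (alt-scale c (tail a) n)) (ℤₚ.neg-distribʳ-* c (alt (tail a) n))

sq-scale : ∀ c a n → sq (scale c a) n ≡ c ℤ.* sq a n
sq-scale c a zero          = refl
sq-scale c a (suc zero)    = sym (ℤₚ.*-zeroʳ c)
sq-scale c a (suc (suc n)) = sq-scale c (tail a) n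

evens-scale : ∀ c a → evens (scale c a) ≈ scale c (evens a)
evens-scale c a = pointwise λ n →
  trans (evens-at (scale c a) n) (cong (c ℤ.*_) (sym (evens-at a n)))

alt-⊠ : ∀ a b → alt (a ⊠ b) ≈ alt a ⊠ alt b
alt-⊠ a b = pointwise (pt a)
  where
  pt : ∀ a n → alt (a ⊠ b) n ≡ (alt a ⊠ alt b) n
  pt a zero    = trans (⊠-zero a b) (sym (⊠-zero (alt a) (alt b)))
  pt a (suc n) = E.begin
    ℤ.- alt (tail (a ⊠ b)) n
      E.≡⟨ cong (ℤ.-_) (trans (at (alt-cong (tail-⊠ a b)) n)
           (trans (at (alt-⊞ (scale (a 0) (tail b)) (tail a ⊠ b)) n)
             (⊞-at (alt (scale (a 0) (tail b))) (alt (tail a ⊠ b)) n))) ⟩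
    ℤ.- (alt (scale (a 0) (tail b)) n ℤ.+ alt (tail a ⊠ b) n)
      E.≡⟨ cong (ℤ.-_) (cong₂ ℤ._+_ (alt-scale (a 0) (tail b) n) (pt (tail a) n)) ⟩
    ℤ.- (a 0 ℤ.* alt (tail b) n ℤ.+ (alt (tail a) ⊠ alt b) n)
      E.≡⟨ ℤ-Solver.solve 3 (λ x y z → :- (x :* y :+ z) := x :* (:- y) :+ con (ℤ.- 1ℤ) :* z) refl
           (a 0) (alt (tail b) n) ((alt (tail a) ⊠ alt b) n) ⟩
    a 0 ℤ.* alt b (suc n) ℤ.+ (ℤ.- 1ℤ) ℤ.* (alt (tail a) ⊠ alt b) n
      E.≡⟨ cong (λ t → a 0 ℤ.* alt b (suc n) ℤ.+ t)
           (trans (sym (scale-⊠ (ℤ.- 1ℤ) (alt (tail a)) (alt b) n))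
             (⊠-local n (λ i _ → ℤₚ.-1*i≡-i (alt (tail a) i)) (λ i _ → refl))) ⟩
    a 0 ℤ.* alt b (suc n) ℤ.+ (tail (alt a) ⊠ alt b) n
      E.≡⟨ ⊠-suc (alt a) (alt b) n ⟨
    (alt a ⊠ alt b) (suc n) E.∎
    where
    module E = ≡-Reasoning
    open ℤ-Solver

-- Since a(q²) = a(0) + q² (`tail a`)(q²), dropping one coefficient of `sq a` leaves q times
-- `sq (tail a)`.
tail-sq-⊠ : ∀ a b n → (tail (sq a) ⊠ b) (suc n) ≡ (sq (tail a) ⊠ b) n
tail-sq-⊠ a b n = trans (⊠-suc (tail (sq a)) b n) (ℤₚ.+-identityˡ ((sq (tail a) ⊠ b) n))

sq-⊠ : ∀ a b → sq (a ⊠ b) ≈ sq a ⊠ sq b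
sq-⊠ a b = pointwise (pt a)
  where
  pt : ∀ a n → sq (a ⊠ b) n ≡ (sq a ⊠ sq b) n
  pt a zero       = trans (⊠-zero a b) (sym (⊠-zero (sq a) (sq b)))
  pt a (suc zero) = sym (trans (⊠-suc (sq a) (sq b) 0)
    (cong₂ ℤ._+_ (ℤₚ.*-zeroʳ (a 0)) (⊠-zero (tail (sq a)) (sq b))))
  pt a (suc (suc n)) = E.begin
    sq (tail (a ⊠ b)) n
      E.≡⟨ trans (at (sq-cong (tail-⊠ a b)) n)
           (trans (at (sq-⊞ (scale (a 0) (tail b)) (tail a ⊠ b)) n)
             (⊞-at (sq (scale (a 0) (tail b))) (sq (tail a ⊠ b)) n)) ⟩
    sq (scale (a 0) (tail b)) n ℤ.+ sq (tail a ⊠ b) n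
      E.≡⟨ cong₂ ℤ._+_ (sq-scale (a 0) (tail b) n) (pt (tail a) n) ⟩
    a 0 ℤ.* sq (tail b) n ℤ.+ (sq (tail a) ⊠ sq b) n
      E.≡⟨ cong (λ t → a 0 ℤ.* sq (tail b) n ℤ.+ t) (tail-sq-⊠ a (sq b) n) ⟨
    a 0 ℤ.* sq (tail b) n ℤ.+ (tail (sq a) ⊠ sq b) (suc n)
      E.≡⟨ ⊠-suc (sq a) (sq b) (suc n) ⟨
    (sq a ⊠ sq b) (suc (suc n)) E.∎
    where module E = ≡-Reasoning

-- The rule U(a(q²) b) = a U(b) for the operator U₂ that keeps even exponents. It is what lets
-- powers of T(q²) and the eta prefactors leave an even part.
evens-sq-⊠ : ∀ a b → evens (sq a ⊠ b) ≈ a ⊠ evens b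
evens-sq-⊠ a b = pointwise (pt a)
  where
  two-tails : ∀ a → tail (tail (sq a ⊠ b)) ≈ scale (a 0) (tail (tail b)) ⊞ (sq (tail a) ⊠ b)
  two-tails a = pointwise λ n → trans (⊠-suc (sq a) b (suc n))
    (trans (cong (λ t → a 0 ℤ.* b (suc (suc n)) ℤ.+ t) (tail-sq-⊠ a b n))
      (sym (⊞-at (scale (a 0) (tail (tail b))) (sq (tail a) ⊠ b) n)))
  pt : ∀ a n → evens (sq a ⊠ b) n ≡ (a ⊠ evens b) n
  pt a zero    = trans (⊠-zero (sq a) b) (sym (⊠-zero a (evens b)))
  pt a (suc n) = E.begin
    evens (tail (tail (sq a ⊠ b))) n
      E.≡⟨ at (evens-cong (two-tails a)) n ⟩
    evens (scale (a 0) (tail (tail b)) ⊞ (sq (tail a) ⊠ b)) n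
      E.≡⟨ trans (at (evens-⊞ (scale (a 0) (tail (tail b))) (sq (tail a) ⊠ b)) n)
             (⊞-at (evens (scale (a 0) (tail (tail b)))) (evens (sq (tail a) ⊠ b)) n) ⟩
    evens (scale (a 0) (tail (tail b))) n ℤ.+ evens (sq (tail a) ⊠ b) n
      E.≡⟨ cong₂ ℤ._+_ (at (evens-scale (a 0) (tail (tail b))) n) (pt (tail a) n) ⟩
    a 0 ℤ.* evens b (suc n) ℤ.+ (tail a ⊠ evens b) n
      E.≡⟨ ⊠-suc a (evens b) n ⟨
    (a ⊠ evens b) (suc n) E.∎
    where module E = ≡-Reasoning

alt-0 : ∀ n → alt (λ _ → 0ℤ) n ≡ 0ℤ
alt-0 zero    = refl
alt-0 (suc n) = cong (ℤ.-_) (alt-0 n)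

sq-0 : ∀ n → sq (λ _ → 0ℤ) n ≡ 0ℤ
sq-0 zero          = refl
sq-0 (suc zero)    = refl
sq-0 (suc (suc n)) = sq-0 n

alt-const : ∀ c → alt (const c) ≈ const c
alt-const c = pointwise λ where
    zero    → refl
    (suc n) → trans (cong (ℤ.-_) (trans (alt-local n (λ i _ → const-suc c i)) (alt-0 n))) (sym (const-suc c n))

sq-const : ∀ c → sq (const c) ≈ const c
sq-const c = pointwise λ where
    zero          → refl
    (suc zero)    → sym (const-suc c 0)
    (suc (suc n)) → trans (sq-local n (λ i _ → const-suc c i)) (trans (sq-0 n) (sym (const-suc c (suc n))))

⊟≈-1⊠ : ∀ a → ⊟ a ≈ const (ℤ.- 1ℤ) ⊠ a
⊟≈-1⊠ = solve 1 (λ a → :- a := con (ℤ.- 1ℤ) :* a) ≈-refl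
  where open Ring

alt-⊟ : ∀ a → alt (⊟ a) ≈ ⊟ alt a
alt-⊟ a = begin
  alt (⊟ a)                         ≈⟨ alt-cong (⊟≈-1⊠ a) ⟩
  alt (const (ℤ.- 1ℤ) ⊠ a)          ≈⟨ alt-⊠ (const (ℤ.- 1ℤ)) a ⟩
  alt (const (ℤ.- 1ℤ)) ⊠ alt a      ≈⟨ S.*-congʳ (alt-const (ℤ.- 1ℤ)) ⟩
  const (ℤ.- 1ℤ) ⊠ alt a            ≈⟨ ⊟≈-1⊠ (alt a) ⟨
  ⊟ alt a                           ∎

sq-⊟ : ∀ a → sq (⊟ a) ≈ ⊟ sq a
sq-⊟ a = begin
  sq (⊟ a)                         ≈⟨ sq-cong (⊟≈-1⊠ a) ⟩
  sq (const (ℤ.- 1ℤ) ⊠ a)          ≈⟨ sq-⊠ (const (ℤ.- 1ℤ)) a ⟩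
  sq (const (ℤ.- 1ℤ)) ⊠ sq a       ≈⟨ S.*-congʳ (sq-const (ℤ.- 1ℤ)) ⟩
  const (ℤ.- 1ℤ) ⊠ sq a            ≈⟨ ⊟≈-1⊠ (sq a) ⟨
  ⊟ sq a                           ∎

alt-^ : ∀ a n → alt (a ^ˢ n) ≈ alt a ^ˢ n
alt-^ a zero    = alt-const 1ℤ
alt-^ a (suc n) = ≈-trans (alt-⊠ a (a ^ˢ n)) (S.*-congˡ (alt-^ a n))

sq-^ : ∀ a n → sq (a ^ˢ n) ≈ sq a ^ˢ n
sq-^ a zero    = sq-const 1ℤ
sq-^ a (suc n) = ≈-trans (sq-⊠ a (a ^ˢ n)) (S.*-congˡ (sq-^ a n))

alt-sq : ∀ a → alt (sq a) ≈ sq a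
alt-sq a = pointwise (pt a)
  where
  pt : ∀ a n → alt (sq a) n ≡ sq a n
  pt a zero          = refl
  pt a (suc zero)    = refl
  pt a (suc (suc n)) = trans (ℤₚ.neg-involutive (alt (sq (tail a)) n)) (pt (tail a) n)

evens-alt : ∀ a → evens (alt a) ≈ evens a
evens-alt a = pointwise (pt a)
  where
  pt : ∀ a n → evens (alt a) n ≡ evens a n
  pt a zero    = refl
  pt a (suc n) = trans (at (evens-cong {tail (tail (alt a))} {alt (tail (tail a))}
    (pointwise λ i → ℤₚ.neg-involutive (alt (tail (tail a)) i))) n) (pt (tail (tail a)) n)

-- The variable q

q : PS
q = qpow 1

⊠-q-zero : ∀ a → (q ⊠ a) 0 ≡ 0ℤ
⊠-q-zero a = ⊠-zero q a

⊠-q-suc : ∀ a n → (q ⊠ a) (suc n) ≡ a n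
⊠-q-suc a n = trans (⊠-suc q a n) (trans (ℤₚ.+-identityˡ ((tail q ⊠ a) n))
  (trans (⊠-local n (λ i _ → tail-q i) (λ i _ → refl)) (at (⊠-identityˡ a) n)))
  where
  tail-q : ∀ i → tail q i ≡ 1ₛ i
  tail-q zero    = sym (const-zero 1ℤ)
  tail-q (suc i) = sym (const-suc 1ℤ i)

q-cancel : ∀ {a b} → q ⊠ a ≈ q ⊠ b → a ≈ b
q-cancel {a} {b} p = pointwise λ n → trans (sym (⊠-q-suc a n)) (trans (at p (suc n)) (⊠-q-suc b n))

𝟙≈1ₛ : 𝟙 ≈ 1ₛ
𝟙≈1ₛ = pointwise λ where
  zero    → sym (const-zero 1ℤ)
  (suc n) → sym (const-suc 1ℤ n)

qpow≈ : ∀ n → qpow n ≈ q ^ˢ n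
qpow≈ zero = pointwise λ where
  zero    → sym (const-zero 1ℤ)
  (suc n) → sym (const-suc 1ℤ n)
qpow≈ (suc n) = pointwise λ where
  zero    → sym (⊠-q-zero (q ^ˢ n))
  (suc i) → trans (at (qpow≈ n) i) (sym (⊠-q-suc (q ^ˢ n) i))

q^-⊠-below : ∀ m a i → i < m → (q ^ˢ m ⊠ a) i ≡ 0ℤ
q^-⊠-below (suc m) a i i<m = trans (at (⊠-assoc q (q ^ˢ m) a) i) (go i i<m)
  where
  go : ∀ i → i < suc m → (q ⊠ (q ^ˢ m ⊠ a)) i ≡ 0ℤ
  go zero    _         = ⊠-q-zero (q ^ˢ m ⊠ a)
  go (suc i) (s≤s i<m) = trans (⊠-q-suc (q ^ˢ m ⊠ a) i) (q^-⊠-below m a i i<m)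

alt-q : alt q ≈ ⊟ q
alt-q = pointwise pt
  where
  pt : ∀ n → alt q n ≡ (⊟ q) n
  pt zero          = sym (⊟-at q 0)
  pt (suc zero)    = sym (⊟-at q 1)
  pt (suc (suc n)) = trans (trans (ℤₚ.neg-involutive _) (alt-0 n)) (sym (⊟-at q (suc (suc n))))

sq-q : sq q ≈ q ^ˢ 2
sq-q = ≈-trans (pointwise pt) (qpow≈ 2)
  where
  pt : ∀ n → sq q n ≡ qpow 2 n
  pt zero                            = refl
  pt (suc zero)                      = refl
  pt (suc (suc zero))                = refl
  pt (suc (suc (suc zero)))          = refl
  pt (suc (suc (suc (suc n))))       = sq-0 n

sq-q^ : ∀ n → sq (q ^ˢ n) ≈ q ^ˢ (2 * n)
sq-q^ n = ≈-trans (sq-^ q n) (≈-trans (^-congˡ n sq-q) (^-assocʳ q 2 n))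

-- Inverses and cancellation

inv-suc : ∀ a n → inv a (suc n) ≡ ℤ.- (tail a ⊠ inv a) n
inv-suc a n = cong (ℤ.-_) (dot 1 n)
  where
  -- The offset `i` has to be general: each step of `dotFrom` raises it while the list of earlier
  -- coefficients shrinks.
  dot : ∀ i n → dotFrom a i (invRev a n) ≡ ((λ t → a (i + t)) ⊠ inv a) n
  dot i zero = trans (ℤₚ.+-identityʳ (a i ℤ.* 1ℤ))
    (trans (cong (λ k → a k ℤ.* 1ℤ) (sym (ℕₚ.+-identityʳ i))) (sym (⊠-zero (λ t → a (i + t)) (inv a))))
  dot i (suc n) = trans
    (cong₂ ℤ._+_ (cong (λ k → a k ℤ.* inv a (suc n)) (sym (ℕₚ.+-identityʳ i)))
      (trans (dot (suc i) n) (⊠-local n (λ t _ → cong a (sym (ℕₚ.+-suc i t))) (λ _ _ → refl))))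
    (sym (⊠-suc (λ t → a (i + t)) (inv a) n))

⊠-inv : ∀ {a} → a 0 ≡ 1ℤ → a ⊠ inv a ≈ 1ₛ
⊠-inv {a} a0 = pointwise λ where
    zero → trans (⊠-zero a (inv a)) (trans (cong (ℤ._* 1ℤ) a0) (sym (const-zero 1ℤ)))
    (suc n) → trans (⊠-suc a (inv a) n)
      (trans (cong₂ (λ c t → c ℤ.* t ℤ.+ (tail a ⊠ inv a) n) a0 (inv-suc a n))
        (trans (ℤ-Solver.solve 1 (λ y → con 1ℤ :* (:- y) :+ y := con 0ℤ) refl ((tail a ⊠ inv a) n))
          (sym (const-suc 1ℤ n))))
  where open ℤ-Solver

inverse-unique : ∀ {a b c} → a ⊠ b ≈ 1ₛ → a ⊠ c ≈ 1ₛ → b ≈ c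
inverse-unique {a} {b} {c} ab ac = begin
  b                 ≈⟨ S.*-identityˡ b ⟨
  1ₛ ⊠ b            ≈⟨ S.*-congʳ ac ⟨
  a ⊠ c ⊠ b         ≈⟨ Ring.solve 3 (λ a b c → a :* c :* b := c :* (a :* b)) ≈-refl a b c ⟩
  c ⊠ (a ⊠ b)       ≈⟨ S.*-congˡ ab ⟩
  c ⊠ 1ₛ            ≈⟨ S.*-identityʳ c ⟩
  c                 ∎
  where open Ring

unit-cancel : ∀ {u v a b} → u ⊠ v ≈ 1ₛ → u ⊠ a ≈ u ⊠ b → a ≈ b
unit-cancel {u} {v} {a} {b} uv p = begin
  a                 ≈⟨ expand a ⟩
  v ⊠ (u ⊠ a)       ≈⟨ S.*-congˡ p ⟩
  v ⊠ (u ⊠ b)       ≈⟨ expand b ⟨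
  b                 ∎
  where
  open Ring
  expand : ∀ a → a ≈ v ⊠ (u ⊠ a)
  expand a = begin
    a                 ≈⟨ S.*-identityˡ a ⟨
    1ₛ ⊠ a            ≈⟨ S.*-congʳ uv ⟨
    u ⊠ v ⊠ a         ≈⟨ Ring.solve 3 (λ u v a → u :* v :* a := v :* (u :* a)) ≈-refl u v a ⟩
    v ⊠ (u ⊠ a)       ∎

⊠-head : ∀ {a b} → a 0 ≡ 1ℤ → b 0 ≡ 1ℤ → (a ⊠ b) 0 ≡ 1ℤ
⊠-head {a} {b} p r = trans (⊠-zero a b) (cong₂ ℤ._*_ p r)

^-head : ∀ {a} n → a 0 ≡ 1ℤ → (a ^ˢ n) 0 ≡ 1ℤ
^-head zero    p = const-zero 1ℤ
^-head (suc n) p = ⊠-head p (^-head n p)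

pow≈ : ∀ a n → pow a n ≈ a ^ˢ n
pow≈ a zero    = 𝟙≈1ₛ
pow≈ a (suc n) = ≈-trans (S.reflexive (⊛≡⊠ a (pow a n))) (S.*-congˡ (pow≈ a n))

unit-^ : ∀ {a b} n → a ⊠ b ≈ 1ₛ → a ^ˢ n ⊠ b ^ˢ n ≈ 1ₛ
unit-^ {a} {b} n ab = ≈-trans (≈-sym (^-distrib-* a b n)) (≈-trans (^-congˡ n ab) (one^ n))
  where
  one^ : ∀ n → 1ₛ ^ˢ n ≈ 1ₛ
  one^ zero    = ≈-refl
  one^ (suc n) = ≈-trans (S.*-identityˡ (1ₛ ^ˢ n)) (one^ n)

inv-pow : ∀ {a} n → a 0 ≡ 1ℤ → inv (pow a n) ≈ inv a ^ˢ n
inv-pow {a} n p = inverse-unique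
  (≈-trans (S.*-congʳ (≈-sym (pow≈ a n))) (⊠-inv (trans (at (pow≈ a n) 0) (^-head n p))))
  (unit-^ n (⊠-inv p))

-- Congruences modulo powers of q

≈⇒≈[] : ∀ {a b n} → a ≈ b → a ≈[ n ] b
≈⇒≈[] p = upTo λ i _ → at p i

≈[]⇒≈ : ∀ {a b} → (∀ n → a ≈[ n ] b) → a ≈ b
≈[]⇒≈ p = pointwise λ n → below (p n) n ℕₚ.≤-refl

≈[]-sym : ∀ {a b n} → a ≈[ n ] b → b ≈[ n ] a
≈[]-sym p = upTo λ i i≤n → sym (below p i i≤n)

≈[]-trans : ∀ {a b c n} → a ≈[ n ] b → b ≈[ n ] c → a ≈[ n ] c
≈[]-trans p r = upTo λ i i≤n → trans (below p i i≤n) (below r i i≤n)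

⊠-cong[] : ∀ {a a′ b b′ n} → a ≈[ n ] a′ → b ≈[ n ] b′ → a ⊠ b ≈[ n ] a′ ⊠ b′
⊠-cong[] p r = upTo λ i i≤n →
  ⊠-local i (λ j j≤i → below p j (ℕₚ.≤-trans j≤i i≤n)) (λ j j≤i → below r j (ℕₚ.≤-trans j≤i i≤n))

⊞-cong[] : ∀ {a a′ b b′ n} → a ≈[ n ] a′ → b ≈[ n ] b′ → a ⊞ b ≈[ n ] a′ ⊞ b′
⊞-cong[] {a} {a′} {b} {b′} p r = upTo λ i i≤n →
  trans (⊞-at a b i) (trans (cong₂ ℤ._+_ (below p i i≤n) (below r i i≤n)) (sym (⊞-at a′ b′ i)))

alt-cong[] : ∀ {a b n} → a ≈[ n ] b → alt a ≈[ n ] alt b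
alt-cong[] p = upTo λ i i≤n → alt-local i λ j j≤i → below p j (ℕₚ.≤-trans j≤i i≤n)

sq-cong[] : ∀ {a b n} → a ≈[ n ] b → sq a ≈[ n ] sq b
sq-cong[] p = upTo λ i i≤n → sq-local i λ j j≤i → below p j (ℕₚ.≤-trans j≤i i≤n)

≈[]-weaken : ∀ {a b m n} → m ≤ n → a ≈[ n ] b → a ≈[ m ] b
≈[]-weaken m≤n p = upTo λ i i≤m → below p i (ℕₚ.≤-trans i≤m m≤n)

-- Euler products

E⁻ E⁺ : ℕ → PS
E⁻ = finProd 1
E⁺ zero    = 1ₛ
E⁺ (suc n) = E⁺ n ⊠ (1ₛ ⊞ q ^ˢ suc n)

finProd-suc : ∀ k n → finProd k (suc n) ≈ finProd k n ⊠ (1ₛ ⊞ ⊟ q ^ˢ (k * suc n))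
finProd-suc k n = ≈-trans (S.reflexive (⊛≡⊠ (finProd k n) (𝟙 ⊖ qpow (k * suc n)))) (S.*-congˡ (factor (k * suc n)))
  where
  factor : ∀ m → 𝟙 ⊖ qpow m ≈ 1ₛ ⊞ ⊟ q ^ˢ m
  factor m = ≈-trans
    (pointwise λ i → sym (trans (⊞-at 𝟙 (⊟ qpow m) i) (cong (λ t → 𝟙 i ℤ.+ t) (⊟-at (qpow m) i))))
    (⊞-cong 𝟙≈1ₛ (⊟-cong (qpow≈ m)))

E⁻-suc : ∀ n → E⁻ (suc n) ≈ E⁻ n ⊠ (1ₛ ⊞ ⊟ q ^ˢ suc n)
E⁻-suc n = ≈-trans (finProd-suc 1 n)
  (S.*-congˡ (⊞-cong ≈-refl (⊟-cong (S.reflexive (cong (q ^ˢ_) (ℕₚ.+-identityʳ (suc n)))))))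

-- The new factor differs from 1 by q^M with M > n. The index is `suc k` because at index 0 that
-- power would be q^0.
finProd-stable : ∀ k n i → i ≤ n → finProd (suc k) (suc n) i ≡ finProd (suc k) n i
finProd-stable k n i i≤n = trans (at (finProd-suc (suc k) n) i) (trans (at expand i)
  (trans (⊞-at F (q ^ˢ M ⊠ ⊟ F) i) (trans (cong (λ t → F i ℤ.+ t) (q^-⊠-below M (⊟ F) i i<M)) (ℤₚ.+-identityʳ (F i)))))
  where
  F = finProd (suc k) n
  M = suc k * suc n
  i<M : i < M
  i<M = ℕₚ.≤-trans (s≤s i≤n) (ℕₚ.m≤m+n (suc n) (k * suc n))
  expand : F ⊠ (1ₛ ⊞ ⊟ q ^ˢ M) ≈ F ⊞ q ^ˢ M ⊠ ⊟ F
  expand = solve 2 (λ a b → a :* (con 1ℤ :+ :- b) := a :+ b :* (:- a)) ≈-refl F (q ^ˢ M)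
    where open Ring

-- `f` takes its n-th coefficient from the n-th partial product, and by stability every longer
-- product has the same one. Each identity between finite products thus transfers to `f`.
f≈[]finProd : ∀ k {n m} → n ≤ m → f (suc k) ≈[ n ] finProd (suc k) m
f≈[]finProd k {n} {m} n≤m = upTo λ i i≤n → stable i (ℕₚ.≤⇒≤′ (ℕₚ.≤-trans i≤n n≤m))
  where
  stable : ∀ i {m} → i ≤′ m → finProd (suc k) i i ≡ finProd (suc k) m i
  stable i ≤′-refl       = refl
  stable i (≤′-step i≤m) = trans (stable i i≤m) (sym (finProd-stable k _ i (ℕₚ.≤′⇒≤ i≤m)))

sq-1-q^ : ∀ m → sq (1ₛ ⊞ ⊟ q ^ˢ m) ≈ 1ₛ ⊞ ⊟ q ^ˢ (2 * m)
sq-1-q^ m = ≈-trans (sq-⊞ 1ₛ (⊟ q ^ˢ m))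
  (⊞-cong (sq-const 1ℤ) (≈-trans (sq-⊟ (q ^ˢ m)) (⊟-cong (sq-q^ m))))

sq-E⁻-suc : ∀ n → sq (E⁻ (suc n)) ≈ sq (E⁻ n) ⊠ (1ₛ ⊞ ⊟ q ^ˢ (2 * suc n))
sq-E⁻-suc n = ≈-trans (sq-cong (E⁻-suc n)) (≈-trans (sq-⊠ (E⁻ n) _) (S.*-congˡ (sq-1-q^ (suc n))))

finProd-2 : ∀ n → finProd 2 n ≈ sq (E⁻ n)
finProd-2 zero    = ≈-trans 𝟙≈1ₛ (≈-sym (≈-trans (sq-cong 𝟙≈1ₛ) (sq-const 1ℤ)))
finProd-2 (suc n) = ≈-trans (finProd-suc 2 n)
  (≈-trans (S.*-congʳ (finProd-2 n)) (≈-sym (sq-E⁻-suc n)))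

f₁≈[] : ∀ {n m} → n ≤ m → f 1 ≈[ n ] E⁻ m
f₁≈[] = f≈[]finProd 0

f₂≈ : f 2 ≈ sq (f 1)
f₂≈ = ≈[]⇒≈ λ n → ≈[]-trans (f≈[]finProd 1 (ℕₚ.≤-refl {n}))
  (≈[]-trans (≈⇒≈[] (finProd-2 n)) (sq-cong[] (≈[]-sym (f₁≈[] ℕₚ.≤-refl))))

q^2* : ∀ m → q ^ˢ (2 * m) ≈ q ^ˢ m ⊠ q ^ˢ m
q^2* m = ≈-trans (S.reflexive (cong (λ k → q ^ˢ (m + k)) (ℕₚ.+-identityʳ m))) (^-homo-* q m m)

E⁻E⁺ : ∀ n → E⁻ n ⊠ E⁺ n ≈ sq (E⁻ n)
E⁻E⁺ zero    = ≈-trans (≈-trans (S.*-congʳ 𝟙≈1ₛ) (S.*-identityˡ 1ₛ))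
  (≈-sym (≈-trans (sq-cong 𝟙≈1ₛ) (sq-const 1ℤ)))
E⁻E⁺ (suc n) = begin
  E⁻ (suc n) ⊠ E⁺ (suc n)                               ≈⟨ S.*-congʳ (E⁻-suc n) ⟩
  E⁻ n ⊠ (1ₛ ⊞ ⊟ y) ⊠ (E⁺ n ⊠ (1ₛ ⊞ y))                 ≈⟨ solve 3 (λ a b y →
      a :* (con 1ℤ :+ :- y) :* (b :* (con 1ℤ :+ y)) := a :* b :* (con 1ℤ :+ :- (y :* y))) ≈-refl (E⁻ n) (E⁺ n) y ⟩
  E⁻ n ⊠ E⁺ n ⊠ (1ₛ ⊞ ⊟ (y ⊠ y))
    ≈⟨ ⊠-cong (E⁻E⁺ n) (⊞-cong ≈-refl (⊟-cong (≈-sym (q^2* (suc n))))) ⟩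
  sq (E⁻ n) ⊠ (1ₛ ⊞ ⊟ q ^ˢ (2 * suc n))                 ≈⟨ sq-E⁻-suc n ⟨
  sq (E⁻ (suc n))                                       ∎
  where
  open Ring
  y = q ^ˢ suc n

E⁻-head : ∀ n → E⁻ n 0 ≡ 1ℤ
E⁻-head zero    = refl
E⁻-head (suc n) = trans (finProd-stable 0 n 0 z≤n) (E⁻-head n)

E⁺-head : ∀ n → E⁺ n 0 ≡ 1ℤ
E⁺-head zero    = const-zero 1ℤ
E⁺-head (suc n) = ⊠-head {E⁺ n} (E⁺-head n)
  (trans (⊞-at 1ₛ (q ^ˢ suc n) 0) (cong₂ ℤ._+_ (const-zero 1ℤ) (⊠-q-zero (q ^ˢ n))))

alt-q^even : ∀ n → alt (q ^ˢ (2 * n)) ≈ q ^ˢ (2 * n)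
alt-q^even n = begin
  alt (q ^ˢ (2 * n))    ≈⟨ alt-cong (sq-q^ n) ⟨
  alt (sq (q ^ˢ n))     ≈⟨ alt-sq (q ^ˢ n) ⟩
  sq (q ^ˢ n)           ≈⟨ sq-q^ n ⟩
  q ^ˢ (2 * n)          ∎

-- Finite form of f₁(q) f₁(-q) f₄ = f₂³. Factors are added in pairs, y = q^(2n+1) and z = q^(2n+2).
-- Replacing q by -q changes the sign of y alone, so both sides gain (1 - y²)(1 - z)²(1 - z²). The
-- mixed lengths n and 2n are those for which this balance is exact.
alt-E⁻-even : ∀ n → E⁻ (2 * n) ⊠ alt (E⁻ (2 * n)) ⊠ sq (sq (E⁻ n))
              ≈ sq (E⁻ n) ⊠ sq (E⁻ n) ⊠ sq (E⁻ (2 * n))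
alt-E⁻-even zero = begin
    𝟙 ⊠ alt 𝟙 ⊠ sq (sq 𝟙)   ≈⟨ ⊠-cong (⊠-cong 𝟙≈1ₛ (≈-trans (alt-cong 𝟙≈1ₛ) (alt-const 1ℤ)))
                                  (≈-trans (sq-cong sq𝟙) (sq-const 1ℤ)) ⟩
    1ₛ ⊠ 1ₛ ⊠ 1ₛ            ≈⟨ ⊠-cong (⊠-cong sq𝟙 sq𝟙) sq𝟙 ⟨
    sq 𝟙 ⊠ sq 𝟙 ⊠ sq 𝟙      ∎
  where
  sq𝟙 : sq 𝟙 ≈ 1ₛ
  sq𝟙 = ≈-trans (sq-cong 𝟙≈1ₛ) (sq-const 1ℤ)
alt-E⁻-even (suc n) = begin
    E⁻ (2 * suc n) ⊠ alt (E⁻ (2 * suc n)) ⊠ sq (sq (E⁻ (suc n)))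
      ≈⟨ ⊠-cong (⊠-cong e-suc alt-e-suc) sqsq-suc ⟩
    e ⊠ (1ₛ ⊞ ⊟ y) ⊠ (1ₛ ⊞ ⊟ z) ⊠ (alt e ⊠ (1ₛ ⊞ y) ⊠ (1ₛ ⊞ ⊟ z)) ⊠ (sq (sq (E⁻ n)) ⊠ (1ₛ ⊞ ⊟ (z ⊠ z)))
      ≈⟨ solve 5 (λ e a s y z →
           e :* (con 1ℤ :+ :- y) :* (con 1ℤ :+ :- z) :* (a :* (con 1ℤ :+ y) :* (con 1ℤ :+ :- z)) :* (s :* (con 1ℤ :+ :- (z :* z)))
           := (e :* a :* s) :* ((con 1ℤ :+ :- z) :* (con 1ℤ :+ :- z) :* (con 1ℤ :+ :- (y :* y)) :* (con 1ℤ :+ :- (z :* z))))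
         ≈-refl e (alt e) (sq (sq (E⁻ n))) y z ⟩
    (e ⊠ alt e ⊠ sq (sq (E⁻ n))) ⊠ ((1ₛ ⊞ ⊟ z) ⊠ (1ₛ ⊞ ⊟ z) ⊠ (1ₛ ⊞ ⊟ (y ⊠ y)) ⊠ (1ₛ ⊞ ⊟ (z ⊠ z)))
      ≈⟨ S.*-congʳ (alt-E⁻-even n) ⟩
    (sq (E⁻ n) ⊠ sq (E⁻ n) ⊠ sq e) ⊠ ((1ₛ ⊞ ⊟ z) ⊠ (1ₛ ⊞ ⊟ z) ⊠ (1ₛ ⊞ ⊟ (y ⊠ y)) ⊠ (1ₛ ⊞ ⊟ (z ⊠ z)))
      ≈⟨ solve 5 (λ s a z u v → (s :* s :* a) :* (z :* z :* u :* v) := (s :* z) :* (s :* z) :* (a :* u :* v))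
         ≈-refl (sq (E⁻ n)) (sq e) (1ₛ ⊞ ⊟ z) (1ₛ ⊞ ⊟ (y ⊠ y)) (1ₛ ⊞ ⊟ (z ⊠ z)) ⟩
    (sq (E⁻ n) ⊠ (1ₛ ⊞ ⊟ z)) ⊠ (sq (E⁻ n) ⊠ (1ₛ ⊞ ⊟ z)) ⊠ (sq e ⊠ (1ₛ ⊞ ⊟ (y ⊠ y)) ⊠ (1ₛ ⊞ ⊟ (z ⊠ z)))
      ≈⟨ ⊠-cong (⊠-cong (sq-E⁻-suc n) (sq-E⁻-suc n)) sq-e-suc ⟨
    sq (E⁻ (suc n)) ⊠ sq (E⁻ (suc n)) ⊠ sq (E⁻ (2 * suc n)) ∎
  where
  open Ring
  e = E⁻ (2 * n)
  y = q ^ˢ suc (2 * n)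
  z = q ^ˢ (2 * suc n)
  2*suc : 2 * suc n ≡ suc (suc (2 * n))
  2*suc = ℕₚ.*-suc 2 n
  e-suc : E⁻ (2 * suc n) ≈ e ⊠ (1ₛ ⊞ ⊟ y) ⊠ (1ₛ ⊞ ⊟ z)
  e-suc = begin
    E⁻ (2 * suc n)                                            ≡⟨ cong E⁻ 2*suc ⟩
    E⁻ (suc (suc (2 * n)))                                    ≈⟨ E⁻-suc (suc (2 * n)) ⟩
    E⁻ (suc (2 * n)) ⊠ (1ₛ ⊞ ⊟ q ^ˢ suc (suc (2 * n)))        ≈⟨ S.*-congʳ (E⁻-suc (2 * n)) ⟩
    e ⊠ (1ₛ ⊞ ⊟ y) ⊠ (1ₛ ⊞ ⊟ q ^ˢ suc (suc (2 * n)))          ≡⟨ cong (λ k → e ⊠ (1ₛ ⊞ ⊟ y) ⊠ (1ₛ ⊞ ⊟ q ^ˢ k)) 2*suc ⟨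
    e ⊠ (1ₛ ⊞ ⊟ y) ⊠ (1ₛ ⊞ ⊟ z)                               ∎
  alt-1- : ∀ {a b} → alt a ≈ b → alt (1ₛ ⊞ ⊟ a) ≈ 1ₛ ⊞ ⊟ b
  alt-1- {a} p = ≈-trans (alt-⊞ 1ₛ (⊟ a)) (⊞-cong (alt-const 1ℤ) (≈-trans (alt-⊟ a) (⊟-cong p)))
  alt-y : alt y ≈ ⊟ y
  alt-y = ≈-trans (alt-⊠ q (q ^ˢ (2 * n))) (≈-trans (⊠-cong alt-q (alt-q^even n))
    (solve 2 (λ a b → (:- a) :* b := :- (a :* b)) ≈-refl q (q ^ˢ (2 * n))))
  alt-e-suc : alt (E⁻ (2 * suc n)) ≈ alt e ⊠ (1ₛ ⊞ y) ⊠ (1ₛ ⊞ ⊟ z)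
  alt-e-suc = begin
    alt (E⁻ (2 * suc n))                                ≈⟨ alt-cong e-suc ⟩
    alt (e ⊠ (1ₛ ⊞ ⊟ y) ⊠ (1ₛ ⊞ ⊟ z))                   ≈⟨ alt-⊠ (e ⊠ (1ₛ ⊞ ⊟ y)) (1ₛ ⊞ ⊟ z) ⟩
    alt (e ⊠ (1ₛ ⊞ ⊟ y)) ⊠ alt (1ₛ ⊞ ⊟ z)               ≈⟨ ⊠-cong (alt-⊠ e (1ₛ ⊞ ⊟ y)) (alt-1- (alt-q^even (suc n))) ⟩
    alt e ⊠ alt (1ₛ ⊞ ⊟ y) ⊠ (1ₛ ⊞ ⊟ z)                 ≈⟨ S.*-congʳ (S.*-congˡ (alt-1- alt-y)) ⟩
    alt e ⊠ (1ₛ ⊞ ⊟ ⊟ y) ⊠ (1ₛ ⊞ ⊟ z)                   ≈⟨ S.*-congʳ (S.*-congˡ (⊞-cong ≈-refl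
                                                              (solve 1 (λ y → :- (:- y) := y) ≈-refl y))) ⟩
    alt e ⊠ (1ₛ ⊞ y) ⊠ (1ₛ ⊞ ⊟ z)                       ∎
  1-q^2* : ∀ m → 1ₛ ⊞ ⊟ q ^ˢ (2 * m) ≈ 1ₛ ⊞ ⊟ (q ^ˢ m ⊠ q ^ˢ m)
  1-q^2* m = ⊞-cong ≈-refl (⊟-cong (q^2* m))
  sqsq-suc : sq (sq (E⁻ (suc n))) ≈ sq (sq (E⁻ n)) ⊠ (1ₛ ⊞ ⊟ (z ⊠ z))
  sqsq-suc = begin
    sq (sq (E⁻ (suc n)))                                ≈⟨ sq-cong (sq-E⁻-suc n) ⟩
    sq (sq (E⁻ n) ⊠ (1ₛ ⊞ ⊟ z))                         ≈⟨ sq-⊠ (sq (E⁻ n)) (1ₛ ⊞ ⊟ z) ⟩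
    sq (sq (E⁻ n)) ⊠ sq (1ₛ ⊞ ⊟ z)                      ≈⟨ S.*-congˡ (≈-trans (sq-1-q^ (2 * suc n)) (1-q^2* (2 * suc n))) ⟩
    sq (sq (E⁻ n)) ⊠ (1ₛ ⊞ ⊟ (z ⊠ z))                   ∎
  sq-e-suc : sq (E⁻ (2 * suc n)) ≈ sq e ⊠ (1ₛ ⊞ ⊟ (y ⊠ y)) ⊠ (1ₛ ⊞ ⊟ (z ⊠ z))
  sq-e-suc = begin
    sq (E⁻ (2 * suc n))                                 ≈⟨ sq-cong e-suc ⟩
    sq (e ⊠ (1ₛ ⊞ ⊟ y) ⊠ (1ₛ ⊞ ⊟ z))                    ≈⟨ sq-⊠ (e ⊠ (1ₛ ⊞ ⊟ y)) (1ₛ ⊞ ⊟ z) ⟩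
    sq (e ⊠ (1ₛ ⊞ ⊟ y)) ⊠ sq (1ₛ ⊞ ⊟ z)                 ≈⟨ ⊠-cong (sq-⊠ e (1ₛ ⊞ ⊟ y)) (≈-trans (sq-1-q^ (2 * suc n)) (1-q^2* (2 * suc n))) ⟩
    sq e ⊠ sq (1ₛ ⊞ ⊟ y) ⊠ (1ₛ ⊞ ⊟ (z ⊠ z))             ≈⟨ S.*-congʳ (S.*-congˡ (≈-trans (sq-1-q^ (suc (2 * n))) (1-q^2* (suc (2 * n))))) ⟩
    sq e ⊠ (1ₛ ⊞ ⊟ (y ⊠ y)) ⊠ (1ₛ ⊞ ⊟ (z ⊠ z))          ∎

alt-f₁ : f 1 ⊠ alt (f 1) ⊠ sq (sq (f 1)) ≈ sq (f 1) ⊠ sq (f 1) ⊠ sq (f 1)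
alt-f₁ = ≈[]⇒≈ λ n →
  let large = f₁≈[] (ℕₚ.m≤m+n n (n + 0))
      small = f₁≈[] (ℕₚ.≤-refl {n})
  in ≈[]-trans (⊠-cong[] (⊠-cong[] large (alt-cong[] large)) (sq-cong[] (sq-cong[] small)))
     (≈[]-trans (≈⇒≈[] (alt-E⁻-even n))
       (≈[]-sym (⊠-cong[] (⊠-cong[] (sq-cong[] small) (sq-cong[] small)) (sq-cong[] large))))

-- Gauss's theta series

2ₛ : PS
2ₛ = const (+ 2)

sgn : ℕ → PS
sgn n = (⊟ 1ₛ) ^ˢ n

θ : ℕ → PS
θ zero    = 1ₛ
θ (suc n) = θ n ⊞ 2ₛ ⊠ (sgn (suc n) ⊠ q ^ˢ (suc n * suc n))

-- With Q n = Π (1 − q^k)/(1 + q^k) and h = 1/Q, the sum partial n n equals θ n, while modulo q^(n+1)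
-- only its leading summand Q n survives.
module Shanks where
  open Ring

  -- `r s` is what `h s` and `h (suc s)` have in common: the factor 1 - q^(s+1) turns it into the
  -- former, 1 + q^(s+1) into the latter.
  Q h r : ℕ → PS
  Q n = E⁻ n ⊠ inv (E⁺ n)
  h n = E⁺ n ⊠ inv (E⁻ n)
  r n = E⁺ n ⊠ inv (E⁻ (suc n))

  inv-factor : ∀ {a b c} → a 0 ≡ 1ℤ → b 0 ≡ 1ℤ → b ≈ a ⊠ c → inv a ≈ c ⊠ inv b
  inv-factor {a} {b} {c} a0 b0 p = inverse-unique (⊠-inv a0)
    (≈-trans (≈-sym (⊠-assoc a c (inv b))) (≈-trans (S.*-congʳ (≈-sym p)) (⊠-inv b0)))

  r-minus : ∀ s → (1ₛ ⊞ ⊟ q ^ˢ suc s) ⊠ r s ≈ h s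
  r-minus s = begin
    (1ₛ ⊞ ⊟ q ^ˢ suc s) ⊠ (E⁺ s ⊠ inv (E⁻ (suc s)))
      ≈⟨ solve 3 (λ a b c → a :* (b :* c) := b :* (a :* c)) ≈-refl (1ₛ ⊞ ⊟ q ^ˢ suc s) (E⁺ s) (inv (E⁻ (suc s))) ⟩
    E⁺ s ⊠ ((1ₛ ⊞ ⊟ q ^ˢ suc s) ⊠ inv (E⁻ (suc s)))
      ≈⟨ S.*-congˡ (inv-factor (E⁻-head s) (E⁻-head (suc s)) (E⁻-suc s)) ⟨
    h s ∎

  r-plus : ∀ s → (1ₛ ⊞ q ^ˢ suc s) ⊠ r s ≈ h (suc s)
  r-plus s = solve 3 (λ a b c → a :* (b :* c) := (b :* a) :* c) ≈-refl (1ₛ ⊞ q ^ˢ suc s) (E⁺ s) (inv (E⁻ (suc s)))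

  Q-step : ∀ n → (1ₛ ⊞ q ^ˢ suc n) ⊠ Q (suc n) ≈ (1ₛ ⊞ ⊟ q ^ˢ suc n) ⊠ Q n
  Q-step n = begin
    (1ₛ ⊞ y) ⊠ (E⁻ (suc n) ⊠ inv (E⁺ (suc n)))
      ≈⟨ S.*-congˡ (S.*-congʳ (E⁻-suc n)) ⟩
    (1ₛ ⊞ y) ⊠ (E⁻ n ⊠ (1ₛ ⊞ ⊟ y) ⊠ inv (E⁺ (suc n)))
      ≈⟨ solve 4 (λ a b c d → a :* (b :* c :* d) := c :* (b :* (a :* d))) ≈-refl
           (1ₛ ⊞ y) (E⁻ n) (1ₛ ⊞ ⊟ y) (inv (E⁺ (suc n))) ⟩
    (1ₛ ⊞ ⊟ y) ⊠ (E⁻ n ⊠ ((1ₛ ⊞ y) ⊠ inv (E⁺ (suc n))))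
      ≈⟨ S.*-congˡ (S.*-congˡ (inv-factor (E⁺-head n) (E⁺-head (suc n)) ≈-refl)) ⟨
    (1ₛ ⊞ ⊟ y) ⊠ Q n ∎
    where y = q ^ˢ suc n

  Q-h : ∀ n → Q n ⊠ h n ≈ 1ₛ
  Q-h n = begin
    E⁻ n ⊠ inv (E⁺ n) ⊠ (E⁺ n ⊠ inv (E⁻ n))
      ≈⟨ solve 4 (λ a b c d → a :* b :* (c :* d) := (a :* d) :* (c :* b)) ≈-refl
           (E⁻ n) (inv (E⁺ n)) (E⁺ n) (inv (E⁻ n)) ⟩
    E⁻ n ⊠ inv (E⁻ n) ⊠ (E⁺ n ⊠ inv (E⁺ n))
      ≈⟨ ⊠-cong (⊠-inv (E⁻-head n)) (⊠-inv (E⁺-head n)) ⟩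
    1ₛ ⊠ 1ₛ ≈⟨ S.*-identityˡ 1ₛ ⟩
    1ₛ ∎

  term : ℕ → ℕ → PS
  term n s = 2ₛ ⊠ (sgn (suc s) ⊠ (Q n ⊠ r s ⊠ (q ^ˢ suc n) ^ˢ suc s))

  partial : ℕ → ℕ → PS
  partial n zero    = Q n
  partial n (suc k) = partial n k ⊞ term n k

  term-suc : ∀ n s → (1ₛ ⊞ q ^ˢ suc n) ⊠ term (suc n) s
           ≈ 2ₛ ⊠ (sgn (suc s) ⊠ ((1ₛ ⊞ ⊟ q ^ˢ suc n) ⊠ Q n ⊠ r s ⊠ (q ^ˢ suc s ⊠ (q ^ˢ suc n) ^ˢ suc s)))
  term-suc n s = begin
    (1ₛ ⊞ y) ⊠ (2ₛ ⊠ (sgn (suc s) ⊠ (Q (suc n) ⊠ r s ⊠ (q ⊠ y) ^ˢ suc s)))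
      ≈⟨ S.*-congˡ (S.*-congˡ (S.*-congˡ (S.*-congˡ (^-distrib-* q y (suc s))))) ⟩
    (1ₛ ⊞ y) ⊠ (2ₛ ⊠ (sgn (suc s) ⊠ (Q (suc n) ⊠ r s ⊠ (q ^ˢ suc s ⊠ y ^ˢ suc s))))
      ≈⟨ solve 6 (λ a b c d e g → a :* (b :* (c :* (d :* e :* g))) := b :* (c :* (a :* d :* e :* g))) ≈-refl
           (1ₛ ⊞ y) 2ₛ (sgn (suc s)) (Q (suc n)) (r s) (q ^ˢ suc s ⊠ y ^ˢ suc s) ⟩
    2ₛ ⊠ (sgn (suc s) ⊠ ((1ₛ ⊞ y) ⊠ Q (suc n) ⊠ r s ⊠ (q ^ˢ suc s ⊠ y ^ˢ suc s)))
      ≈⟨ S.*-congˡ (S.*-congˡ (S.*-congʳ (S.*-congʳ (Q-step n)))) ⟩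
    2ₛ ⊠ (sgn (suc s) ⊠ ((1ₛ ⊞ ⊟ y) ⊠ Q n ⊠ r s ⊠ (q ^ˢ suc s ⊠ y ^ˢ suc s))) ∎
    where y = q ^ˢ suc n

  -- For a fixed number of summands, raising n leaves only a boundary term. Induction on k moves
  -- this boundary: with z = q^(k+1), the old one, carrying `h k`, cancels against (1 - z) `r k`,
  -- and (1 + z) `r k` = `h (suc k)` forms the next. The factor 1 + q^(n+1) clears the denominator
  -- of `Q (suc n)` relative to `Q n`.
  telescope : ∀ n k → (1ₛ ⊞ q ^ˢ suc n) ⊠ (partial (suc n) k ⊞ ⊟ partial n k)
            ≈ 2ₛ ⊠ (sgn (suc k) ⊠ (Q n ⊠ h k ⊠ (q ^ˢ suc n) ^ˢ suc k))
  telescope n zero = begin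
    (1ₛ ⊞ y) ⊠ (Q (suc n) ⊞ ⊟ Q n)
      ≈⟨ solve 3 (λ y a b → (con 1ℤ :+ y) :* (a :+ :- b) := (con 1ℤ :+ y) :* a :+ :- ((con 1ℤ :+ y) :* b)) ≈-refl y (Q (suc n)) (Q n) ⟩
    (1ₛ ⊞ y) ⊠ Q (suc n) ⊞ ⊟ ((1ₛ ⊞ y) ⊠ Q n)
      ≈⟨ ⊞-cong (Q-step n) ≈-refl ⟩
    (1ₛ ⊞ ⊟ y) ⊠ Q n ⊞ ⊟ ((1ₛ ⊞ y) ⊠ Q n)
      ≈⟨ solve 2 (λ y a → (con 1ℤ :+ :- y) :* a :+ :- ((con 1ℤ :+ y) :* a)
           := con (+ 2) :* ((:- con 1ℤ) :* con 1ℤ :* (a :* con 1ℤ :* (y :* con 1ℤ)))) ≈-refl y (Q n) ⟩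
    2ₛ ⊠ (sgn 1 ⊠ (Q n ⊠ 1ₛ ⊠ y ^ˢ 1))
      ≈⟨ S.*-congˡ (S.*-congˡ (S.*-congʳ (S.*-congˡ h0))) ⟨
    2ₛ ⊠ (sgn 1 ⊠ (Q n ⊠ h 0 ⊠ y ^ˢ 1)) ∎
    where
    y = q ^ˢ suc n
    h0 : h 0 ≈ 1ₛ
    h0 = ≈-trans (⊠-comm 1ₛ (inv 𝟙)) (≈-trans (S.*-identityʳ (inv 𝟙))
      (inverse-unique {𝟙} (⊠-inv refl) (≈-trans (S.*-identityʳ 𝟙) 𝟙≈1ₛ)))
  telescope n (suc k) = begin
    (1ₛ ⊞ y) ⊠ (partial (suc n) k ⊞ term (suc n) k ⊞ ⊟ (partial n k ⊞ term n k))
      ≈⟨ solve 5 (λ y a b c d → y :* (a :+ b :+ :- (c :+ d)) := y :* (a :+ :- c) :+ (y :* b :+ :- (y :* d))) ≈-refl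
           (1ₛ ⊞ y) (partial (suc n) k) (term (suc n) k) (partial n k) (term n k) ⟩
    (1ₛ ⊞ y) ⊠ (partial (suc n) k ⊞ ⊟ partial n k) ⊞ ((1ₛ ⊞ y) ⊠ term (suc n) k ⊞ ⊟ ((1ₛ ⊞ y) ⊠ term n k))
      ≈⟨ ⊞-cong (telescope n k) (⊞-cong (term-suc n k) ≈-refl) ⟩
    2ₛ ⊠ (σ ⊠ (Q n ⊠ h k ⊠ Y)) ⊞ (2ₛ ⊠ (σ ⊠ ((1ₛ ⊞ ⊟ y) ⊠ Q n ⊠ r k ⊠ (z ⊠ Y))) ⊞ ⊟ ((1ₛ ⊞ y) ⊠ (2ₛ ⊠ (σ ⊠ (Q n ⊠ r k ⊠ Y)))))
      ≈⟨ solve 7 (λ σ Q h Y y z r →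
           con (+ 2) :* (σ :* (Q :* h :* Y)) :+ (con (+ 2) :* (σ :* ((con 1ℤ :+ :- y) :* Q :* r :* (z :* Y))) :+ :- ((con 1ℤ :+ y) :* (con (+ 2) :* (σ :* (Q :* r :* Y)))))
           := con (+ 2) :* (σ :* (Q :* Y)) :* (h :+ :- ((con 1ℤ :+ :- z) :* r)) :+ con (+ 2) :* ((:- con 1ℤ) :* σ :* (Q :* ((con 1ℤ :+ z) :* r) :* (y :* Y)))) ≈-refl
           σ (Q n) (h k) Y y z (r k) ⟩
    2ₛ ⊠ (σ ⊠ (Q n ⊠ Y)) ⊠ (h k ⊞ ⊟ ((1ₛ ⊞ ⊟ z) ⊠ r k)) ⊞ 2ₛ ⊠ (⊟ 1ₛ ⊠ σ ⊠ (Q n ⊠ ((1ₛ ⊞ z) ⊠ r k) ⊠ (y ⊠ Y)))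
      ≈⟨ ⊞-cong (S.*-congˡ (≈-trans (⊞-cong ≈-refl (⊟-cong (r-minus k))) (S.-‿inverseʳ (h k))))
           (S.*-congˡ (S.*-congˡ (S.*-congʳ (S.*-congˡ (r-plus k))))) ⟩
    2ₛ ⊠ (σ ⊠ (Q n ⊠ Y)) ⊠ 0ₛ ⊞ 2ₛ ⊠ (⊟ 1ₛ ⊠ σ ⊠ (Q n ⊠ h (suc k) ⊠ (y ⊠ Y)))
      ≈⟨ solve 2 (λ a b → a :* con 0ℤ :+ b := b) ≈-refl (2ₛ ⊠ (σ ⊠ (Q n ⊠ Y))) (2ₛ ⊠ (⊟ 1ₛ ⊠ σ ⊠ (Q n ⊠ h (suc k) ⊠ (y ⊠ Y)))) ⟩
    2ₛ ⊠ (⊟ 1ₛ ⊠ σ ⊠ (Q n ⊠ h (suc k) ⊠ (y ⊠ Y))) ∎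
    where
    y = q ^ˢ suc n
    z = q ^ˢ suc k
    σ = sgn (suc k)
    Y = y ^ˢ suc k

  -- On the diagonal the boundary term and the one additional summand contribute, as Q h = 1, the
  -- multiples 1 and y of the same 2 σ Y. Their sum contains 1 + y, which cancels, and Y =
  -- (q^(n+1))^(n+1) is the power with square exponent.
  partial-step : ∀ n → partial (suc n) (suc n) ⊞ ⊟ partial n n ≈ 2ₛ ⊠ (sgn (suc n) ⊠ q ^ˢ (suc n * suc n))
  partial-step n = unit-cancel (⊠-inv {1ₛ ⊞ y} head) (begin
    (1ₛ ⊞ y) ⊠ (partial (suc n) n ⊞ term (suc n) n ⊞ ⊟ partial n n)
      ≈⟨ solve 4 (λ y a b c → y :* (a :+ b :+ :- c) := y :* (a :+ :- c) :+ y :* b) ≈-refl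
           (1ₛ ⊞ y) (partial (suc n) n) (term (suc n) n) (partial n n) ⟩
    (1ₛ ⊞ y) ⊠ (partial (suc n) n ⊞ ⊟ partial n n) ⊞ (1ₛ ⊞ y) ⊠ term (suc n) n
      ≈⟨ ⊞-cong (telescope n n) (term-suc n n) ⟩
    2ₛ ⊠ (σ ⊠ (Q n ⊠ h n ⊠ Y)) ⊞ 2ₛ ⊠ (σ ⊠ ((1ₛ ⊞ ⊟ y) ⊠ Q n ⊠ r n ⊠ (y ⊠ Y)))
      ≈⟨ ⊞-cong ≈-refl (S.*-congˡ (S.*-congˡ (S.*-congʳ (≈-trans
           (solve 3 (λ a b c → a :* b :* c := b :* (a :* c)) ≈-refl (1ₛ ⊞ ⊟ y) (Q n) (r n)) (S.*-congˡ (r-minus n)))))) ⟩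
    2ₛ ⊠ (σ ⊠ (Q n ⊠ h n ⊠ Y)) ⊞ 2ₛ ⊠ (σ ⊠ (Q n ⊠ h n ⊠ (y ⊠ Y)))
      ≈⟨ ⊞-cong (S.*-congˡ (S.*-congˡ (S.*-congʳ (Q-h n)))) (S.*-congˡ (S.*-congˡ (S.*-congʳ (Q-h n)))) ⟩
    2ₛ ⊠ (σ ⊠ (1ₛ ⊠ Y)) ⊞ 2ₛ ⊠ (σ ⊠ (1ₛ ⊠ (y ⊠ Y)))
      ≈⟨ solve 3 (λ σ y Y → con (+ 2) :* (σ :* (con 1ℤ :* Y)) :+ con (+ 2) :* (σ :* (con 1ℤ :* (y :* Y)))
           := (con 1ℤ :+ y) :* (con (+ 2) :* (σ :* Y))) ≈-refl σ y Y ⟩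
    (1ₛ ⊞ y) ⊠ (2ₛ ⊠ (σ ⊠ Y))
      ≈⟨ S.*-congˡ (S.*-congˡ (S.*-congˡ (^-assocʳ q (suc n) (suc n)))) ⟩
    (1ₛ ⊞ y) ⊠ (2ₛ ⊠ (σ ⊠ q ^ˢ (suc n * suc n))) ∎)
    where
    y = q ^ˢ suc n
    σ = sgn (suc n)
    Y = y ^ˢ suc n
    head : (1ₛ ⊞ y) 0 ≡ 1ℤ
    head = trans (⊞-at 1ₛ y 0) (cong₂ ℤ._+_ (const-zero 1ℤ) (⊠-q-zero (q ^ˢ n)))

  partial≈θ : ∀ n → partial n n ≈ θ n
  partial≈θ zero = ≈-trans (S.*-congʳ 𝟙≈1ₛ) (⊠-inv (const-zero 1ℤ))
  partial≈θ (suc n) = begin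
    partial (suc n) (suc n)
      ≈⟨ solve 2 (λ a b → a := b :+ (a :+ :- b)) ≈-refl (partial (suc n) (suc n)) (partial n n) ⟩
    partial n n ⊞ (partial (suc n) (suc n) ⊞ ⊟ partial n n)
      ≈⟨ ⊞-cong (partial≈θ n) (partial-step n) ⟩
    θ (suc n) ∎

  term≈[]0 : ∀ n k → term n k ≈[ n ] 0ₛ
  term≈[]0 n k = ≈[]-trans (≈⇒≈[] (solve 5 (λ σ Q r y Y → con (+ 2) :* (σ :* (Q :* r :* (y :* Y)))
      := y :* (con (+ 2) :* (σ :* (Q :* r :* Y)))) ≈-refl (sgn (suc k)) (Q n) (r k) (q ^ˢ suc n) ((q ^ˢ suc n) ^ˢ k)))
    (upTo λ i i≤n → trans (q^-⊠-below (suc n) _ i (s≤s i≤n)) (sym (0ₛ-at i)))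

  partial≈[]Q : ∀ n k → partial n k ≈[ n ] Q n
  partial≈[]Q n zero    = ≈⇒≈[] ≈-refl
  partial≈[]Q n (suc k) = ≈[]-trans (⊞-cong[] (partial≈[]Q n k) (term≈[]0 n k)) (≈⇒≈[] (S.+-identityʳ (Q n)))

f₁-head : f 1 0 ≡ 1ℤ
f₁-head = refl

-- φ⁻ = φ(−q) in its product form.
φ⁻ : PS
φ⁻ = f 1 ⊠ f 1 ⊠ inv (sq (f 1))

-- Gauss's identity to order n. There f₁² is `E⁻ n ⊠ E⁻ n`, that is (E⁻ E⁺) Q: the bracket is the
-- truncated f₂, and Q agrees with Shanks's sum `partial n n`, hence with `θ n`.
φ⁻≈[]θ : ∀ n → φ⁻ ≈[ n ] θ n
φ⁻≈[]θ n = ≈[]-trans (⊠-cong[] square (≈⇒≈[] ≈-refl)) (≈⇒≈[] (begin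
    sq (f 1) ⊠ θ n ⊠ inv (sq (f 1))      ≈⟨ solve 3 (λ a b c → a :* b :* c := b :* (a :* c)) ≈-refl (sq (f 1)) (θ n) (inv (sq (f 1))) ⟩
    θ n ⊠ (sq (f 1) ⊠ inv (sq (f 1)))    ≈⟨ S.*-congˡ (⊠-inv refl) ⟩
    θ n ⊠ 1ₛ                             ≈⟨ S.*-identityʳ (θ n) ⟩
    θ n                                  ∎))
  where
  open Ring
  open Shanks
  fE : f 1 ≈[ n ] E⁻ n
  fE = f₁≈[] ℕₚ.≤-refl
  square : f 1 ⊠ f 1 ≈[ n ] sq (f 1) ⊠ θ n
  square = ≈[]-trans (⊠-cong[] fE fE) (≈[]-trans (≈⇒≈[] (begin
      E⁻ n ⊠ E⁻ n                                 ≈⟨ S.*-identityʳ (E⁻ n ⊠ E⁻ n) ⟨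
      E⁻ n ⊠ E⁻ n ⊠ 1ₛ                            ≈⟨ S.*-congˡ (⊠-inv (E⁺-head n)) ⟨
      E⁻ n ⊠ E⁻ n ⊠ (E⁺ n ⊠ inv (E⁺ n))           ≈⟨ solve 3 (λ a b c → a :* a :* (b :* c) := a :* b :* (a :* c)) ≈-refl (E⁻ n) (E⁺ n) (inv (E⁺ n)) ⟩
      E⁻ n ⊠ E⁺ n ⊠ Q n                           ≈⟨ S.*-congʳ (E⁻E⁺ n) ⟩
      sq (E⁻ n) ⊠ Q n                             ∎))
    (⊠-cong[] (≈[]-sym (sq-cong[] fE)) (≈[]-trans (≈[]-sym (partial≈[]Q n n)) (≈⇒≈[] (partial≈θ n)))))

sgn-square : ∀ s → sgn s ⊠ sgn s ≈ 1ₛ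
sgn-square zero    = S.*-identityˡ 1ₛ
sgn-square (suc s) = ≈-trans
  (solve 1 (λ a → (:- con 1ℤ) :* a :* ((:- con 1ℤ) :* a) := a :* a) ≈-refl (sgn s)) (sgn-square s)
  where open Ring

-- s² and s have the same parity, so the substitution q → -q removes all signs from the theta
-- series.
sgn-s² : ∀ s → sgn (s * s) ≈ sgn s
sgn-s² zero    = ≈-refl
sgn-s² (suc s) = begin
  sgn (suc s + s * suc s)               ≡⟨ cong (λ k → sgn (suc s + k)) (ℕₚ.*-suc s s) ⟩
  sgn (suc s + (s + s * s))             ≈⟨ ^-homo-* (⊟ 1ₛ) (suc s) (s + s * s) ⟩
  sgn (suc s) ⊠ sgn (s + s * s)         ≈⟨ S.*-congˡ (^-homo-* (⊟ 1ₛ) s (s * s)) ⟩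
  sgn (suc s) ⊠ (sgn s ⊠ sgn (s * s))   ≈⟨ S.*-congˡ (S.*-congˡ (sgn-s² s)) ⟩
  sgn (suc s) ⊠ (sgn s ⊠ sgn s)         ≈⟨ S.*-congˡ (sgn-square s) ⟩
  sgn (suc s) ⊠ 1ₛ                      ≈⟨ S.*-identityʳ (sgn (suc s)) ⟩
  sgn (suc s)                           ∎

sgn-even : ∀ n → sgn (2 * n) ≈ 1ₛ
sgn-even n = ≈-trans (S.reflexive (cong (λ k → sgn (n + k)) (ℕₚ.+-identityʳ n)))
  (≈-trans (^-homo-* (⊟ 1ₛ) n n) (sgn-square n))

alt-q^ : ∀ m → alt (q ^ˢ m) ≈ sgn m ⊠ q ^ˢ m
alt-q^ m = ≈-trans (alt-^ q m) (≈-trans (^-congˡ m (≈-trans alt-q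
  (Ring.solve 1 (λ a → Ring.:- a Ring.:= (Ring.:- Ring.con 1ℤ) Ring.:* a) ≈-refl q))) (^-distrib-* (⊟ 1ₛ) q m))

alt-θ-suc : ∀ n → alt (θ (suc n)) ≈ alt (θ n) ⊞ 2ₛ ⊠ q ^ˢ (suc n * suc n)
alt-θ-suc n = begin
  alt (θ n ⊞ 2ₛ ⊠ (σ ⊠ Y))            ≈⟨ alt-⊞ (θ n) (2ₛ ⊠ (σ ⊠ Y)) ⟩
  alt (θ n) ⊞ alt (2ₛ ⊠ (σ ⊠ Y))      ≈⟨ ⊞-cong ≈-refl (≈-trans (alt-⊠ 2ₛ (σ ⊠ Y)) (⊠-cong (alt-const (+ 2)) (alt-⊠ σ Y))) ⟩
  alt (θ n) ⊞ 2ₛ ⊠ (alt σ ⊠ alt Y)    ≈⟨ ⊞-cong ≈-refl (S.*-congˡ (⊠-cong alt-σ (≈-trans (alt-q^ (suc n * suc n)) (S.*-congʳ (sgn-s² (suc n)))))) ⟩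
  alt (θ n) ⊞ 2ₛ ⊠ (σ ⊠ (σ ⊠ Y))      ≈⟨ ⊞-cong ≈-refl (S.*-congˡ (≈-trans (≈-sym (⊠-assoc σ σ Y))
                                            (≈-trans (S.*-congʳ (sgn-square (suc n))) (S.*-identityˡ Y)))) ⟩
  alt (θ n) ⊞ 2ₛ ⊠ Y                  ∎
  where
  σ = sgn (suc n)
  Y = q ^ˢ (suc n * suc n)
  alt-σ : alt σ ≈ σ
  alt-σ = ≈-trans (alt-^ (⊟ 1ₛ) (suc n)) (^-congˡ (suc n) (≈-trans (alt-⊟ 1ₛ) (⊟-cong (alt-const 1ℤ))))

-- Odd squares cancel. An even square (2s)² = 4 s² carries a plus sign and is a square in the
-- variable q⁴; hence φ(q⁴), not φ(-q⁴), on the right, and the inner `alt`.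
θ-even-part : ∀ n → θ (2 * n) ⊞ alt (θ (2 * n)) ≈ 2ₛ ⊠ sq (sq (alt (θ n)))
θ-even-part zero = begin
  1ₛ ⊞ alt 1ₛ              ≈⟨ ⊞-cong ≈-refl (alt-const 1ℤ) ⟩
  1ₛ ⊞ 1ₛ                  ≈⟨ solve 0 (con 1ℤ :+ con 1ℤ := con (+ 2) :* con 1ℤ) ≈-refl ⟩
  2ₛ ⊠ 1ₛ                  ≈⟨ S.*-congˡ (≈-trans (sq-cong (≈-trans (sq-cong (alt-const 1ℤ)) (sq-const 1ℤ))) (sq-const 1ℤ)) ⟨
  2ₛ ⊠ sq (sq (alt 1ₛ))    ∎
  where open Ring
θ-even-part (suc n) = begin
  θ (2 * suc n) ⊞ alt (θ (2 * suc n))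
    ≡⟨ cong (λ k → θ k ⊞ alt (θ k)) (ℕₚ.*-suc 2 n) ⟩
  θ (2 + 2 * n) ⊞ alt (θ (2 + 2 * n))
    ≈⟨ ⊞-cong (⊞-cong (⊞-cong ≈-refl (S.*-congˡ (S.*-congʳ (S.*-congˡ (sgn-even n)))))
                (S.*-congˡ (S.*-congʳ (S.*-congˡ (S.*-congˡ (sgn-even n))))))
         (≈-trans (alt-θ-suc (suc (2 * n))) (⊞-cong (alt-θ-suc (2 * n)) ≈-refl)) ⟩
  (θ (2 * n) ⊞ 2ₛ ⊠ (⊟ 1ₛ ⊠ 1ₛ ⊠ Y) ⊞ 2ₛ ⊠ (⊟ 1ₛ ⊠ (⊟ 1ₛ ⊠ 1ₛ) ⊠ Z)) ⊞ (alt (θ (2 * n)) ⊞ 2ₛ ⊠ Y ⊞ 2ₛ ⊠ Z)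
    ≈⟨ solve 4 (λ a b Y Z → let m1 = :- con 1ℤ ; 1′ = con 1ℤ ; 2′ = con (+ 2) in
         (a :+ 2′ :* (m1 :* 1′ :* Y) :+ 2′ :* (m1 :* (m1 :* 1′) :* Z)) :+ (b :+ 2′ :* Y :+ 2′ :* Z)
         := (a :+ b) :+ 2′ :* (2′ :* Z)) ≈-refl (θ (2 * n)) (alt (θ (2 * n))) Y Z ⟩
  (θ (2 * n) ⊞ alt (θ (2 * n))) ⊞ 2ₛ ⊠ (2ₛ ⊠ Z)
    ≈⟨ ⊞-cong (θ-even-part n) (S.*-congˡ (≈-sym sqsq)) ⟩
  2ₛ ⊠ sq (sq (alt (θ n))) ⊞ 2ₛ ⊠ sq (sq (2ₛ ⊠ W))
    ≈⟨ solve 2 (λ a b → con (+ 2) :* a :+ con (+ 2) :* b := con (+ 2) :* (a :+ b)) ≈-refl (sq (sq (alt (θ n)))) (sq (sq (2ₛ ⊠ W))) ⟩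
  2ₛ ⊠ (sq (sq (alt (θ n))) ⊞ sq (sq (2ₛ ⊠ W)))
    ≈⟨ S.*-congˡ (≈-trans (sq-cong (sq-⊞ (alt (θ n)) (2ₛ ⊠ W))) (sq-⊞ (sq (alt (θ n))) (sq (2ₛ ⊠ W)))) ⟨
  2ₛ ⊠ sq (sq (alt (θ n) ⊞ 2ₛ ⊠ W))
    ≈⟨ S.*-congˡ (sq-cong (sq-cong (alt-θ-suc n))) ⟨
  2ₛ ⊠ sq (sq (alt (θ (suc n)))) ∎
  where
  open Ring
  Y = q ^ˢ (suc (2 * n) * suc (2 * n))
  Z = q ^ˢ (suc (suc (2 * n)) * suc (suc (2 * n)))
  W = q ^ˢ (suc n * suc n)
  exponent : 2 * (2 * (suc n * suc n)) ≡ suc (suc (2 * n)) * suc (suc (2 * n))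
  exponent = ℕ-Solver.solve 1 (λ n → let m = ℕ-Solver.con 1 ℕ-Solver.:+ n ; k = ℕ-Solver.con 2 ℕ-Solver.:+ ℕ-Solver.con 2 ℕ-Solver.:* n in
    ℕ-Solver.con 2 ℕ-Solver.:* (ℕ-Solver.con 2 ℕ-Solver.:* (m ℕ-Solver.:* m)) ℕ-Solver.:= k ℕ-Solver.:* k) refl n
  sq-2 : ∀ a → sq (2ₛ ⊠ a) ≈ 2ₛ ⊠ sq a
  sq-2 a = ≈-trans (sq-⊠ 2ₛ a) (S.*-congʳ (sq-const (+ 2)))
  sqsq : sq (sq (2ₛ ⊠ W)) ≈ 2ₛ ⊠ Z
  sqsq = begin
    sq (sq (2ₛ ⊠ W))                         ≈⟨ ≈-trans (sq-cong (sq-2 W)) (sq-2 (sq W)) ⟩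
    2ₛ ⊠ sq (sq W)                           ≈⟨ S.*-congˡ (≈-trans (sq-cong (sq-q^ (suc n * suc n))) (sq-q^ (2 * (suc n * suc n)))) ⟩
    2ₛ ⊠ q ^ˢ (2 * (2 * (suc n * suc n)))    ≡⟨ cong (λ k → 2ₛ ⊠ q ^ˢ k) exponent ⟩
    2ₛ ⊠ Z                                   ∎

φ⁺ : PS
φ⁺ = alt φ⁻

φ-even-part : φ⁻ ⊞ φ⁺ ≈ 2ₛ ⊠ sq (sq φ⁺)
φ-even-part = ≈[]⇒≈ λ n →
  let large = ≈[]-weaken (ℕₚ.m≤m+n n (n + 0)) (φ⁻≈[]θ (2 * n))
  in ≈[]-trans (⊞-cong[] large (alt-cong[] large))
     (≈[]-trans (≈⇒≈[] (θ-even-part n))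
       (⊠-cong[] (≈⇒≈[] ≈-refl) (≈[]-sym (sq-cong[] (sq-cong[] (alt-cong[] (φ⁻≈[]θ n)))))))

-- Jacobi's identity

-- Replacing q by q² doubles the order of vanishing; both descents below live on this gain.
sq-vanishes : ∀ {a} i n → i ≤ suc (2 * n) → (∀ j → j ≤ n → a j ≡ 0ℤ) → sq a i ≡ 0ℤ
sq-vanishes zero          n       _         p = p 0 z≤n
sq-vanishes (suc zero)    n       _         p = refl
sq-vanishes (suc (suc i)) zero    (s≤s ())  p
sq-vanishes (suc (suc i)) (suc n) (s≤s i≤n) p =
  sq-vanishes i n (ℕₚ.≤-pred (subst (suc i ≤_) (ℕₚ.*-suc 2 n) i≤n)) λ j j≤n → p (suc j) (s≤s j≤n)

vanishes-step : ∀ {a : PS} {n} → (∀ i → i ≤ n → a i ≡ 0ℤ) → a (suc n) ≡ 0ℤ → ∀ i → i ≤ suc n → a i ≡ 0ℤ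
vanishes-step {n = n} p r i i≤n with ℕₚ.m≤n⇒m<n∨m≡n i≤n
... | inj₁ (s≤s i<n) = p i i<n
... | inj₂ refl      = r

-- A nonzero `a` would have some order d ≥ 1, while the right-hand side has order at least 2d > d.
descent₁ : ∀ {a} c → a 0 ≡ 0ℤ → a ≈ const c ⊠ sq a → a ≈ 0ₛ
descent₁ {a} c a0 p = pointwise λ n → trans (vanish n n ℕₚ.≤-refl) (sym (0ₛ-at n))
  where
  vanish : ∀ n i → i ≤ n → a i ≡ 0ℤ
  vanish zero    zero z≤n = a0
  vanish (suc n) = vanishes-step (vanish n)
    (trans (at p (suc n)) (trans (const-⊠ c (sq a) (suc n))
      (trans (cong (c ℤ.*_) (sq-vanishes (suc n) n (s≤s (ℕₚ.m≤m+n n (n + 0))) (vanish n))) (ℤₚ.*-zeroʳ c))))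

-- If a has order d ≥ 2, then s a has order d + 1, whereas (sq a) r has order at least 2d.
descent₂ : ∀ {a s r} → a 0 ≡ 0ℤ → a 1 ≡ 0ℤ → s 0 ≡ 0ℤ → s 1 ≡ + 32 → s ⊠ a ≈ sq a ⊠ r → a ≈ 0ₛ
descent₂ {a} {s} {r} a0 a1 s0 s1 p = pointwise λ n → trans (vanish n n (ℕₚ.m≤n⇒m≤1+n ℕₚ.≤-refl)) (sym (0ₛ-at n))
  where
  product-vanishes : ∀ b c n → (∀ i → i ≤ n → b i ≡ 0ℤ) → (b ⊠ c) n ≡ 0ℤ
  product-vanishes b c n b0 = trans (⊠-local n (λ i i≤n → trans (b0 i i≤n) (sym (0ₛ-at i))) (λ _ _ → refl))
    (trans (at (0ₛ-⊠ c) n) (0ₛ-at n))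
  leading : ∀ n → (∀ i → i ≤ n → a i ≡ 0ℤ) → (s ⊠ a) (suc (suc n)) ≡ + 32 ℤ.* a (suc n)
  leading n a≡0 = E.begin
    (s ⊠ a) (suc (suc n))
      E.≡⟨ ⊠-suc s a (suc n) ⟩
    s 0 ℤ.* a (suc (suc n)) ℤ.+ (tail s ⊠ a) (suc n)
      E.≡⟨ cong₂ (λ c t → c ℤ.* a (suc (suc n)) ℤ.+ t) s0 (⊠-suc (tail s) a n) ⟩
    0ℤ ℤ.+ (s 1 ℤ.* a (suc n) ℤ.+ (tail (tail s) ⊠ a) n)
      E.≡⟨ ℤₚ.+-identityˡ _ ⟩
    s 1 ℤ.* a (suc n) ℤ.+ (tail (tail s) ⊠ a) n
      E.≡⟨ cong₂ (λ c t → c ℤ.* a (suc n) ℤ.+ t) s1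
             (trans (at (⊠-comm (tail (tail s)) a) n) (product-vanishes a (tail (tail s)) n a≡0)) ⟩
    + 32 ℤ.* a (suc n) ℤ.+ 0ℤ
      E.≡⟨ ℤₚ.+-identityʳ _ ⟩
    + 32 ℤ.* a (suc n) E.∎
    where module E = ≡-Reasoning
  vanish : ∀ n i → i ≤ suc n → a i ≡ 0ℤ
  vanish zero    zero       _         = a0
  vanish zero    (suc zero) _         = a1
  vanish zero    (suc (suc i)) (s≤s ())
  vanish (suc n) = vanishes-step (vanish n)
    -- Here `a` vanishes through n + 1. Coefficient n + 3 of `s ⊠ a` isolates 32 a(n+2), and `sq a`
    -- vanishes through 2n + 3 ≥ n + 3. One step earlier this bound fails, which is why a(1) = 0 is
    -- given separately.
    (ℤₚ.*-cancelˡ-≡ (+ 32) (a (suc (suc n))) 0ℤ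
      (trans (sym (leading (suc n) (vanish n))) (trans (at p (suc (suc (suc n))))
        (product-vanishes (sq a) r (suc (suc (suc n))) λ i i≤n+3 →
          sq-vanishes i (suc n) (ℕₚ.≤-trans i≤n+3 n+3≤2n+3) (vanish n)))))
    where
    n+3≤2n+3 : suc (suc (suc n)) ≤ suc (2 * suc n)
    n+3≤2n+3 = s≤s (subst (suc (suc n) ≤_) (sym (ℕₚ.*-suc 2 n)) (s≤s (s≤s (ℕₚ.m≤m+n n (n + 0)))))

sq-unit : ∀ {a b} → a ⊠ b ≈ 1ₛ → sq a ⊠ sq b ≈ 1ₛ
sq-unit {a} {b} p = ≈-trans (≈-sym (sq-⊠ a b)) (≈-trans (sq-cong p) (sq-const 1ℤ))

alt-unit : ∀ {a b} → a ⊠ b ≈ 1ₛ → alt a ⊠ alt b ≈ 1ₛ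
alt-unit {a} {b} p = ≈-trans (≈-sym (alt-⊠ a b)) (≈-trans (alt-cong p) (alt-const 1ℤ))

f₂ f₄ f₈ : PS
f₂ = sq (f 1)
f₄ = sq f₂
f₈ = sq f₄

I₂ : PS
I₂ = inv f₂

f₂-I₂ : f₂ ⊠ I₂ ≈ 1ₛ
f₂-I₂ = ⊠-inv refl

f₄-I₄ : f₄ ⊠ sq I₂ ≈ 1ₛ
f₄-I₄ = sq-unit f₂-I₂

φ⁺≈ : φ⁺ ≈ alt (f 1) ⊠ alt (f 1) ⊠ I₂
φ⁺≈ = begin
  alt (f 1 ⊠ f 1 ⊠ I₂)               ≈⟨ ≈-trans (alt-⊠ (f 1 ⊠ f 1) I₂) (S.*-congʳ (alt-⊠ (f 1) (f 1))) ⟩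
  alt (f 1) ⊠ alt (f 1) ⊠ alt I₂     ≈⟨ S.*-congˡ alt-I₂ ⟩
  alt (f 1) ⊠ alt (f 1) ⊠ I₂         ∎
  where
  alt-I₂ : alt I₂ ≈ I₂
  alt-I₂ = inverse-unique (≈-trans (S.*-congʳ (≈-sym (alt-sq (f 1)))) (alt-unit f₂-I₂)) f₂-I₂

-- Both sides are the square of f₂²/f₄: φ(-q²) is this quotient by its product form, and f₁(q)
-- f₁(-q)/f₂ is by `alt-f₁`.
φ⁺φ⁻ : φ⁺ ⊠ φ⁻ ≈ sq φ⁻ ⊠ sq φ⁻
φ⁺φ⁻ = begin
    φ⁺ ⊠ φ⁻                                ≈⟨ S.*-congʳ φ⁺≈ ⟩
    g⁻ ⊠ g⁻ ⊠ I₂ ⊠ (g ⊠ g ⊠ I₂)              ≈⟨ solve 3 (λ x y i → y :* y :* i :* (x :* x :* i) := x :* y :* i :* (x :* y :* i)) ≈-refl g g⁻ I₂ ⟩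
    g ⊠ g⁻ ⊠ I₂ ⊠ (g ⊠ g⁻ ⊠ I₂)              ≈⟨ ⊠-cong xyI xyI ⟩
    f₂ ⊠ f₂ ⊠ J ⊠ (f₂ ⊠ f₂ ⊠ J)            ≈⟨ ⊠-cong sqφ sqφ ⟨
    sq φ⁻ ⊠ sq φ⁻                          ∎
  where
  open Ring
  g = f 1
  g⁻ = alt (f 1)
  J = sq I₂
  sqφ : sq φ⁻ ≈ f₂ ⊠ f₂ ⊠ J
  sqφ = ≈-trans (sq-⊠ (g ⊠ g) I₂) (S.*-congʳ (sq-⊠ g g))
  xyI : g ⊠ g⁻ ⊠ I₂ ≈ f₂ ⊠ f₂ ⊠ J
  xyI = begin
    g ⊠ g⁻ ⊠ I₂                       ≈⟨ S.*-identityʳ (g ⊠ g⁻ ⊠ I₂) ⟨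
    g ⊠ g⁻ ⊠ I₂ ⊠ 1ₛ                  ≈⟨ S.*-congˡ f₄-I₄ ⟨
    g ⊠ g⁻ ⊠ I₂ ⊠ (f₄ ⊠ J)            ≈⟨ solve 5 (λ x y i v j → x :* y :* i :* (v :* j) := x :* y :* v :* (i :* j)) ≈-refl g g⁻ I₂ f₄ J ⟩
    g ⊠ g⁻ ⊠ f₄ ⊠ (I₂ ⊠ J)            ≈⟨ S.*-congʳ alt-f₁ ⟩
    f₂ ⊠ f₂ ⊠ f₂ ⊠ (I₂ ⊠ J)          ≈⟨ solve 3 (λ u i j → u :* u :* u :* (i :* j) := u :* u :* j :* (u :* i)) ≈-refl f₂ I₂ J ⟩
    f₂ ⊠ f₂ ⊠ J ⊠ (f₂ ⊠ I₂)          ≈⟨ S.*-congˡ f₂-I₂ ⟩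
    f₂ ⊠ f₂ ⊠ J ⊠ 1ₛ                 ≈⟨ S.*-identityʳ (f₂ ⊠ f₂ ⊠ J) ⟩
    f₂ ⊠ f₂ ⊠ J                      ∎

-- By φ-even-part and φ⁺φ⁻, the difference δ of the two sides satisfies δ(q) = −2 δ(q²).
φ²-sum : φ⁺ ⊠ φ⁺ ⊞ φ⁻ ⊠ φ⁻ ≈ 2ₛ ⊠ (sq φ⁺ ⊠ sq φ⁺)
φ²-sum = begin
    A ⊞ B                      ≈⟨ solve 3 (λ a b c → a :+ b := (a :+ b :+ :- c) :+ c) ≈-refl A B (2ₛ ⊠ (sq φ⁺ ⊠ sq φ⁺)) ⟩
    δ ⊞ 2ₛ ⊠ (sq φ⁺ ⊠ sq φ⁺)   ≈⟨ ⊞-cong (descent₁ (ℤ.- (+ 2)) δ-head δ-step) ≈-refl ⟩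
    0ₛ ⊞ 2ₛ ⊠ (sq φ⁺ ⊠ sq φ⁺)  ≈⟨ S.+-identityˡ _ ⟩
    2ₛ ⊠ (sq φ⁺ ⊠ sq φ⁺)       ∎
  where
  open Ring
  A = φ⁺ ⊠ φ⁺
  B = φ⁻ ⊠ φ⁻
  P₁ = sq φ⁺
  N₁ = sq φ⁻
  P₂ = sq P₁
  δ = A ⊞ B ⊞ ⊟ (2ₛ ⊠ (P₁ ⊠ P₁))
  opaque
    unfolding _⊞_
    δ-head : δ 0 ≡ 0ℤ
    δ-head = refl
  sqδ : sq δ ≈ P₁ ⊠ P₁ ⊞ N₁ ⊠ N₁ ⊞ ⊟ (2ₛ ⊠ (P₂ ⊠ P₂))
  sqδ = ≈-trans (sq-⊞ (A ⊞ B) (⊟ (2ₛ ⊠ (P₁ ⊠ P₁))))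
    (⊞-cong (≈-trans (sq-⊞ A B) (⊞-cong (sq-⊠ φ⁺ φ⁺) (sq-⊠ φ⁻ φ⁻)))
      (≈-trans (sq-⊟ (2ₛ ⊠ (P₁ ⊠ P₁))) (⊟-cong (≈-trans (sq-⊠ 2ₛ (P₁ ⊠ P₁)) (⊠-cong (sq-const (+ 2)) (sq-⊠ P₁ P₁))))))
  δ-step : δ ≈ const (ℤ.- (+ 2)) ⊠ sq δ
  δ-step = begin
    φ⁺ ⊠ φ⁺ ⊞ φ⁻ ⊠ φ⁻ ⊞ ⊟ (2ₛ ⊠ (P₁ ⊠ P₁))
      -- The sum and the product of φ(q) and φ(-q) enter through p² + n² = (n + p)² - 2 p n.
      ≈⟨ solve 3 (λ p n c → p :* p :+ n :* n :+ :- (con (+ 2) :* (c :* c))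
           := (n :+ p) :* (n :+ p) :+ :- (con (+ 2) :* (p :* n)) :+ :- (con (+ 2) :* (c :* c))) ≈-refl φ⁺ φ⁻ P₁ ⟩
    (φ⁻ ⊞ φ⁺) ⊠ (φ⁻ ⊞ φ⁺) ⊞ ⊟ (2ₛ ⊠ (φ⁺ ⊠ φ⁻)) ⊞ ⊟ (2ₛ ⊠ (P₁ ⊠ P₁))
      ≈⟨ ⊞-cong (⊞-cong (⊠-cong φ-even-part φ-even-part) (⊟-cong (S.*-congˡ φ⁺φ⁻))) ≈-refl ⟩
    2ₛ ⊠ P₂ ⊠ (2ₛ ⊠ P₂) ⊞ ⊟ (2ₛ ⊠ (N₁ ⊠ N₁)) ⊞ ⊟ (2ₛ ⊠ (P₁ ⊠ P₁))
      ≈⟨ solve 3 (λ a b c → con (+ 2) :* a :* (con (+ 2) :* a) :+ :- (con (+ 2) :* (b :* b)) :+ :- (con (+ 2) :* (c :* c))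
           := con (ℤ.- (+ 2)) :* (c :* c :+ b :* b :+ :- (con (+ 2) :* (a :* a)))) ≈-refl P₂ N₁ P₁ ⟩
    const (ℤ.- (+ 2)) ⊠ (P₁ ⊠ P₁ ⊞ N₁ ⊠ N₁ ⊞ ⊟ (2ₛ ⊠ (P₂ ⊠ P₂)))
      ≈⟨ S.*-congˡ sqδ ⟨
    const (ℤ.- (+ 2)) ⊠ sq δ ∎

-- With H and G the two sides, δ = H - G and s = H + G multiply to H² - G². The product forms give H
-- = f₂⁴ (φ(q)⁴ - φ(-q)⁴), and the theta relations make H² a multiple of `C ⊞ ⊟ K`, which is
-- H(q²)/f₄⁴. As G² is G(q²) times the same cofactor, s δ is a multiple of δ(q²), as `descent₂`
-- requires.
jacobi : alt (f 1) ^ˢ 8 ⊞ ⊟ f 1 ^ˢ 8 ≈ const (+ 16) ⊠ (q ⊠ f₄ ^ˢ 8)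
jacobi = begin
    y8 ⊞ ⊟ x8                      ≈⟨ solve 2 (λ a b → a := (a :+ :- b) :+ b) ≈-refl (y8 ⊞ ⊟ x8) G ⟩
    δ ⊞ G                          ≈⟨ ⊞-cong (descent₂ δ0 δ1 s0 s1 key) ≈-refl ⟩
    0ₛ ⊞ G                         ≈⟨ S.+-identityˡ G ⟩
    G                              ∎
  where
  open Ring
  x8 = f 1 ^ˢ 8
  y8 = alt (f 1) ^ˢ 8
  u4 = f₂ ^ˢ 4
  u8 = f₂ ^ˢ 8
  v4 = f₄ ^ˢ 4
  j4 = sq I₂ ^ˢ 4
  w8 = f₈ ^ˢ 8
  p8 = sq (alt (f 1)) ^ˢ 8
  C = sq φ⁺ ^ˢ 4
  K = sq φ⁻ ^ˢ 4
  G = const (+ 16) ⊠ (q ⊠ f₄ ^ˢ 8)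
  G′ = const (+ 16) ⊠ (q ⊠ (v4 ⊠ v4))
  δ = y8 ⊞ ⊟ x8 ⊞ ⊟ G
  s = y8 ⊞ ⊟ x8 ⊞ G

  -- The first coefficients are evaluated outright: `y8 ⊞ ⊟ x8` and `G` both begin with 16 q, so δ
  -- has no term below q² and s = 32 q + ... .
  opaque
    unfolding _⊞_
    δ0 : δ 0 ≡ 0ℤ
    δ0 = refl
    δ1 : δ 1 ≡ 0ℤ
    δ1 = refl
    s0 : s 0 ≡ 0ℤ
    s0 = refl
    s1 : s 1 ≡ + 32
    s1 = refl

  GG′ : G ≈ G′
  GG′ = S.*-congˡ (S.*-congˡ (^-homo-* f₄ 4 4))

  eighth : ∀ a → (a ⊠ a ⊠ I₂) ^ˢ 4 ⊠ u4 ≈ a ^ˢ 8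
  eighth a = begin
    (a ⊠ a ⊠ I₂) ^ˢ 4 ⊠ u4       ≈⟨ solve 3 (λ a i u → (a :* a :* i) :^ 4 :* u :^ 4 := a :^ 8 :* (u :* i) :^ 4) ≈-refl a I₂ f₂ ⟩
    a ^ˢ 8 ⊠ (f₂ ⊠ I₂) ^ˢ 4      ≈⟨ S.*-congˡ (^-congˡ 4 f₂-I₂) ⟩
    a ^ˢ 8 ⊠ 1ₛ ^ˢ 4             ≈⟨ solve 1 (λ a → a :* (con 1ℤ :^ 4) := a) ≈-refl (a ^ˢ 8) ⟩
    a ^ˢ 8                       ∎

  φ⁻-eighth : φ⁻ ^ˢ 4 ⊠ u4 ≈ x8
  φ⁻-eighth = eighth (f 1)

  φ⁺-eighth : φ⁺ ^ˢ 4 ⊠ u4 ≈ y8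
  φ⁺-eighth = ≈-trans (S.*-congʳ (^-congˡ 4 φ⁺≈)) (eighth (alt (f 1)))

  sq-eighth : ∀ {a b} → a ^ˢ 4 ⊠ u4 ≈ b ^ˢ 8 → sq a ^ˢ 4 ⊠ v4 ≈ sq b ^ˢ 8
  sq-eighth {a} {b} p = begin
    sq a ^ˢ 4 ⊠ v4               ≈⟨ ⊠-cong (sq-^ a 4) (sq-^ f₂ 4) ⟨
    sq (a ^ˢ 4) ⊠ sq u4          ≈⟨ sq-⊠ (a ^ˢ 4) u4 ⟨
    sq (a ^ˢ 4 ⊠ u4)             ≈⟨ sq-cong p ⟩
    sq (b ^ˢ 8)                  ≈⟨ sq-^ b 8 ⟩
    sq b ^ˢ 8                    ∎

  v4j4 : v4 ⊠ j4 ≈ 1ₛ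
  v4j4 = unit-^ 4 f₄-I₄

  upw : u8 ⊠ p8 ⊠ w8 ≈ v4 ⊠ v4 ⊠ v4 ⊠ v4 ⊠ v4 ⊠ v4
  upw = begin
    u8 ⊠ p8 ⊠ w8                           ≈⟨ S.*-congʳ (^-distrib-* f₂ (sq (alt (f 1))) 8) ⟨
    (f₂ ⊠ sq (alt (f 1))) ^ˢ 8 ⊠ w8        ≈⟨ ^-distrib-* (f₂ ⊠ sq (alt (f 1))) f₈ 8 ⟨
    (f₂ ⊠ sq (alt (f 1)) ⊠ f₈) ^ˢ 8        ≈⟨ ^-congˡ 8 sq-alt-f₁ ⟩
    (f₄ ⊠ f₄ ⊠ f₄) ^ˢ 8                    ≈⟨ solve 1 (λ v → let v4 = v :^ 4 in (v :* v :* v) :^ 8 := v4 :* v4 :* v4 :* v4 :* v4 :* v4) ≈-refl f₄ ⟩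
    v4 ⊠ v4 ⊠ v4 ⊠ v4 ⊠ v4 ⊠ v4            ∎
    where
    sq-alt-f₁ : f₂ ⊠ sq (alt (f 1)) ⊠ f₈ ≈ f₄ ⊠ f₄ ⊠ f₄
    sq-alt-f₁ = begin
      f₂ ⊠ sq (alt (f 1)) ⊠ f₈             ≈⟨ ≈-trans (sq-⊠ (f 1 ⊠ alt (f 1)) f₄) (S.*-congʳ (sq-⊠ (f 1) (alt (f 1)))) ⟨
      sq (f 1 ⊠ alt (f 1) ⊠ f₄)            ≈⟨ sq-cong alt-f₁ ⟩
      sq (f₂ ⊠ f₂ ⊠ f₂)                    ≈⟨ ≈-trans (sq-⊠ (f₂ ⊠ f₂) f₂) (S.*-congʳ (sq-⊠ f₂ f₂)) ⟩
      f₄ ⊠ f₄ ⊠ f₄                         ∎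

  -- The eighth power of `alt-f₁` at q², rearranged: it writes the f₄^16 of G² as the cofactor
  -- `u8 ⊠ C ⊠ j4` times f₈⁸, the power that occurs in G(q²).
  uCjw : u8 ⊠ C ⊠ j4 ⊠ w8 ≈ v4 ⊠ v4 ⊠ v4 ⊠ v4
  uCjw = begin
    u8 ⊠ C ⊠ j4 ⊠ w8                       ≈⟨ S.*-identityʳ _ ⟨
    u8 ⊠ C ⊠ j4 ⊠ w8 ⊠ 1ₛ                  ≈⟨ S.*-congˡ v4j4 ⟨
    u8 ⊠ C ⊠ j4 ⊠ w8 ⊠ (v4 ⊠ j4)           ≈⟨ solve 5 (λ u c j w v → u :* c :* j :* w :* (v :* j) := u :* (c :* v) :* w :* (j :* j)) ≈-refl u8 C j4 w8 v4 ⟩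
    u8 ⊠ (C ⊠ v4) ⊠ w8 ⊠ (j4 ⊠ j4)         ≈⟨ S.*-congʳ (S.*-congʳ (S.*-congˡ (sq-eighth {φ⁺} {alt (f 1)} φ⁺-eighth))) ⟩
    u8 ⊠ p8 ⊠ w8 ⊠ (j4 ⊠ j4)               ≈⟨ S.*-congʳ upw ⟩
    v4 ⊠ v4 ⊠ v4 ⊠ v4 ⊠ v4 ⊠ v4 ⊠ (j4 ⊠ j4)
      ≈⟨ solve 2 (λ v j → v :* v :* v :* v :* v :* v :* (j :* j) := v :* v :* v :* v :* (v :* j :* (v :* j))) ≈-refl v4 j4 ⟩
    v4 ⊠ v4 ⊠ v4 ⊠ v4 ⊠ (v4 ⊠ j4 ⊠ (v4 ⊠ j4)) ≈⟨ S.*-congˡ (⊠-cong v4j4 v4j4) ⟩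
    v4 ⊠ v4 ⊠ v4 ⊠ v4 ⊠ (1ₛ ⊠ 1ₛ)          ≈⟨ solve 1 (λ a → a :* (con 1ℤ :* con 1ℤ) := a) ≈-refl (v4 ⊠ v4 ⊠ v4 ⊠ v4) ⟩
    v4 ⊠ v4 ⊠ v4 ⊠ v4                      ∎

  square : (y8 ⊞ ⊟ x8) ⊠ (y8 ⊞ ⊟ x8) ≈ const (+ 16) ⊠ (u8 ⊠ (C ⊠ (C ⊞ ⊟ K)))
  square = begin
    (y8 ⊞ ⊟ x8) ⊠ (y8 ⊞ ⊟ x8)
      ≈⟨ ⊠-cong difference difference ⟩
    (φ⁺ ^ˢ 4 ⊠ u4 ⊞ ⊟ (φ⁻ ^ˢ 4 ⊠ u4)) ⊠ (φ⁺ ^ˢ 4 ⊠ u4 ⊞ ⊟ (φ⁻ ^ˢ 4 ⊠ u4))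
      -- (p⁴ - n⁴)² is a polynomial in p² + n² and p n, precisely the two expressions known in terms
      -- of series in q².
      ≈⟨ solve 3 (λ p n u → (p :^ 4 :* u :+ :- (n :^ 4 :* u)) :* (p :^ 4 :* u :+ :- (n :^ 4 :* u))
           := u :* u :* ((p :* p :+ n :* n) :* (p :* p :+ n :* n)
                :* ((p :* p :+ n :* n) :* (p :* p :+ n :* n) :+ :- (con (+ 4) :* (p :* n :* (p :* n)))))) ≈-refl φ⁺ φ⁻ u4 ⟩
    u4 ⊠ u4 ⊠ (Σφ ⊠ Σφ ⊠ (Σφ ⊠ Σφ ⊞ ⊟ (const (+ 4) ⊠ (φ⁺ ⊠ φ⁻ ⊠ (φ⁺ ⊠ φ⁻)))))
      ≈⟨ ⊠-cong (≈-sym (^-homo-* f₂ 4 4)) (⊠-cong (⊠-cong φ²-sum φ²-sum)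
           (⊞-cong (⊠-cong φ²-sum φ²-sum) (⊟-cong (S.*-congˡ (⊠-cong φ⁺φ⁻ φ⁺φ⁻))))) ⟩
    u8 ⊠ (2cc ⊠ 2cc ⊠ (2cc ⊠ 2cc ⊞ ⊟ (const (+ 4) ⊠ (dd ⊠ dd))))
      ≈⟨ solve 3 (λ u c d → let 2cc = con (+ 2) :* (c :* c) in
           u :* (2cc :* 2cc :* (2cc :* 2cc :+ :- (con (+ 4) :* (d :* d :* (d :* d)))))
           := con (+ 16) :* (u :* (c :^ 4 :* (c :^ 4 :+ :- (d :^ 4))))) ≈-refl u8 (sq φ⁺) (sq φ⁻) ⟩
    const (+ 16) ⊠ (u8 ⊠ (C ⊠ (C ⊞ ⊟ K))) ∎
    where
    Σφ = φ⁺ ⊠ φ⁺ ⊞ φ⁻ ⊠ φ⁻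
    2cc = 2ₛ ⊠ (sq φ⁺ ⊠ sq φ⁺)
    dd = sq φ⁻ ⊠ sq φ⁻
    difference : y8 ⊞ ⊟ x8 ≈ φ⁺ ^ˢ 4 ⊠ u4 ⊞ ⊟ (φ⁻ ^ˢ 4 ⊠ u4)
    difference = ⊞-cong (≈-sym φ⁺-eighth) (⊟-cong (≈-sym φ⁻-eighth))

  sqδ : sq δ ≈ C ⊠ v4 ⊞ ⊟ (K ⊠ v4) ⊞ ⊟ (const (+ 16) ⊠ (q ⊠ q ⊠ w8))
  sqδ = begin
    sq (y8 ⊞ ⊟ x8 ⊞ ⊟ G)
      ≈⟨ ≈-trans (sq-⊞ (y8 ⊞ ⊟ x8) (⊟ G)) (⊞-cong (≈-trans (sq-⊞ y8 (⊟ x8)) (⊞-cong ≈-refl (sq-⊟ x8))) (sq-⊟ G)) ⟩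
    sq y8 ⊞ ⊟ sq x8 ⊞ ⊟ sq G
      ≈⟨ ⊞-cong (⊞-cong (≈-trans (sq-^ (alt (f 1)) 8) (≈-sym (sq-eighth {φ⁺} {alt (f 1)} φ⁺-eighth)))
                   (⊟-cong (≈-trans (sq-^ (f 1) 8) (≈-sym (sq-eighth {φ⁻} {f 1} φ⁻-eighth)))))
           (⊟-cong (≈-trans (sq-⊠ (const (+ 16)) (q ⊠ f₄ ^ˢ 8)) (⊠-cong (sq-const (+ 16))
              (≈-trans (sq-⊠ q (f₄ ^ˢ 8)) (⊠-cong (≈-trans sq-q (S.*-congˡ (S.*-identityʳ q))) (sq-^ f₄ 8)))))) ⟩
    C ⊠ v4 ⊞ ⊟ (K ⊠ v4) ⊞ ⊟ (const (+ 16) ⊠ (q ⊠ q ⊠ w8)) ∎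

  key : s ⊠ δ ≈ sq δ ⊠ (const (+ 16) ⊠ (u8 ⊠ C ⊠ j4))
  key = begin
    (H ⊞ G) ⊠ (H ⊞ ⊟ G)
      ≈⟨ solve 2 (λ h g → (h :+ g) :* (h :+ :- g) := h :* h :+ :- (g :* g)) ≈-refl H G ⟩
    H ⊠ H ⊞ ⊟ (G ⊠ G)
      ≈⟨ ⊞-cong square (⊟-cong (⊠-cong GG′ GG′)) ⟩
    const (+ 16) ⊠ (u8 ⊠ (C ⊠ (C ⊞ ⊟ K))) ⊞ ⊟ (G′ ⊠ G′)
      ≈⟨ solve 5 (λ u c k v q → con (+ 16) :* (u :* (c :* (c :+ :- k))) :+ :- (con (+ 16) :* (q :* (v :* v)) :* (con (+ 16) :* (q :* (v :* v))))
           := con (+ 16) :* (u :* (c :* (c :+ :- k))) :* con 1ℤ :+ :- (con (+ 256) :* (q :* q) :* (v :* v :* v :* v))) ≈-refl u8 C K v4 q ⟩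
    const (+ 16) ⊠ (u8 ⊠ (C ⊠ (C ⊞ ⊟ K))) ⊠ 1ₛ ⊞ ⊟ (const (+ 256) ⊠ (q ⊠ q) ⊠ (v4 ⊠ v4 ⊠ v4 ⊠ v4))
      ≈⟨ ⊞-cong (S.*-congˡ v4j4) (⊟-cong (S.*-congˡ uCjw)) ⟨
    const (+ 16) ⊠ (u8 ⊠ (C ⊠ (C ⊞ ⊟ K))) ⊠ (v4 ⊠ j4) ⊞ ⊟ (const (+ 256) ⊠ (q ⊠ q) ⊠ (u8 ⊠ C ⊠ j4 ⊠ w8))
      ≈⟨ solve 7 (λ u c k v j w q → con (+ 16) :* (u :* (c :* (c :+ :- k))) :* (v :* j) :+ :- (con (+ 256) :* (q :* q) :* (u :* c :* j :* w))
           := (c :* v :+ :- (k :* v) :+ :- (con (+ 16) :* (q :* q :* w))) :* (con (+ 16) :* (u :* c :* j))) ≈-refl u8 C K v4 j4 w8 q ⟩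
    (C ⊠ v4 ⊞ ⊟ (K ⊠ v4) ⊞ ⊟ (const (+ 16) ⊠ (q ⊠ q ⊠ w8))) ⊠ (const (+ 16) ⊠ (u8 ⊠ C ⊠ j4))
      ≈⟨ S.*-congʳ sqδ ⟨
    sq δ ⊠ (const (+ 16) ⊠ (u8 ⊠ C ⊠ j4)) ∎
    where H = y8 ⊞ ⊟ x8

-- The modular equation

I₁ : PS
I₁ = inv (f 1)

T w : PS
T = q ⊠ f₂ ^ˢ 24 ⊠ I₁ ^ˢ 24
w = q ⊠ f₄ ^ˢ 8 ⊠ I₁ ^ˢ 8

module Modular where
  open Ring

  -- i8, a8 and k8 are the inverses of x8, y8 and u8.
  x8 = f 1 ^ˢ 8
  y8 = alt (f 1) ^ˢ 8
  u8 = f₂ ^ˢ 8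
  v8 = f₄ ^ˢ 8
  i8 = I₁ ^ˢ 8
  a8 = alt I₁ ^ˢ 8
  k8 = sq I₁ ^ˢ 8

  x8i8 : x8 ⊠ i8 ≈ 1ₛ
  x8i8 = unit-^ 8 (⊠-inv f₁-head)

  y8a8 : y8 ⊠ a8 ≈ 1ₛ
  y8a8 = unit-^ 8 (alt-unit (⊠-inv f₁-head))

  u8k8 : u8 ⊠ k8 ≈ 1ₛ
  u8k8 = unit-^ 8 (sq-unit (⊠-inv f₁-head))

  x8y8v8 : x8 ⊠ y8 ⊠ v8 ≈ u8 ⊠ u8 ⊠ u8
  x8y8v8 = begin
    x8 ⊠ y8 ⊠ v8                        ≈⟨ S.*-congʳ (^-distrib-* (f 1) (alt (f 1)) 8) ⟨
    (f 1 ⊠ alt (f 1)) ^ˢ 8 ⊠ v8         ≈⟨ ^-distrib-* (f 1 ⊠ alt (f 1)) f₄ 8 ⟨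
    (f 1 ⊠ alt (f 1) ⊠ f₄) ^ˢ 8         ≈⟨ ^-congˡ 8 alt-f₁ ⟩
    (f₂ ⊠ f₂ ⊠ f₂) ^ˢ 8                 ≈⟨ ≈-trans (^-distrib-* (f₂ ⊠ f₂) f₂ 8) (S.*-congʳ (^-distrib-* f₂ f₂ 8)) ⟩
    u8 ⊠ u8 ⊠ u8                        ∎

  -- `x8y8v8` solved for 1/(x8 y8), using only the known inverses.
  i8a8 : i8 ⊠ a8 ≈ v8 ⊠ (k8 ⊠ k8 ⊠ k8)
  i8a8 = begin
    i8 ⊠ a8
      ≈⟨ solve 2 (λ i a → i :* a := i :* a :* (con 1ℤ :* con 1ℤ :* con 1ℤ)) ≈-refl i8 a8 ⟩
    i8 ⊠ a8 ⊠ (1ₛ ⊠ 1ₛ ⊠ 1ₛ)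
      ≈⟨ S.*-congˡ (⊠-cong (⊠-cong u8k8 u8k8) u8k8) ⟨
    i8 ⊠ a8 ⊠ (u8 ⊠ k8 ⊠ (u8 ⊠ k8) ⊠ (u8 ⊠ k8))
      ≈⟨ solve 4 (λ i a u k → i :* a :* (u :* k :* (u :* k) :* (u :* k)) := u :* u :* u :* (i :* a :* (k :* k :* k))) ≈-refl i8 a8 u8 k8 ⟩
    u8 ⊠ u8 ⊠ u8 ⊠ (i8 ⊠ a8 ⊠ (k8 ⊠ k8 ⊠ k8))
      ≈⟨ S.*-congʳ x8y8v8 ⟨
    x8 ⊠ y8 ⊠ v8 ⊠ (i8 ⊠ a8 ⊠ (k8 ⊠ k8 ⊠ k8))
      ≈⟨ solve 6 (λ x y v i a k → x :* y :* v :* (i :* a :* k) := x :* i :* (y :* a) :* (v :* k)) ≈-refl x8 y8 v8 i8 a8 (k8 ⊠ k8 ⊠ k8) ⟩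
    x8 ⊠ i8 ⊠ (y8 ⊠ a8) ⊠ (v8 ⊠ (k8 ⊠ k8 ⊠ k8))
      ≈⟨ S.*-congʳ (⊠-cong x8i8 y8a8) ⟩
    1ₛ ⊠ 1ₛ ⊠ (v8 ⊠ (k8 ⊠ k8 ⊠ k8))
      ≈⟨ solve 1 (λ a → con 1ℤ :* con 1ℤ :* a := a) ≈-refl (v8 ⊠ (k8 ⊠ k8 ⊠ k8)) ⟩
    v8 ⊠ (k8 ⊠ k8 ⊠ k8) ∎

  -- Jacobi's identity over the common denominator: 1/x - 1/y = (y - x)/(x y).
  i8-a8 : i8 ⊞ ⊟ a8 ≈ v8 ⊠ (k8 ⊠ k8 ⊠ k8) ⊠ (const (+ 16) ⊠ (q ⊠ v8))
  i8-a8 = begin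
    i8 ⊞ ⊟ a8
      ≈⟨ solve 2 (λ i a → i :+ :- a := con 1ℤ :* i :+ :- (con 1ℤ :* a)) ≈-refl i8 a8 ⟩
    1ₛ ⊠ i8 ⊞ ⊟ (1ₛ ⊠ a8)
      ≈⟨ ⊞-cong (S.*-congʳ y8a8) (⊟-cong (S.*-congʳ x8i8)) ⟨
    y8 ⊠ a8 ⊠ i8 ⊞ ⊟ (x8 ⊠ i8 ⊠ a8)
      ≈⟨ solve 4 (λ x y i a → y :* a :* i :+ :- (x :* i :* a) := i :* a :* (y :+ :- x)) ≈-refl x8 y8 i8 a8 ⟩
    i8 ⊠ a8 ⊠ (y8 ⊞ ⊟ x8)
      ≈⟨ ⊠-cong i8a8 jacobi ⟩
    v8 ⊠ (k8 ⊠ k8 ⊠ k8) ⊠ (const (+ 16) ⊠ (q ⊠ v8)) ∎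

  ^24 : ∀ a → a ^ˢ 24 ≈ a ^ˢ 8 ⊠ a ^ˢ 8 ⊠ a ^ˢ 8
  ^24 a = ≈-trans (^-homo-* a 16 8) (S.*-congʳ (^-homo-* a 8 8))

  sqT : sq T ≈ q ⊠ q ⊠ (v8 ⊠ v8 ⊠ v8) ⊠ (k8 ⊠ k8 ⊠ k8)
  sqT = begin
    sq (q ⊠ f₂ ^ˢ 24 ⊠ I₁ ^ˢ 24)
      ≈⟨ ≈-trans (sq-⊠ (q ⊠ f₂ ^ˢ 24) (I₁ ^ˢ 24)) (S.*-congʳ (sq-⊠ q (f₂ ^ˢ 24))) ⟩
    sq q ⊠ sq (f₂ ^ˢ 24) ⊠ sq (I₁ ^ˢ 24)
      ≈⟨ ⊠-cong (⊠-cong (≈-trans sq-q (S.*-congˡ (S.*-identityʳ q))) (≈-trans (sq-^ f₂ 24) (^24 f₄)))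
           (≈-trans (sq-^ I₁ 24) (^24 (sq I₁))) ⟩
    q ⊠ q ⊠ (v8 ⊠ v8 ⊠ v8) ⊠ (k8 ⊠ k8 ⊠ k8) ∎

  alt-w : alt w ≈ ⊟ q ⊠ v8 ⊠ a8
  alt-w = begin
    alt (q ⊠ v8 ⊠ i8)
      ≈⟨ ≈-trans (alt-⊠ (q ⊠ v8) i8) (⊠-cong (alt-⊠ q v8) (alt-^ I₁ 8)) ⟩
    alt q ⊠ alt v8 ⊠ a8
      ≈⟨ S.*-congʳ (⊠-cong alt-q (≈-trans (alt-^ f₄ 8) (^-congˡ 8 (alt-sq f₂)))) ⟩
    ⊟ q ⊠ v8 ⊠ a8 ∎

  w-trace : w ⊞ alt w ≈ const (+ 16) ⊠ sq T
  w-trace = begin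
    q ⊠ v8 ⊠ i8 ⊞ alt w
      ≈⟨ ⊞-cong ≈-refl alt-w ⟩
    q ⊠ v8 ⊠ i8 ⊞ ⊟ q ⊠ v8 ⊠ a8
      ≈⟨ solve 4 (λ q v i a → q :* v :* i :+ (:- q) :* v :* a := q :* v :* (i :+ :- a)) ≈-refl q v8 i8 a8 ⟩
    q ⊠ v8 ⊠ (i8 ⊞ ⊟ a8)
      ≈⟨ S.*-congˡ i8-a8 ⟩
    q ⊠ v8 ⊠ (v8 ⊠ (k8 ⊠ k8 ⊠ k8) ⊠ (const (+ 16) ⊠ (q ⊠ v8)))
      ≈⟨ solve 3 (λ q v k → q :* v :* (v :* k :* (con (+ 16) :* (q :* v))) := con (+ 16) :* (q :* q :* (v :* v :* v) :* k)) ≈-refl q v8 (k8 ⊠ k8 ⊠ k8) ⟩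
    const (+ 16) ⊠ (q ⊠ q ⊠ (v8 ⊠ v8 ⊠ v8) ⊠ (k8 ⊠ k8 ⊠ k8))
      ≈⟨ S.*-congˡ sqT ⟨
    const (+ 16) ⊠ sq T ∎

  w-norm : w ⊠ alt w ≈ ⊟ sq T
  w-norm = begin
    q ⊠ v8 ⊠ i8 ⊠ alt w
      ≈⟨ S.*-congˡ alt-w ⟩
    q ⊠ v8 ⊠ i8 ⊠ (⊟ q ⊠ v8 ⊠ a8)
      ≈⟨ solve 4 (λ q v i a → q :* v :* i :* ((:- q) :* v :* a) := :- (q :* q :* (v :* v) :* (i :* a))) ≈-refl q v8 i8 a8 ⟩
    ⊟ (q ⊠ q ⊠ (v8 ⊠ v8) ⊠ (i8 ⊠ a8))
      ≈⟨ ⊟-cong (S.*-congˡ i8a8) ⟩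
    ⊟ (q ⊠ q ⊠ (v8 ⊠ v8) ⊠ (v8 ⊠ (k8 ⊠ k8 ⊠ k8)))
      ≈⟨ ⊟-cong (≈-trans (solve 3 (λ q v k → q :* q :* (v :* v) :* (v :* k) := q :* q :* (v :* v :* v) :* k) ≈-refl q v8 (k8 ⊠ k8 ⊠ k8)) (≈-sym sqT)) ⟩
    ⊟ sq T ∎

  w-quadratic : w ⊠ w ≈ sq T ⊠ (const (+ 16) ⊠ w ⊞ 1ₛ)
  w-quadratic = begin
    w ⊠ w
      ≈⟨ solve 2 (λ a b → a :* a := a :* (a :+ b) :+ :- (a :* b)) ≈-refl w (alt w) ⟩
    w ⊠ (w ⊞ alt w) ⊞ ⊟ (w ⊠ alt w)
      ≈⟨ ⊞-cong (S.*-congˡ w-trace) (⊟-cong w-norm) ⟩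
    w ⊠ (const (+ 16) ⊠ sq T) ⊞ ⊟ ⊟ sq T
      ≈⟨ solve 2 (λ a t → a :* (con (+ 16) :* t) :+ :- (:- t) := t :* (con (+ 16) :* a :+ con 1ℤ)) ≈-refl w (sq T) ⟩
    sq T ⊠ (const (+ 16) ⊠ w ⊞ 1ₛ) ∎

  -- The f₂^24 in the numerator of T cancels the denominator of T(q²), leaving q³ f₄^24/f₁^24.
  w-cube : sq T ⊠ T ≈ w ^ˢ 3
  w-cube = begin
    sq T ⊠ (q ⊠ f₂ ^ˢ 24 ⊠ I₁ ^ˢ 24)
      ≈⟨ ⊠-cong sqT (⊠-cong (S.*-congˡ (^24 f₂)) (^24 I₁)) ⟩
    q ⊠ q ⊠ (v8 ⊠ v8 ⊠ v8) ⊠ (k8 ⊠ k8 ⊠ k8) ⊠ (q ⊠ (u8 ⊠ u8 ⊠ u8) ⊠ (i8 ⊠ i8 ⊠ i8))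
      ≈⟨ solve 5 (λ q v k u i → q :* q :* (v :* v :* v) :* (k :* k :* k) :* (q :* (u :* u :* u) :* (i :* i :* i))
           := (q :* v :* i) :^ 3 :* (u :* k :* (u :* k) :* (u :* k))) ≈-refl q v8 k8 u8 i8 ⟩
    w ^ˢ 3 ⊠ (u8 ⊠ k8 ⊠ (u8 ⊠ k8) ⊠ (u8 ⊠ k8))
      ≈⟨ S.*-congˡ (⊠-cong (⊠-cong u8k8 u8k8) u8k8) ⟩
    w ^ˢ 3 ⊠ (1ₛ ⊠ 1ₛ ⊠ 1ₛ)
      ≈⟨ solve 1 (λ a → a :* (con 1ℤ :* con 1ℤ :* con 1ℤ) := a) ≈-refl (w ^ˢ 3) ⟩
    w ^ˢ 3 ∎

  -- Isolates in q/f₁⁸ the factor 1/f₄⁸, a series in q² that can be taken out of an even part, where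
  -- it becomes 1/f₂⁸.
  qi8 : q ⊠ i8 ≈ sq k8 ⊠ w
  qi8 = begin
    q ⊠ i8                     ≈⟨ S.*-identityˡ (q ⊠ i8) ⟨
    1ₛ ⊠ (q ⊠ i8)              ≈⟨ S.*-congʳ v8k ⟨
    v8 ⊠ sq k8 ⊠ (q ⊠ i8)      ≈⟨ solve 4 (λ v k q i → v :* k :* (q :* i) := k :* (q :* v :* i)) ≈-refl v8 (sq k8) q i8 ⟩
    sq k8 ⊠ w                  ∎
    where
    v8k : v8 ⊠ sq k8 ≈ 1ₛ
    v8k = ≈-trans (S.*-congʳ (≈-sym (sq-^ f₂ 8))) (sq-unit u8k8)

  -- T is q times a series with constant term 1: the latter cancels as a unit, q by shifting
  -- coefficients.
  T-cancel : ∀ {a b} → T ⊠ a ≈ T ⊠ b → a ≈ b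
  T-cancel {a} {b} p = unit-cancel {f₂ ^ˢ 24 ⊠ I₁ ^ˢ 24} (⊠-inv (⊠-head (^-head {f₂} 24 refl) (^-head {I₁} 24 refl)))
    (q-cancel (≈-trans (≈-sym (regroup a)) (≈-trans p (regroup b))))
    where
    regroup : ∀ a → T ⊠ a ≈ q ⊠ (f₂ ^ˢ 24 ⊠ I₁ ^ˢ 24 ⊠ a)
    regroup a = solve 4 (λ q u i a → q :* u :* i :* a := q :* (u :* i :* a)) ≈-refl q (f₂ ^ˢ 24) (I₁ ^ˢ 24) a

  T^-cancel : ∀ i {a b} → T ^ˢ i ⊠ a ≈ T ^ˢ i ⊠ b → a ≈ b
  T^-cancel zero    {a} {b} p = ≈-trans (≈-sym (S.*-identityˡ a)) (≈-trans p (S.*-identityˡ b))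
  T^-cancel (suc i) {a} {b} p = T^-cancel i (T-cancel
    (≈-trans (≈-sym (⊠-assoc T (T ^ˢ i) a)) (≈-trans p (⊠-assoc T (T ^ˢ i) b))))

open Modular using (i8; k8; qi8; w-trace; w-quadratic; w-cube; T^-cancel)

-- Polynomials in T without constant term

polyT : ℕ → (ℕ → ℤ) → PS
polyT zero    c = 0ₛ
polyT (suc N) c = polyT N c ⊞ const (c (suc N)) ⊠ T ^ˢ suc N

polyT-cong : ∀ N {c d} → (∀ k → c (suc k) ≡ d (suc k)) → polyT N c ≈ polyT N d
polyT-cong zero    p = ≈-refl
polyT-cong (suc N) p = ⊞-cong (polyT-cong N p) (S.reflexive (cong (λ t → const t ⊠ T ^ˢ suc N) (p N)))

polyT-⊞ : ∀ N c d → polyT N (λ k → c k ℤ.+ d k) ≈ polyT N c ⊞ polyT N d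
polyT-⊞ zero    c d = ≈-sym (S.+-identityˡ 0ₛ)
polyT-⊞ (suc N) c d = begin
  polyT N (λ k → c k ℤ.+ d k) ⊞ const (c (suc N) ℤ.+ d (suc N)) ⊠ T ^ˢ suc N
    ≈⟨ ⊞-cong (polyT-⊞ N c d) (S.*-congʳ (const-⊞ (c (suc N)) (d (suc N)))) ⟩
  polyT N c ⊞ polyT N d ⊞ (const (c (suc N)) ⊞ const (d (suc N))) ⊠ T ^ˢ suc N
    ≈⟨ solve 5 (λ a b x y t → a :+ b :+ (x :+ y) :* t := a :+ x :* t :+ (b :+ y :* t)) ≈-refl
         (polyT N c) (polyT N d) (const (c (suc N))) (const (d (suc N))) (T ^ˢ suc N) ⟩
  polyT (suc N) c ⊞ polyT (suc N) d ∎
  where open Ring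

polyT-scale : ∀ N a c → polyT N (λ k → a ℤ.* c k) ≈ const a ⊠ polyT N c
polyT-scale zero    a c = ≈-sym (S.zeroʳ (const a))
polyT-scale (suc N) a c = begin
  polyT N (λ k → a ℤ.* c k) ⊞ const (a ℤ.* c (suc N)) ⊠ T ^ˢ suc N
    ≈⟨ ⊞-cong (polyT-scale N a c) (S.*-congʳ (const-* a (c (suc N)))) ⟩
  const a ⊠ polyT N c ⊞ const a ⊠ const (c (suc N)) ⊠ T ^ˢ suc N
    ≈⟨ solve 4 (λ a p c t → a :* p :+ a :* c :* t := a :* (p :+ c :* t)) ≈-refl (const a) (polyT N c) (const (c (suc N))) (T ^ˢ suc N) ⟩
  const a ⊠ polyT (suc N) c ∎
  where open Ring

polyT-zero : ∀ N {c} → (∀ k → k < N → c (suc k) ≡ 0ℤ) → polyT N c ≈ 0ₛ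
polyT-zero zero    p = ≈-refl
polyT-zero (suc N) p = ≈-trans
  (⊞-cong (polyT-zero N (λ k k<N → p k (ℕₚ.m≤n⇒m≤1+n k<N)))
    (≈-trans (S.reflexive (cong (λ t → const t ⊠ T ^ˢ suc N) (p N ℕₚ.≤-refl))) (S.zeroˡ (T ^ˢ suc N))))
  (S.+-identityˡ 0ₛ)

polyT-split : ∀ i n c → polyT (i + n) c ≈ polyT i c ⊞ T ^ˢ i ⊠ polyT n (λ j → c (i + j))
polyT-split i zero c = begin
  polyT (i + 0) c                 ≡⟨ cong (λ k → polyT k c) (ℕₚ.+-identityʳ i) ⟩
  polyT i c                       ≈⟨ S.+-identityʳ (polyT i c) ⟨
  polyT i c ⊞ 0ₛ                  ≈⟨ ⊞-cong ≈-refl (S.zeroʳ (T ^ˢ i)) ⟨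
  polyT i c ⊞ T ^ˢ i ⊠ 0ₛ         ∎
polyT-split i (suc n) c = begin
  polyT (i + suc n) c
    ≡⟨ cong (λ k → polyT k c) (ℕₚ.+-suc i n) ⟩
  polyT (i + n) c ⊞ const (c (suc (i + n))) ⊠ T ^ˢ suc (i + n)
    ≡⟨ cong (λ k → polyT (i + n) c ⊞ const (c k) ⊠ T ^ˢ k) (ℕₚ.+-suc i n) ⟨
  polyT (i + n) c ⊞ const (c (i + suc n)) ⊠ T ^ˢ (i + suc n)
    ≈⟨ ⊞-cong (polyT-split i n c) (S.*-congˡ (^-homo-* T i (suc n))) ⟩
  polyT i c ⊞ T ^ˢ i ⊠ polyT n (λ j → c (i + j)) ⊞ const (c (i + suc n)) ⊠ (T ^ˢ i ⊠ T ^ˢ suc n)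
    ≈⟨ solve 5 (λ a t b c s → a :+ t :* b :+ c :* (t :* s) := a :+ t :* (b :+ c :* s)) ≈-refl
         (polyT i c) (T ^ˢ i) (polyT n (λ j → c (i + j))) (const (c (i + suc n))) (T ^ˢ suc n) ⟩
  polyT i c ⊞ T ^ˢ i ⊠ polyT (suc n) (λ j → c (i + j)) ∎
  where open Ring

Supported : ℕ → (ℕ → ℤ) → Set
Supported N c = ∀ k → N < k → c k ≡ 0ℤ

polyT-extend : ∀ {N M c} → Supported N c → N ≤ M → polyT M c ≈ polyT N c
polyT-extend {N} {M} {c} supp N≤M = begin
  polyT M c                                           ≡⟨ cong (λ k → polyT k c) (ℕₚ.m+[n∸m]≡n N≤M) ⟨
  polyT (N + (M ∸ N)) c                               ≈⟨ polyT-split N (M ∸ N) c ⟩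
  polyT N c ⊞ T ^ˢ N ⊠ polyT (M ∸ N) (λ j → c (N + j)) ≈⟨ ⊞-cong ≈-refl (S.*-congˡ (polyT-zero (M ∸ N)
                                                          (λ k _ → supp (N + suc k) (ℕₚ.m<m+n N (s≤s z≤n))))) ⟩
  polyT N c ⊞ T ^ˢ N ⊠ 0ₛ                             ≈⟨ solve 2 (λ a b → a :+ b :* con 0ℤ := a) ≈-refl (polyT N c) (T ^ˢ N) ⟩
  polyT N c                                           ∎
  where open Ring

-- The matrix M and the even parts of powers of w

m-above : ∀ r → Supported r (m r)
m-above zero k _ = refl
m-above (suc zero) (suc (suc k)) _ = refl
m-above (suc (suc zero)) (suc (suc (suc k))) _ = refl
m-above (suc zero) (suc zero) (s≤s ())
m-above (suc (suc zero)) (suc zero) (s≤s ())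
m-above (suc (suc zero)) (suc (suc zero)) (s≤s (s≤s ()))
m-above (suc (suc (suc r))) (suc zero) (s≤s ())
m-above (suc (suc (suc r))) (suc (suc k)) (s≤s r<k) =
  cong₂ (λ s t → + 16 ℤ.* s ℤ.+ t) (m-above (suc (suc r)) (suc k) r<k) (m-above (suc r) (suc k) (ℕₚ.<-trans (ℕₚ.n<1+n (suc r)) r<k))

-- The recursion goes back one column and at most two rows, so row r is zero to the left of column
-- r/2. This makes rows 3i and 3i + 1 divisible by T^i and lets the sums defining `x` stop at i =
-- 2j.
m-below : ∀ r k → 2 * k < r → m r k ≡ 0ℤ
m-below (suc zero) zero _ = refl
m-below (suc (suc zero)) zero _ = refl
m-below (suc (suc (suc r))) zero _ = refl
m-below (suc zero) (suc k) (s≤s ())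
m-below (suc (suc zero)) (suc k) (s≤s (s≤s p)) with () ← subst (_≤ 0) (ℕₚ.+-suc k (k + 0)) p
m-below (suc (suc (suc r))) (suc zero) _ = refl
m-below (suc (suc (suc r))) (suc (suc k)) p =
  cong₂ (λ s t → + 16 ℤ.* s ℤ.+ t) (m-below (suc (suc r)) (suc k) (ℕₚ.m≤n⇒m≤1+n small)) (m-below (suc r) (suc k) small)
  where
  small : 2 * suc k < suc r
  small = ℕₚ.≤-pred (ℕₚ.≤-pred (subst (_< suc (suc (suc r))) (ℕₚ.*-suc 2 (suc k)) p))

evens-1 : evens 1ₛ ≈ 1ₛ
evens-1 = begin
  evens 1ₛ            ≈⟨ evens-cong (≈-trans (S.*-congʳ (sq-const 1ℤ)) (S.*-identityˡ 1ₛ)) ⟨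
  evens (sq 1ₛ ⊠ 1ₛ)  ≈⟨ evens-sq-⊠ 1ₛ 1ₛ ⟩
  1ₛ ⊠ evens 1ₛ       ≈⟨ S.*-identityˡ (evens 1ₛ) ⟩
  evens 1ₛ            ≈⟨ pointwise pt ⟩
  1ₛ                  ∎
  where
  pt : ∀ n → evens 1ₛ n ≡ 1ₛ n
  pt zero    = refl
  pt (suc n) = trans (evens-at 1ₛ (suc n)) (trans (const-suc 1ℤ _) (sym (const-suc 1ℤ n)))

evens-const-⊠ : ∀ c a → evens (const c ⊠ a) ≈ const c ⊠ evens a
evens-const-⊠ c a = ≈-trans (evens-cong (S.*-congʳ (≈-sym (sq-const c)))) (evens-sq-⊠ (const c) a)

-- w(q) and w(-q) have the same even part, so twice it is the even part of their sum 16 T(q²).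
-- Cancelling 2 in ℤ leaves 8, the entry `m 1 1`.
evens-w : evens w ≈ const (+ 8) ⊠ T
evens-w = pointwise λ n → ℤₚ.*-cancelˡ-≡ (+ 2) _ _ (trans (sym (const-⊠ (+ 2) (evens w) n))
  (trans (at doubled n) (const-⊠ (+ 2) (const (+ 8) ⊠ T) n)))
  where
  open Ring
  doubled : const (+ 2) ⊠ evens w ≈ const (+ 2) ⊠ (const (+ 8) ⊠ T)
  doubled = begin
    const (+ 2) ⊠ evens w              ≈⟨ solve 1 (λ a → con (+ 2) :* a := a :+ a) ≈-refl (evens w) ⟩
    evens w ⊞ evens w                  ≈⟨ ⊞-cong ≈-refl (evens-alt w) ⟨
    evens w ⊞ evens (alt w)            ≈⟨ evens-⊞ w (alt w) ⟨
    evens (w ⊞ alt w)                  ≈⟨ evens-cong (≈-trans w-trace (⊠-comm (const (+ 16)) (sq T))) ⟩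
    evens (sq T ⊠ const (+ 16))        ≈⟨ evens-sq-⊠ T (const (+ 16)) ⟩
    T ⊠ evens (const (+ 16))           ≈⟨ S.*-congˡ (≈-trans (evens-cong (≈-sym (S.*-identityʳ (const (+ 16)))))
                                            (≈-trans (evens-const-⊠ (+ 16) 1ₛ) (S.*-congˡ evens-1))) ⟩
    T ⊠ (const (+ 16) ⊠ 1ₛ)            ≈⟨ solve 1 (λ t → t :* (con (+ 16) :* con 1ℤ) := con (+ 2) :* (con (+ 8) :* t)) ≈-refl T ⟩
    const (+ 2) ⊠ (const (+ 8) ⊠ T)    ∎

evens-w^-step : ∀ j → evens (w ^ˢ suc (suc j)) ≈ T ⊠ (const (+ 16) ⊠ evens (w ^ˢ suc j) ⊞ evens (w ^ˢ j))
evens-w^-step j = begin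
  evens (w ⊠ (w ⊠ w ^ˢ j))
    ≈⟨ evens-cong (≈-trans (≈-sym (⊠-assoc w w (w ^ˢ j))) (S.*-congʳ w-quadratic)) ⟩
  evens (sq T ⊠ (const (+ 16) ⊠ w ⊞ 1ₛ) ⊠ w ^ˢ j)
    ≈⟨ evens-cong (solve 3 (λ t w v → t :* (con (+ 16) :* w :+ con 1ℤ) :* v := t :* (con (+ 16) :* (w :* v) :+ v)) ≈-refl (sq T) w (w ^ˢ j)) ⟩
  evens (sq T ⊠ (const (+ 16) ⊠ w ^ˢ suc j ⊞ w ^ˢ j))
    ≈⟨ evens-sq-⊠ T _ ⟩
  T ⊠ evens (const (+ 16) ⊠ w ^ˢ suc j ⊞ w ^ˢ j)
    ≈⟨ S.*-congˡ (≈-trans (evens-⊞ _ _) (⊞-cong (evens-const-⊠ (+ 16) (w ^ˢ suc j)) ≈-refl)) ⟩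
  T ⊠ (const (+ 16) ⊠ evens (w ^ˢ suc j) ⊞ evens (w ^ˢ j)) ∎
  where open Ring

-- The factor T in `evens-w^-step` is the shift by one column in the recursion for M. The second
-- power is a separate base case because w^0 = 1 is constant and corresponds to no row: it yields
-- the entry 1, while 128 = 16 · 8.
evens-w^ : ∀ j → evens (w ^ˢ suc j) ≈ polyT (suc j) (m (suc j))
evens-w^ zero = begin
  evens (w ⊠ 1ₛ)                       ≈⟨ evens-cong (S.*-identityʳ w) ⟩
  evens w                              ≈⟨ evens-w ⟩
  const (+ 8) ⊠ T                      ≈⟨ solve 1 (λ t → con (+ 8) :* t := con 0ℤ :+ con (+ 8) :* (t :* con 1ℤ)) ≈-refl T ⟩
  0ₛ ⊞ const (+ 8) ⊠ (T ⊠ 1ₛ)          ∎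
  where open Ring
evens-w^ (suc zero) = begin
  evens (w ^ˢ 2)
    ≈⟨ evens-w^-step 0 ⟩
  T ⊠ (const (+ 16) ⊠ evens (w ^ˢ 1) ⊞ evens 1ₛ)
    ≈⟨ S.*-congˡ (⊞-cong (S.*-congˡ (evens-w^ zero)) evens-1) ⟩
  T ⊠ (const (+ 16) ⊠ polyT 1 (m 1) ⊞ 1ₛ)
    ≈⟨ solve 1 (λ t → t :* (con (+ 16) :* (con 0ℤ :+ con (+ 8) :* (t :* con 1ℤ)) :+ con 1ℤ)
         := con 0ℤ :+ con 1ℤ :* (t :* con 1ℤ) :+ con (+ 128) :* (t :* (t :* con 1ℤ))) ≈-refl T ⟩
  polyT 2 (m 2) ∎
  where open Ring
evens-w^ (suc (suc j)) = begin
  evens (w ^ˢ suc (suc (suc j)))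
    ≈⟨ evens-w^-step (suc j) ⟩
  T ⊠ (const (+ 16) ⊠ evens (w ^ˢ suc (suc j)) ⊞ evens (w ^ˢ suc j))
    ≈⟨ S.*-congˡ (⊞-cong (S.*-congˡ (evens-w^ (suc j)))
         (≈-trans (evens-w^ j) (≈-sym (polyT-extend (m-above (suc j)) (ℕₚ.n≤1+n (suc j)))))) ⟩
  T ⊠ (const (+ 16) ⊠ polyT (suc (suc j)) (m (suc (suc j))) ⊞ polyT (suc (suc j)) (m (suc j)))
    ≈⟨ S.*-congˡ (⊞-cong (polyT-scale (suc (suc j)) (+ 16) (m (suc (suc j)))) ≈-refl) ⟨
  T ⊠ (polyT (suc (suc j)) (λ k → + 16 ℤ.* m (suc (suc j)) k) ⊞ polyT (suc (suc j)) (m (suc j)))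
    ≈⟨ S.*-congˡ (polyT-⊞ (suc (suc j)) (λ k → + 16 ℤ.* m (suc (suc j)) k) (m (suc j))) ⟨
  T ⊠ polyT (suc (suc j)) (λ k → + 16 ℤ.* m (suc (suc j)) k ℤ.+ m (suc j) k)
    ≈⟨ S.*-congˡ (polyT-cong (suc (suc j)) (λ k → refl)) ⟩
  T ⊠ polyT (suc (suc j)) (λ k → m (suc (suc (suc j))) (1 + k))
    -- The zero coefficient inserted at T is the first column of M, which vanishes from row 3 on.
    ≈⟨ solve 2 (λ t p → t :* p := con 0ℤ :+ con 0ℤ :* (t :* con 1ℤ) :+ (t :* con 1ℤ) :* p) ≈-refl T _ ⟩
  polyT 1 (m (suc (suc (suc j)))) ⊞ T ^ˢ 1 ⊠ polyT (suc (suc j)) (λ k → m (suc (suc (suc j))) (1 + k))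
    ≈⟨ polyT-split 1 (suc (suc j)) (m (suc (suc (suc j)))) ⟨
  polyT (suc (suc (suc j))) (m (suc (suc (suc j)))) ∎
  where open Ring

-- T has no inverse, so both sides are multiplied by T^i, which turns the left one into the even
-- part of w^(3i+e). The columns up to i of that row vanish by `m-below`, and T^i cancels. The
-- exponent of T is positive since for i = e = 0 the even part is the constant 1.
evens-w^T^ : ∀ e i → evens (w ^ˢ e ⊠ T ^ˢ suc i) ≈ polyT (2 * suc i + e) (λ j → m (3 * suc i + e) (suc i + j))
evens-w^T^ e i′ = T^-cancel i (begin
  T ^ˢ i ⊠ evens (w ^ˢ e ⊠ T ^ˢ i)
    ≈⟨ evens-sq-⊠ (T ^ˢ i) (w ^ˢ e ⊠ T ^ˢ i) ⟨
  evens (sq (T ^ˢ i) ⊠ (w ^ˢ e ⊠ T ^ˢ i))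
    ≈⟨ evens-cong to-w ⟩
  evens (w ^ˢ (3 * i + e))
    ≈⟨ evens-w^ (i′ + 2 * i + e) ⟩
  polyT (3 * i + e) (m (3 * i + e))
    ≡⟨ cong (λ k → polyT k (m (3 * i + e))) (ℕₚ.+-assoc i (2 * i) e) ⟩
  polyT (i + (2 * i + e)) (m (3 * i + e))
    ≈⟨ polyT-split i (2 * i + e) (m (3 * i + e)) ⟩
  polyT i (m (3 * i + e)) ⊞ T ^ˢ i ⊠ P
    ≈⟨ ⊞-cong (polyT-zero i (λ k k<i → m-below (3 * i + e) (suc k) (small k<i))) ≈-refl ⟩
  0ₛ ⊞ T ^ˢ i ⊠ P
    ≈⟨ S.+-identityˡ _ ⟩
  T ^ˢ i ⊠ P ∎)
  where
  open Ring
  i = suc i′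
  P = polyT (2 * i + e) (λ j → m (3 * i + e) (i + j))
  to-w : sq (T ^ˢ i) ⊠ (w ^ˢ e ⊠ T ^ˢ i) ≈ w ^ˢ (3 * i + e)
  to-w = begin
    sq (T ^ˢ i) ⊠ (w ^ˢ e ⊠ T ^ˢ i)       ≈⟨ S.*-congʳ (sq-^ T i) ⟩
    sq T ^ˢ i ⊠ (w ^ˢ e ⊠ T ^ˢ i)         ≈⟨ solve 3 (λ a b c → a :* (b :* c) := a :* c :* b) ≈-refl (sq T ^ˢ i) (w ^ˢ e) (T ^ˢ i) ⟩
    sq T ^ˢ i ⊠ T ^ˢ i ⊠ w ^ˢ e           ≈⟨ S.*-congʳ (^-distrib-* (sq T) T i) ⟨
    (sq T ⊠ T) ^ˢ i ⊠ w ^ˢ e              ≈⟨ S.*-congʳ (≈-trans (^-congˡ i w-cube) (^-assocʳ w 3 i)) ⟩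
    w ^ˢ (3 * i) ⊠ w ^ˢ e                 ≈⟨ ^-homo-* w (3 * i) e ⟨
    w ^ˢ (3 * i + e)                      ∎
  small : ∀ {k} → k < i → 2 * suc k < 3 * i + e
  small {k} k<i = ℕₚ.≤-trans (s≤s (ℕₚ.*-monoʳ-≤ 2 k<i))
    (ℕₚ.≤-trans (ℕₚ.+-monoˡ-≤ (2 * i) (s≤s z≤n)) (ℕₚ.m≤m+n (3 * i) e))

-- The recursion for x

Σ₁-suc : ∀ N g → Σ₁ (suc N) g ≡ Σ₁ N g ℤ.+ g (suc N)
Σ₁-suc N g = go 1 N
  where
  go : ∀ a N → sumFrom a (suc N) g ≡ sumFrom a N g ℤ.+ g (a + N)
  go a zero    = trans (ℤₚ.+-identityʳ (g a))
    (trans (cong g (sym (ℕₚ.+-identityʳ a))) (sym (ℤₚ.+-identityˡ (g (a + 0)))))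
  go a (suc N) = trans (cong (λ t → g a ℤ.+ t) (go (suc a) N))
    (trans (sym (ℤₚ.+-assoc (g a) (sumFrom (suc a) N g) (g (suc a + N))))
      (cong (λ k → g a ℤ.+ sumFrom (suc a) N g ℤ.+ g k) (sym (ℕₚ.+-suc a N))))

Σ₁-cong : ∀ N {g h} → (∀ i → g i ≡ h i) → Σ₁ N g ≡ Σ₁ N h
Σ₁-cong zero    p = refl
Σ₁-cong (suc N) {g} {h} p = trans (Σ₁-suc N g) (trans (cong₂ ℤ._+_ (Σ₁-cong N p) (p (suc N))) (sym (Σ₁-suc N h)))

Σ₁-extend : ∀ {N M g} → Supported N g → N ≤ M → Σ₁ M g ≡ Σ₁ N g
Σ₁-extend {N} {M} {g} supp N≤M = go (ℕₚ.≤⇒≤′ N≤M)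
  where
  go : ∀ {M} → N ≤′ M → Σ₁ M g ≡ Σ₁ N g
  go ≤′-refl           = refl
  go (≤′-step {M} N≤M) = trans (Σ₁-suc M g)
    (trans (cong₂ ℤ._+_ (go N≤M) (supp (suc M) (s≤s (ℕₚ.≤′⇒≤ N≤M)))) (ℤₚ.+-identityʳ (Σ₁ N g)))

Σ₁-supports : ∀ {N M g} → Supported N g → Supported M g → Σ₁ N g ≡ Σ₁ M g
Σ₁-supports {N} {M} sN sM with ℕₚ.≤-total N M
... | inj₁ N≤M = sym (Σ₁-extend sN N≤M)
... | inj₂ M≤N = Σ₁-extend sM M≤N

-- One step of the recursion for `x`; `e` is the exponent of the accompanying w, 0 after an odd and
-- 1 after an even level.
next : ℕ → (ℕ → ℤ) → ℕ → ℤ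
next e c j = Σ₁ (2 * j) (λ i → c i ℤ.* m (3 * i + e) (i + j))

next-bound : ∀ e i j → 2 * i + e < j → m (3 * i + e) (i + j) ≡ 0ℤ
next-bound e i j p = m-above (3 * i + e) (i + j)
  (subst (_< i + j) (sym (ℕₚ.+-assoc i (2 * i) e)) (ℕₚ.+-monoʳ-< i p))

-- For i > 2j one has 2(i + j) < 3i, so `m-below` applies and cutting the sum at 2j loses nothing.
next-term-support : ∀ e (c : ℕ → ℤ) j → Supported (2 * j) (λ i → c i ℤ.* m (3 * i + e) (i + j))
next-term-support e c j i 2j<i = trans (cong (c i ℤ.*_) (m-below (3 * i + e) (i + j) bound)) (ℤₚ.*-zeroʳ (c i))
  where
  bound : 2 * (i + j) < 3 * i + e
  bound = ℕₚ.≤-trans (subst (_< 3 * i) (sym (ℕₚ.*-distribˡ-+ 2 i j))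
      (subst (2 * i + 2 * j <_) (ℕₚ.+-comm (2 * i) i) (ℕₚ.+-monoʳ-< (2 * i) 2j<i)))
    (ℕₚ.m≤m+n (3 * i) e)

-- The even part of w^e T^i has degree at most 2i + e in T. Iterated from 1 with e = 0 and e = 1 in
-- turn, this produces the bounds 1, 2, 5, 10, ... of the theorem.
next-support : ∀ e {N c} → Supported N c → Supported (2 * N + e) (next e c)
next-support e {N} {c} supp j p = Σ₁-extend {0} {2 * j} vanishing z≤n
  where
  vanishing : Supported 0 (λ i → c i ℤ.* m (3 * i + e) (i + j))
  vanishing i _ with ℕₚ.<-≤-connex N i
  ... | inj₁ N<i = cong (ℤ._* m (3 * i + e) (i + j)) (supp i N<i)
  ... | inj₂ i≤N = trans (cong (c i ℤ.*_) (next-bound e i j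
          (ℕₚ.≤-<-trans (ℕₚ.+-monoˡ-≤ e (ℕₚ.*-monoʳ-≤ 2 i≤N)) p))) (ℤₚ.*-zeroʳ (c i))

-- Linearity reduces this to monomials, all padded to the common length 2N + e. The sum over i then
-- stops at N in every column, whereas `next` stops at 2j; both cut-offs lie beyond the nonzero
-- terms.
evens-polyT : ∀ e N c → Supported N c → evens (w ^ˢ e ⊠ polyT N c) ≈ polyT (2 * N + e) (next e c)
evens-polyT e N c supp = ≈-trans (go N ℕₚ.≤-refl) (polyT-cong (2 * N + e) λ j →
    Σ₁-supports {N} {2 * suc j} (λ i N<i → cong (ℤ._* m (3 * i + e) (i + suc j)) (supp i N<i)) (next-term-support e c (suc j)))
  where
  open Ring
  M = 2 * N + e
  go : ∀ n → n ≤ N → evens (w ^ˢ e ⊠ polyT n c) ≈ polyT M (λ j → Σ₁ n (λ i → c i ℤ.* m (3 * i + e) (i + j)))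
  go zero    _   = begin
    evens (w ^ˢ e ⊠ 0ₛ)               ≈⟨ evens-cong (⊠-comm (w ^ˢ e) 0ₛ) ⟩
    evens (0ₛ ⊠ w ^ˢ e)               ≈⟨ evens-const-⊠ 0ℤ (w ^ˢ e) ⟩
    0ₛ ⊠ evens (w ^ˢ e)               ≈⟨ S.zeroˡ _ ⟩
    0ₛ                                ≈⟨ polyT-zero M (λ _ _ → refl) ⟨
    polyT M (λ j → 0ℤ)                ∎
  go (suc n) n<N = begin
    evens (w ^ˢ e ⊠ (polyT n c ⊞ const (c i) ⊠ T ^ˢ i))
      ≈⟨ evens-cong (solve 4 (λ w p c t → w :* (p :+ c :* t) := w :* p :+ c :* (w :* t)) ≈-refl (w ^ˢ e) (polyT n c) (const (c i)) (T ^ˢ i)) ⟩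
    evens (w ^ˢ e ⊠ polyT n c ⊞ const (c i) ⊠ (w ^ˢ e ⊠ T ^ˢ i))
      ≈⟨ ≈-trans (evens-⊞ _ _) (⊞-cong (go n (ℕₚ.<⇒≤ n<N)) (evens-const-⊠ (c i) (w ^ˢ e ⊠ T ^ˢ i))) ⟩
    polyT M (λ j → Σ₁ n (term j)) ⊞ const (c i) ⊠ evens (w ^ˢ e ⊠ T ^ˢ i)
      ≈⟨ ⊞-cong ≈-refl (S.*-congˡ (≈-trans (evens-w^T^ e n)
           (≈-sym (polyT-extend (next-bound e i) (ℕₚ.+-monoˡ-≤ e (ℕₚ.*-monoʳ-≤ 2 n<N)))))) ⟩
    polyT M (λ j → Σ₁ n (term j)) ⊞ const (c i) ⊠ polyT M (λ j → m (3 * i + e) (i + j))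
      ≈⟨ ⊞-cong ≈-refl (polyT-scale M (c i) (λ j → m (3 * i + e) (i + j))) ⟨
    polyT M (λ j → Σ₁ n (term j)) ⊞ polyT M (λ j → term j i)
      ≈⟨ polyT-⊞ M (λ j → Σ₁ n (term j)) (λ j → term j i) ⟨
    polyT M (λ j → Σ₁ n (term j) ℤ.+ term j i)
      ≈⟨ polyT-cong M (λ j → sym (Σ₁-suc n (term (suc j)))) ⟩
    polyT M (λ j → Σ₁ (suc n) (term j)) ∎
    where
    i = suc n
    term : ℕ → ℕ → ℤ
    term j i = c i ℤ.* m (3 * i + e) (i + j)

odd-2* : ∀ β → odd (2 * β) ≡ false
odd-2* zero    = refl
odd-2* (suc β) = trans (cong odd (ℕₚ.*-suc 2 β)) (cong (λ b → not (not b)) (odd-2* β))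

x-after-odd : ∀ β j → x (2 + 2 * β) j ≡ next 0 (x (1 + 2 * β)) j
x-after-odd β j rewrite odd-2* β =
  Σ₁-cong (2 * j) λ i → cong (λ r → x (1 + 2 * β) i ℤ.* m r (i + j)) (sym (ℕₚ.+-identityʳ (3 * i)))

x-after-even : ∀ β j → x (3 + 2 * β) j ≡ next 1 (x (2 + 2 * β)) j
x-after-even β j rewrite odd-2* β = refl

-- deg α = (4^α − 1) / 3
deg : ℕ → ℕ
deg zero    = 0
deg (suc α) = 2 * (2 * deg α) + 1

supported-cong : ∀ {N c d} → (∀ j → c j ≡ d j) → Supported N d → Supported N c
supported-cong p supp k N<k = trans (p k) (supp k N<k)

x-odd-support : ∀ β → Supported (deg (suc β)) (x (1 + 2 * β))
x-even-support : ∀ β → Supported (2 * deg (suc β)) (x (2 + 2 * β))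

x-odd-support zero    (suc (suc k)) _ = refl
x-odd-support zero    (suc zero) (s≤s ())
x-odd-support (suc β) = subst (λ a → Supported (deg (suc (suc β))) (x (suc a))) (sym (ℕₚ.*-suc 2 β))
  (supported-cong (x-after-even β) (next-support 1 (x-even-support β)))

x-even-support β = subst (λ N → Supported N (x (2 + 2 * β))) (ℕₚ.+-identityʳ (2 * deg (suc β)))
  (supported-cong (x-after-odd β) (next-support 0 (x-odd-support β)))

-- Passing from one level to the next

evens-shiftSeq : ∀ g → evens (shiftSeq g) ≈ shiftSeq (λ k → g (2 * k + 1))
evens-shiftSeq g = pointwise λ where
  zero    → refl
  (suc n) → trans (evens-at (shiftSeq g) (suc n)) (cong (shiftSeq g) (trans (ℕₚ.*-suc 2 n) (cong suc (ℕₚ.+-comm 1 (2 * n)))))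

-- In Σ g(n) q^(n+1) the even exponents belong to odd n; the extra factor q makes them belong to
-- even n.
evens-q-shiftSeq : ∀ g → evens (q ⊠ shiftSeq g) ≈ shiftSeq (λ k → g (2 * k))
evens-q-shiftSeq g = pointwise λ where
  zero    → ⊠-q-zero (shiftSeq g)
  (suc n) → trans (evens-at (q ⊠ shiftSeq g) (suc n)) (trans (cong (q ⊠ shiftSeq g) (ℕₚ.*-suc 2 n)) (⊠-q-suc (shiftSeq g) (suc (2 * n))))

shiftSeq≈ : ∀ g → shiftSeq g ≈ q ⊠ g
shiftSeq≈ g = pointwise λ where
  zero    → sym (⊠-q-zero g)
  (suc n) → sym (⊠-q-suc g n)

shiftSeq-cong : ∀ {g h} → (∀ k → g k ≡ h k) → shiftSeq g ≈ shiftSeq h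
shiftSeq-cong p = pointwise λ where
  zero    → refl
  (suc n) → p n

evens-qi8 : ∀ a → evens (q ⊠ (i8 ⊠ a)) ≈ k8 ⊠ evens (w ⊠ a)
evens-qi8 a = begin
  evens (q ⊠ (i8 ⊠ a))       ≈⟨ evens-cong (≈-trans (≈-sym (⊠-assoc q i8 a)) (S.*-congʳ qi8)) ⟩
  evens (sq k8 ⊠ w ⊠ a)      ≈⟨ evens-cong (⊠-assoc (sq k8) w a) ⟩
  evens (sq k8 ⊠ (w ⊠ a))    ≈⟨ evens-sq-⊠ k8 (w ⊠ a) ⟩
  k8 ⊠ evens (w ⊠ a)         ∎

p₈≈ : p₈ ≈ i8
p₈≈ = inv-pow 8 f₁-head

4^≡ : ∀ α → 4 ^ α ≡ 3 * deg α + 1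
4^≡ zero    = refl
4^≡ (suc α) = trans (cong (4 *_) (4^≡ α))
  (solve 1 (λ e → con 4 :* (con 3 :* e :+ con 1) := con 3 :* (con 2 :* (con 2 :* e) :+ con 1) :+ con 1) refl (deg α))
  where open ℕ-Solver

-- The two families are proved together, each level from the one before, with α = β + 1; p₈ itself
-- plays the part of level 0. The offset 2 `deg β` + 1 is (2^(2α-1) + 1)/3 without division. It is
-- unchanged from an even level to the next odd one, where even arguments are selected.
odd-level : ∀ β → shiftSeq (λ k → p₈ (2 * 4 ^ β * k + (2 * deg β + 1))) ≈ k8 ⊠ polyT (deg (suc β)) (x (1 + 2 * β))
even-level : ∀ β → shiftSeq (λ k → p₈ (4 ^ suc β * k + (2 * deg (suc β) + 1))) ≈ i8 ⊠ polyT (2 * deg (suc β)) (x (2 + 2 * β))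

odd-level zero = begin
  shiftSeq (λ k → p₈ (2 * k + 1))            ≈⟨ evens-shiftSeq p₈ ⟨
  evens (shiftSeq p₈)                        ≈⟨ evens-cong (≈-trans (shiftSeq≈ p₈) (S.*-congˡ (≈-trans p₈≈ (≈-sym (S.*-identityʳ i8))))) ⟩
  evens (q ⊠ (i8 ⊠ 1ₛ))                      ≈⟨ evens-qi8 1ₛ ⟩
  k8 ⊠ evens (w ^ˢ 1)                        ≈⟨ S.*-congˡ (evens-w^ 0) ⟩
  k8 ⊠ polyT 1 (m 1)                         ≈⟨ S.*-congˡ (polyT-cong 1 {m 1} {x 1} λ where zero → refl ; (suc k) → refl) ⟩
  k8 ⊠ polyT 1 (x 1)                         ∎
odd-level (suc β) = begin
  shiftSeq (λ k → p₈ (2 * 4 ^ suc β * k + (2 * deg (suc β) + 1)))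
    ≈⟨ shiftSeq-cong (λ k → cong (λ n → p₈ (n + (2 * deg (suc β) + 1)))
         (solve 2 (λ a k → con 2 :* a :* k := a :* (con 2 :* k)) refl (4 ^ suc β) k)) ⟩
  shiftSeq (λ k → p₈ (4 ^ suc β * (2 * k) + (2 * deg (suc β) + 1)))
    ≈⟨ evens-q-shiftSeq _ ⟨
  evens (q ⊠ shiftSeq (λ k → p₈ (4 ^ suc β * k + (2 * deg (suc β) + 1))))
    ≈⟨ evens-cong (S.*-congˡ (even-level β)) ⟩
  evens (q ⊠ (i8 ⊠ P))
    ≈⟨ evens-qi8 P ⟩
  k8 ⊠ evens (w ⊠ P)
    ≈⟨ S.*-congˡ (evens-cong (S.*-congʳ (≈-sym (S.*-identityʳ w)))) ⟩
  k8 ⊠ evens (w ^ˢ 1 ⊠ P)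
    ≈⟨ S.*-congˡ (evens-polyT 1 (2 * deg (suc β)) (x (2 + 2 * β)) (x-even-support β)) ⟩
  k8 ⊠ polyT (deg (suc (suc β))) (next 1 (x (2 + 2 * β)))
    ≈⟨ S.*-congˡ (polyT-cong (deg (suc (suc β))) (λ k → sym (x-after-even β (suc k)))) ⟩
  k8 ⊠ polyT (deg (suc (suc β))) (x (3 + 2 * β))
    ≡⟨ cong (λ a → k8 ⊠ polyT (deg (suc (suc β))) (x (suc a))) (ℕₚ.*-suc 2 β) ⟨
  k8 ⊠ polyT (deg (suc (suc β))) (x (1 + 2 * suc β)) ∎
  where
  open ℕ-Solver
  P = polyT (2 * deg (suc β)) (x (2 + 2 * β))

even-level β = begin
  shiftSeq (λ k → p₈ (4 ^ suc β * k + (2 * deg (suc β) + 1)))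
    ≈⟨ shiftSeq-cong (λ k → cong p₈ (index k)) ⟩
  shiftSeq (λ k → p₈ (2 * 4 ^ β * (2 * k + 1) + (2 * deg β + 1)))
    ≈⟨ evens-shiftSeq _ ⟨
  evens (shiftSeq (λ k → p₈ (2 * 4 ^ β * k + (2 * deg β + 1))))
    ≈⟨ evens-cong (≈-trans (odd-level β) (S.*-congʳ (≈-sym (sq-^ I₁ 8)))) ⟩
  evens (sq i8 ⊠ P)
    ≈⟨ evens-sq-⊠ i8 P ⟩
  i8 ⊠ evens P
    ≈⟨ S.*-congˡ (evens-cong (≈-sym (S.*-identityˡ P))) ⟩
  i8 ⊠ evens (w ^ˢ 0 ⊠ P)
    ≈⟨ S.*-congˡ (evens-polyT 0 (deg (suc β)) (x (1 + 2 * β)) (x-odd-support β)) ⟩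
  i8 ⊠ polyT (2 * deg (suc β) + 0) (next 0 (x (1 + 2 * β)))
    ≈⟨ S.*-congˡ (polyT-cong (2 * deg (suc β) + 0) (λ k → sym (x-after-odd β (suc k)))) ⟩
  i8 ⊠ polyT (2 * deg (suc β) + 0) (x (2 + 2 * β))
    ≡⟨ cong (λ N → i8 ⊠ polyT N (x (2 + 2 * β))) (ℕₚ.+-identityʳ (2 * deg (suc β))) ⟩
  i8 ⊠ polyT (2 * deg (suc β)) (x (2 + 2 * β)) ∎
  where
  open ℕ-Solver
  P = polyT (deg (suc β)) (x (1 + 2 * β))
  index : ∀ k → 4 ^ suc β * k + (2 * deg (suc β) + 1) ≡ 2 * 4 ^ β * (2 * k + 1) + (2 * deg β + 1)
  -- With 4^β = 3e + 1, selecting odd arguments moves the offset to 2(3e + 1) + (2e + 1) = 8e + 3 =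
  -- 2(4e + 1) + 1.
  index k rewrite 4^≡ β = solve 2 (λ e k →
    con 4 :* (con 3 :* e :+ con 1) :* k :+ (con 2 :* (con 2 :* (con 2 :* e) :+ con 1) :+ con 1)
    := con 2 :* (con 3 :* e :+ con 1) :* (con 2 :* k :+ con 1) :+ (con 2 :* e :+ con 1)) refl (deg β) k

-- Translation into the eta quotients and exponents of the theorem

summand : ℕ → PS
summand j = qpow j ⊛ pow (f 2) (24 * j) ⊛ inv (pow (f 1) (24 * j))

summand≈ : ∀ j → summand j ≈ T ^ˢ j
summand≈ j = begin
  a ⊛ b ⊛ c
    ≡⟨ trans (⊛≡⊠ (a ⊛ b) c) (cong (_⊠ c) (⊛≡⊠ a b)) ⟩
  a ⊠ b ⊠ c
    ≈⟨ ⊠-cong (⊠-cong (qpow≈ j) (≈-trans (pow≈ (f 2) (24 * j)) (^-congˡ (24 * j) f₂≈))) (inv-pow (24 * j) f₁-head) ⟩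
  q ^ˢ j ⊠ f₂ ^ˢ (24 * j) ⊠ I₁ ^ˢ (24 * j)
    ≈⟨ ⊠-cong (S.*-congˡ (^-assocʳ f₂ 24 j)) (^-assocʳ I₁ 24 j) ⟨
  q ^ˢ j ⊠ (f₂ ^ˢ 24) ^ˢ j ⊠ (I₁ ^ˢ 24) ^ˢ j
    ≈⟨ ≈-trans (^-distrib-* (q ⊠ f₂ ^ˢ 24) (I₁ ^ˢ 24) j) (S.*-congʳ (^-distrib-* q (f₂ ^ˢ 24) j)) ⟨
  T ^ˢ j ∎
  where
  a = qpow j
  b = pow (f 2) (24 * j)
  c = inv (pow (f 1) (24 * j))

psum≈ : ∀ N c (t : ℕ → PS) → (∀ j → t j ≈ T ^ˢ j) → psum N (λ j → scale (c j) (t j)) ≈ polyT N c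
psum≈ zero    c t t≈ = pointwise λ n → sym (0ₛ-at n)
psum≈ (suc N) c t t≈ = pointwise λ n → trans (Σ₁-suc N (λ j → c j ℤ.* t j n))
  (trans (cong₂ ℤ._+_ (at (psum≈ N c t t≈) n)
    (trans (cong (c (suc N) ℤ.*_) (at (t≈ (suc N)) n)) (sym (const-⊠ (c (suc N)) (T ^ˢ suc N) n))))
  (sym (⊞-at (polyT N c) (const (c (suc N)) ⊠ T ^ˢ suc N) n)))

inv-f₂ : inv (pow (f 2) 8) ≈ k8
inv-f₂ = ≈-trans (inv-pow 8 refl) (^-congˡ 8 (inverse-unique (⊠-inv refl)
  (≈-trans (S.*-congʳ f₂≈) (sq-unit (⊠-inv f₁-head)))))

2^1+2* : ∀ β → 2 ^ (1 + 2 * β) ≡ 2 * 4 ^ β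
2^1+2* β = cong (2 *_) (sym (ℕₚ.^-*-assoc 2 2 β))

-- The division is exact: 2(3e + 1) + 1 = 3(2e + 1) for e = `deg β`.
[2*4^+1]/3 : ∀ β → (2 * 4 ^ β + 1) / 3 ≡ 2 * deg β + 1
[2*4^+1]/3 β = trans (cong (λ n → (2 * n + 1) / 3) (4^≡ β)) (trans
  (cong (_/ 3) (solve 1 (λ e → con 2 :* (con 3 :* e :+ con 1) :+ con 1 := (con 2 :* e :+ con 1) :* con 3) refl (deg β)))
  (m*n/n≡m (2 * deg β + 1) 3))
  where open ℕ-Solver

4^-1 : ∀ α → 4 ^ α ∸ 1 ≡ deg α * 3
4^-1 α = trans (cong (_∸ 1) (4^≡ α)) (trans (ℕₚ.m+n∸n≡m (3 * deg α) 1) (ℕₚ.*-comm 3 (deg α)))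

[4^-1]/3 : ∀ α → (4 ^ α ∸ 1) / 3 ≡ deg α
[4^-1]/3 α = trans (cong (_/ 3) (4^-1 α)) (m*n/n≡m (deg α) 3)

[2*[4^-1]]/3 : ∀ α → (2 * (4 ^ α ∸ 1)) / 3 ≡ 2 * deg α
[2*[4^-1]]/3 α = trans (cong (λ n → (2 * n) / 3) (4^-1 α))
  (trans (cong (_/ 3) (sym (ℕₚ.*-assoc 2 (deg α) 3))) (m*n/n≡m (2 * deg α) 3))

theorem3p2 : (α : ℕ) → 1 ≤ α →
    ((n : ℕ) →
    shiftSeq (λ k → p₈ (2 ^ (2 * α ∸ 1) * k + (2 ^ (2 * α ∸ 1) + 1) / 3)) n
    ≡ (inv (pow (f 2) 8) ⊛ psum ((4 ^ α ∸ 1) / 3) (λ j → scale (x (2 * α ∸ 1) j) (qpow j ⊛ pow (f 2) (24 * j) ⊛ inv (pow (f 1) (24 * j))))) n)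
    ×
    ((n : ℕ) →
    shiftSeq (λ k → p₈ (2 ^ (2 * α) * k + (2 ^ (2 * α + 1) + 1) / 3)) n
    ≡ (inv (pow (f 1) 8) ⊛ psum ((2 * (4 ^ α ∸ 1)) / 3) (λ j → scale (x (2 * α) j) (qpow j ⊛ pow (f 2) (24 * j) ⊛ inv (pow (f 1) (24 * j))))) n)
theorem3p2 (suc β) _ = at odd-case , at even-case
  where
  α = suc β

  rhs : PS → ℕ → ℕ → PS
  rhs a N r = a ⊛ psum N (λ j → scale (x r j) (summand j))

  rhs≈ : ∀ {a b} → a ≈ b → ∀ N r → rhs a N r ≈ b ⊠ polyT N (x r)
  rhs≈ {a} p N r = ≈-trans (S.reflexive (⊛≡⊠ a (psum N (λ j → scale (x r j) (summand j)))))
    (⊠-cong p (psum≈ N (x r) summand summand≈))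

  progression : ℕ → ℕ → PS
  progression a b = shiftSeq (λ k → p₈ (a * k + b))

  odd-case : progression (2 ^ (2 * α ∸ 1)) ((2 ^ (2 * α ∸ 1) + 1) / 3)
           ≈ rhs (inv (pow (f 2) 8)) ((4 ^ α ∸ 1) / 3) (2 * α ∸ 1)
  odd-case = begin
    progression (2 ^ (2 * α ∸ 1)) ((2 ^ (2 * α ∸ 1) + 1) / 3)
      ≡⟨ cong₂ progression power (trans (cong (λ a → (a + 1) / 3) power) ([2*4^+1]/3 β)) ⟩
    progression (2 * 4 ^ β) (2 * deg β + 1)
      ≈⟨ odd-level β ⟩
    k8 ⊠ polyT (deg α) (x (1 + 2 * β))
      ≈⟨ rhs≈ inv-f₂ (deg α) (1 + 2 * β) ⟨
    rhs (inv (pow (f 2) 8)) (deg α) (1 + 2 * β)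
      ≡⟨ cong₂ (rhs (inv (pow (f 2) 8))) ([4^-1]/3 α) row ⟨
    rhs (inv (pow (f 2) 8)) ((4 ^ α ∸ 1) / 3) (2 * α ∸ 1) ∎
    where
    row : 2 * α ∸ 1 ≡ 1 + 2 * β
    row = cong (_∸ 1) (ℕₚ.*-suc 2 β)
    power : 2 ^ (2 * α ∸ 1) ≡ 2 * 4 ^ β
    power = trans (cong (2 ^_) row) (2^1+2* β)

  even-case : progression (2 ^ (2 * α)) ((2 ^ (2 * α + 1) + 1) / 3)
            ≈ rhs (inv (pow (f 1) 8)) ((2 * (4 ^ α ∸ 1)) / 3) (2 * α)
  even-case = begin
    progression (2 ^ (2 * α)) ((2 ^ (2 * α + 1) + 1) / 3)
      ≡⟨ cong₂ progression (sym (ℕₚ.^-*-assoc 2 2 α)) offset ⟩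
    progression (4 ^ α) (2 * deg α + 1)
      ≈⟨ even-level β ⟩
    i8 ⊠ polyT (2 * deg α) (x (2 + 2 * β))
      ≈⟨ rhs≈ p₈≈ (2 * deg α) (2 + 2 * β) ⟨
    rhs (inv (pow (f 1) 8)) (2 * deg α) (2 + 2 * β)
      ≡⟨ cong₂ (rhs (inv (pow (f 1) 8))) ([2*[4^-1]]/3 α) (ℕₚ.*-suc 2 β) ⟨
    rhs (inv (pow (f 1) 8)) ((2 * (4 ^ α ∸ 1)) / 3) (2 * α) ∎
    where
    offset : (2 ^ (2 * α + 1) + 1) / 3 ≡ 2 * deg α + 1
    offset = trans (cong (λ n → (n + 1) / 3) (trans (cong (2 ^_) (ℕₚ.+-comm (2 * α) 1)) (2^1+2* α))) ([2*4^+1]/3 α)
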